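{- Let $\alpha$ be a positive integer, $\gamma$ a positive integer, and $\varepsilon\in\{1,-1\}$. Let $F(z)$ be a formal power series with integer coefficients satisfying $$c_2(z)F^2(z)+c_1(z)F(z)+c_0(z)+3\,\mathcal Q\bigl(z;F(z),F'(z),\dots,F^{(s)}(z)\bigr)=0,$$ where $c_0,c_1,c_2\in\mathbb Z[z]$ and: (1) $c_2(z)\equiv z^{e_1}(1+\varepsilon z^\gamma)^{e_2}$ modulo $3$ for some non-negative integers $e_1,e_2$; (2) $c_1^2(z)-c_0(z)c_2(z)\equiv z^{2f_1}(1+\varepsilon z^\gamma)^{2f_2+1}$ modulo $3$ for some non-negative integers $f_1,f_2$; (3) $\mathcal Q$ is a polynomial with integer coefficients; (4) the equation determines its power series solution uniquely modulo $3^{3^\alpha}$, i.e. any two formal power series with integer coefficients that satisfy the equation modulo $3^{3^\alpha}$ agree modulo $3^{3^\alpha}$. Then there exist $a_0(z),\dots,a_{2\cdot3^\alpha-1}(z)\in\mathbb Z[z,z^{ -1},(1+\varepsilon z^\gamma)^{ -1}]$ such that $$F(z)=\sum_{i=0}^{2\cdot3^\alpha-1}a_i(z)\Psi^i(\varepsilon z^\gamma)\quad\text{modulo }3^{3^\alpha}.$$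
   Context: $\Psi(z)=\prod_{j\ge0}(1+z^{3^j})$, so $\Psi(\varepsilon z^\gamma)=\prod_{j\ge0}(1+(\varepsilon z^\gamma)^{3^j})$. Congruences "modulo $3^e$" between integral (Laurent) series in $z$ are coefficientwise; rational functions are expanded as Laurent series in $z$. -}

module Defs where

open import Algebra.Bundles.Raw using (RawRing; RawSemiring)
import Algebra.Definitions.RawSemiring as RawSemiringDefs
open import Data.Fin using (Fin; toℕ)
open import Data.Integer as ℤ using (ℤ; +_; -[1+_]; 0ℤ; 1ℤ)
open import Data.Integer.Divisibility.Signed using (_∣_)
open import Data.List using (List; []; _∷_; foldr)
open import Data.Nat using (ℕ; zero; suc; _∸_; _^_)
import Data.Nat as ℕ
open import Data.Product using (_×_; _,_)
open import Data.Vec using (Vec; _∷_; lookup; iterate)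
open import Level using (0ℓ)
open import Relation.Binary.PropositionalEquality using (_≡_)

private module ℤΣ = RawSemiringDefs ℤ.+-*-rawSemiring

-- Formal power series over ℤ, given by their coefficients.

Series : Set
Series = ℕ → ℤ

infix 4 _≈ˢ_ _≡ˢ_[mod_]
infixl 6 _+ˢ_ _-ˢ_
infixl 7 _*ˢ_
infix 8 -ˢ_

_≈ˢ_ : Series → Series → Set
f ≈ˢ g = ∀ n → f n ≡ g n

_≡ˢ_[mod_] : Series → Series → ℕ → Set
f ≡ˢ g [mod N ] = ∀ n → + N ∣ f n ℤ.- g n

const : ℤ → Series
const a zero    = a
const a (suc _) = 0ℤ

0ˢ 1ˢ z : Series
0ˢ = const 0ℤ
1ˢ = const 1ℤ
z zero          = 0ℤ
z (suc zero)    = 1ℤ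
z (suc (suc _)) = 0ℤ

_+ˢ_ _-ˢ_ _*ˢ_ : Series → Series → Series
(f +ˢ g) n = f n ℤ.+ g n
(f -ˢ g) n = f n ℤ.- g n
(f *ˢ g) n = ℤΣ.sum {suc n} λ i → f (toℕ i) ℤ.* g (n ∸ toℕ i)

-ˢ_ : Series → Series
(-ˢ f) n = ℤ.- f n

seriesRawRing : RawRing 0ℓ 0ℓ
seriesRawRing = record
  { Carrier = Series ; _≈_ = _≈ˢ_ ; _+_ = _+ˢ_ ; _*_ = _*ˢ_
  ; -_ = -ˢ_ ; 0# = 0ˢ ; 1# = 1ˢ }

open RawSemiringDefs (RawRing.rawSemiring seriesRawRing) public
  using () renaming (_^_ to _^ˢ_; sum to sumˢ; product to productˢ)

deriv : Series → Series
deriv f n = + suc n ℤ.* f (suc n)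

-- Infinite sum and product of a sequence of series u₀, u₁, …, read off
-- from the partial sum (product) over j ≤ n.  They are the limits of the
-- partial sums (products) whenever uⱼ ∈ O(zʲ) (respectively uⱼ ∈ 1 + O(zʲ)),
-- and are only used in that case.

∑∞ ∏∞ : (ℕ → Series) → Series
∑∞ u n = sumˢ     {suc n} (λ j → u (toℕ j)) n
∏∞ u n = productˢ {suc n} (λ j → u (toℕ j)) n

-- Ψ(w) = ∏ⱼ (1 + w^(3ʲ)) and 1/(1+w) = Σⱼ (-w)ʲ, for w without constant term.

Ψ : Series → Series
Ψ w = ∏∞ λ j → 1ˢ +ˢ w ^ˢ (3 ^ j)

inv1+ : Series → Series
inv1+ w = ∑∞ λ j → (-ˢ w) ^ˢ j

-- A polynomial in z, as its list of coefficients, constant term first.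

Poly : Set
Poly = List ℤ

⟦_⟧ : Poly → Series
⟦ [] ⟧    n       = 0ℤ
⟦ a ∷ p ⟧ zero    = a
⟦ a ∷ p ⟧ (suc n) = ⟦ p ⟧ n

-- A polynomial in n variables, as a list of terms: coefficient and exponents.

MvPoly : ℕ → Set
MvPoly n = List (ℤ × Vec ℕ n)

evalTerm : ∀ {n} → ℤ × Vec ℕ n → Vec Series n → Series
evalTerm {n} (a , es) fs =
  const a *ˢ productˢ {n} λ i → lookup fs i ^ˢ lookup es i

eval : ∀ {n} → MvPoly n → Vec Series n → Series
eval p fs = foldr (λ t acc → evalTerm t fs +ˢ acc) 0ˢ p

-- The left-hand side c₂F² + c₁F + c₀ + 3 Q(z; F, F′, …, F⁽ˢ⁾).

equationLHS : (c₀ c₁ c₂ : Poly) (s : ℕ) → MvPoly (2 ℕ.+ s) → Series → Series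
equationLHS c₀ c₁ c₂ s Q F =
  ⟦ c₂ ⟧ *ˢ F ^ˢ 2 +ˢ ⟦ c₁ ⟧ *ˢ F +ˢ ⟦ c₀ ⟧
    +ˢ const (+ 3) *ˢ eval Q (z ∷ iterate deriv F (suc s))

-- The Laurent series z^(-shift) · body.  Representatives are not unique;
-- they are compared through their coefficients.

infix 4 _≈ᴸ_ _≡ᴸ_[mod_]
infixl 6 _+ᴸ_
infixl 7 _*ᴸ_

record Laurent : Set where
  constructor z^-_·_
  field
    shift : ℕ
    body  : Series

coeff : Laurent → ℤ → ℤ
coeff (z^- m · f) k with k ℤ.+ + m
... | + n      = f n
... | -[1+ _ ] = 0ℤ

_≈ᴸ_ : Laurent → Laurent → Set
f ≈ᴸ g = ∀ k → coeff f k ≡ coeff g k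

_≡ᴸ_[mod_] : Laurent → Laurent → ℕ → Set
f ≡ᴸ g [mod N ] = ∀ k → + N ∣ coeff f k ℤ.- coeff g k

fromSeries : Series → Laurent
fromSeries f = z^- 0 · f

_+ᴸ_ _*ᴸ_ : Laurent → Laurent → Laurent
(z^- m · f) +ᴸ (z^- n · g) = z^- (m ℕ.+ n) · (z ^ˢ n *ˢ f +ˢ z ^ˢ m *ˢ g)
(z^- m · f) *ᴸ (z^- n · g) = z^- (m ℕ.+ n) · (f *ˢ g)

laurentRawSemiring : RawSemiring 0ℓ 0ℓ
laurentRawSemiring = record
  { Carrier = Laurent ; _≈_ = _≈ᴸ_ ; _+_ = _+ᴸ_ ; _*_ = _*ᴸ_
  ; 0# = fromSeries 0ˢ ; 1# = fromSeries 1ˢ }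

open RawSemiringDefs laurentRawSemiring public
  using () renaming (_^_ to _^ᴸ_; sum to sumᴸ)

-- Elements of ℤ[z, z⁻¹, (1+w)⁻¹], for a polynomial w in z without constant
-- term, as fractions numerator / (z ^ zExp · (1+w) ^ wExp).

record LocPoly : Set where
  constructor mkLocPoly
  field
    numerator : Poly
    zExp wExp : ℕ

expand : Series → LocPoly → Laurent
expand w a = z^- zExp · (⟦ numerator ⟧ *ˢ inv1+ w ^ˢ wExp)
  where open LocPoly a

-- ε z^γ
monomial : ℤ → ℕ → Series
monomial ε γ = const ε *ˢ z ^ˢ γ

{-# OPTIONS --safe #-}

-- Put N = 3^α, u = 1/(1 + w) and let S be the differential ring generated over ℤ[z, z⁻¹, u]
-- by Ψ = Ψ(w).  Modulo 3 one has Ψ² ≡ u, so the ideal I = (3, Ψ² - u) of S consists of Laurent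
-- series divisible by 3, and I^N vanishes modulo 3^N; moreover I is closed under d/dz.
--
-- The discriminant c₁² - c₀c₂ is, modulo I, the square of B = ± z^f₁ (1 + w)^f₂ (1 + w) Ψ, which
-- is a unit of S / I.  Hence (c₁ - B)/c₂ solves the equation modulo I, and Newton iteration in
-- the I-adic filtration (in which the term 3Q is always of higher order) produces a solution in
-- S modulo I^N.  Over 𝔽₃ the quadratic has only the two roots that belong to the two signs of
-- B; with the right sign F agrees with the solution modulo 3, and then, the derivative
-- 2c₂F + c₁ of the quadratic being a unit modulo 3, also modulo 3^N.  Finally (Ψ² - u)^N ≡ 0
-- lets one reduce polynomials in Ψ to degree less than 2N.

module Submission where

-- Congruence modulo 3^N is taken as the equality of the ring, so that the N-th powers of 3 and of
-- Ψ² - u are zero as ring elements and every limit of the iteration is reached after finitely many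
-- steps. That S is closed under d/dz is the delicate point, since Ψ is an infinite product. It is
-- split into its first N + 1 factors and the tail Ψ(w^(3^(N+1))). The tail has derivative zero
-- modulo 3^N because w^(3^(N+1)) has, and the finite product has its logarithmic derivative in
-- ℤ[z, z⁻¹, u]. Two filtrations are needed. The solution has to be displayed as a polynomial in Ψ,
-- so membership in a power of I must carry an expression in generators; divisibility by 3 would not
-- give one. F, on the other hand, is not known to lie in S, and it can be compared with the
-- solution only through multiples of 3^β in the whole Laurent ring. The linearisation behind both
-- Newton's step and uniqueness is therefore proved for an abstract filtration. Choosing the sign of
-- B requires deciding which factor of a product vanishes modulo 3; this is settled at one known
-- coefficient, that of z^f₁ in B, which is ± 1.

module PowerSeries where

  -- Power series over ℤ with congruence as equality

  open import Defs
  open import Algebra.Bundles using (CommutativeRing)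
  open import Algebra.Solver.Ring.AlmostCommutativeRing
    using (fromCommutativeRing; _-Raw-AlmostCommutative⟶_)
  import Algebra.Solver.Ring as RingSolver
  import Algebra.Consequences.Setoid as Consequences
  open import Data.Integer as ℤ using (ℤ; +_; 0ℤ; 1ℤ; -1ℤ)
  import Data.Integer.Properties as ℤ
  open import Data.Integer.Divisibility.Signed using (_∣_; divides; ∣m∣n⇒∣m+n; ∣m⇒∣-m; ∣m⇒∣m*n)
  open import Data.Integer.Tactic.RingSolver using (solve-∀)
  open import Data.Maybe using (Maybe; just; nothing)
  open import Data.Nat as ℕ using (ℕ; zero; suc)
  open import Level using (0ℓ)
  open import Relation.Binary.Bundles using (Setoid)
  open import Relation.Binary.Structures using (IsEquivalence)
  open import Relation.Binary.PropositionalEquality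
    using (_≡_; refl; sym; trans; cong; cong₂; subst; module ≡-Reasoning)
  open import Relation.Nullary using (yes; no)

  -- As `(f *ˢ g) (suc n)` reduces to `f 0 ℤ.* g (suc n) ℤ.+ (tail f *ˢ g) n`, the ring laws follow
  -- by induction on the coefficient, with `f` replaced by its tail.
  tail : Series → Series
  tail f n = f (suc n)

  *ˢ-zero : ∀ f g → (f *ˢ g) 0 ≡ f 0 ℤ.* g 0
  *ˢ-zero f g = ℤ.+-identityʳ _

  *ˢ-cong : ∀ {f f′ g g′} → f ≈ˢ f′ → g ≈ˢ g′ → f *ˢ g ≈ˢ f′ *ˢ g′
  *ˢ-cong p q zero    = cong (ℤ._+ 0ℤ) (cong₂ ℤ._*_ (p 0) (q 0))
  *ˢ-cong p q (suc n) =
    cong₂ ℤ._+_ (cong₂ ℤ._*_ (p 0) (q (suc n))) (*ˢ-cong (λ i → p (suc i)) q n)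

  -- The mirror image of the definitional recursion, detaching the term with `g 0` instead of the
  -- one with `f 0`; commutativity needs both.
  *ˢ-sucʳ : ∀ f g n → (f *ˢ g) (suc n) ≡ f (suc n) ℤ.* g 0 ℤ.+ (f *ˢ tail g) n
  *ˢ-sucʳ f g zero = lem (f 0) (f 1) (g 0) (g 1)
    where
    lem : ∀ a b c d → a ℤ.* d ℤ.+ (b ℤ.* c ℤ.+ 0ℤ) ≡ b ℤ.* c ℤ.+ (a ℤ.* d ℤ.+ 0ℤ)
    lem = solve-∀
  *ˢ-sucʳ f g (suc n) = trans (cong (ℤ._+_ (f 0 ℤ.* g (suc (suc n)))) (*ˢ-sucʳ (tail f) g n))
          (lem (f 0 ℤ.* g (suc (suc n))) (f (suc (suc n)) ℤ.* g 0) ((tail f *ˢ tail g) n))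
    where
    lem : ∀ a b c → a ℤ.+ (b ℤ.+ c) ≡ b ℤ.+ (a ℤ.+ c)
    lem = solve-∀

  *ˢ-comm : ∀ f g → f *ˢ g ≈ˢ g *ˢ f
  *ˢ-comm f g zero    = cong (ℤ._+ 0ℤ) (ℤ.*-comm (f 0) (g 0))
  *ˢ-comm f g (suc n) =
    trans (cong₂ ℤ._+_ (ℤ.*-comm (f 0) (g (suc n))) (*ˢ-comm (tail f) g n))
          (sym (*ˢ-sucʳ g f n))

  *ˢ-distribʳ : ∀ h f g → (f +ˢ g) *ˢ h ≈ˢ f *ˢ h +ˢ g *ˢ h
  *ˢ-distribʳ h f g zero = lem (f 0) (g 0) (h 0)
    where
    lem : ∀ a b c → (a ℤ.+ b) ℤ.* c ℤ.+ 0ℤ ≡ a ℤ.* c ℤ.+ 0ℤ ℤ.+ (b ℤ.* c ℤ.+ 0ℤ)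
    lem = solve-∀
  *ˢ-distribʳ h f g (suc n) =
    trans (cong (ℤ._+_ ((f 0 ℤ.+ g 0) ℤ.* h (suc n))) (*ˢ-distribʳ h (tail f) (tail g) n))
          (lem (f 0) (g 0) (h (suc n)) ((tail f *ˢ h) n) ((tail g *ˢ h) n))
    where
    lem : ∀ a b c d e → (a ℤ.+ b) ℤ.* c ℤ.+ (d ℤ.+ e) ≡ a ℤ.* c ℤ.+ d ℤ.+ (b ℤ.* c ℤ.+ e)
    lem = solve-∀

  scale : ℤ → Series → Series
  scale a f n = a ℤ.* f n

  *ˢ-scale : ∀ a f g → scale a f *ˢ g ≈ˢ scale a (f *ˢ g)
  *ˢ-scale a f g zero = lem a (f 0) (g 0)
    where
    lem : ∀ a b c → a ℤ.* b ℤ.* c ℤ.+ 0ℤ ≡ a ℤ.* (b ℤ.* c ℤ.+ 0ℤ)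
    lem = solve-∀
  *ˢ-scale a f g (suc n) =
    trans (cong (ℤ._+_ (a ℤ.* f 0 ℤ.* g (suc n))) (*ˢ-scale a (tail f) g n))
          (lem a (f 0) (g (suc n)) ((tail f *ˢ g) n))
    where
    lem : ∀ a b c d → a ℤ.* b ℤ.* c ℤ.+ a ℤ.* d ≡ a ℤ.* (b ℤ.* c ℤ.+ d)
    lem = solve-∀

  0*ˢ : ∀ f g → (∀ n → f n ≡ 0ℤ) → ∀ n → (f *ˢ g) n ≡ 0ℤ
  0*ˢ f g p zero    = trans (ℤ.+-identityʳ _) (cong (ℤ._* g 0) (p 0))
  0*ˢ f g p (suc n) =
    cong₂ ℤ._+_ (cong (ℤ._* g (suc n)) (p 0)) (0*ˢ (tail f) g (λ i → p (suc i)) n)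

  const*ˢ : ∀ a g → const a *ˢ g ≈ˢ scale a g
  const*ˢ a g zero    = ℤ.+-identityʳ _
  const*ˢ a g (suc n) =
    trans (cong (ℤ._+_ (a ℤ.* g (suc n))) (0*ˢ (tail (const a)) g (λ _ → refl) n)) (ℤ.+-identityʳ _)

  *ˢ-identityˡ : ∀ g → 1ˢ *ˢ g ≈ˢ g
  *ˢ-identityˡ g n = trans (const*ˢ 1ℤ g n) (ℤ.*-identityˡ _)

  *ˢ-assoc : ∀ f g h → (f *ˢ g) *ˢ h ≈ˢ f *ˢ (g *ˢ h)
  *ˢ-assoc f g h zero = lem (f 0) (g 0) (h 0)
    where
    lem : ∀ a b c → (a ℤ.* b ℤ.+ 0ℤ) ℤ.* c ℤ.+ 0ℤ ≡ a ℤ.* (b ℤ.* c ℤ.+ 0ℤ) ℤ.+ 0ℤ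
    lem = solve-∀
  *ˢ-assoc f g h (suc n) = begin
    -- By computation, the tail of `f *ˢ g` is `scale (f 0) (tail g) +ˢ tail f *ˢ g`.
    (f *ˢ g) 0 ℤ.* h (suc n) ℤ.+ ((scale (f 0) (tail g) +ˢ tail f *ˢ g) *ˢ h) n
      ≡⟨ cong (ℤ._+_ ((f *ˢ g) 0 ℤ.* h (suc n))) (*ˢ-distribʳ h (scale (f 0) (tail g)) (tail f *ˢ g) n) ⟩
    (f *ˢ g) 0 ℤ.* h (suc n) ℤ.+ ((scale (f 0) (tail g) *ˢ h) n ℤ.+ ((tail f *ˢ g) *ˢ h) n)
      ≡⟨ cong (ℤ._+_ ((f *ˢ g) 0 ℤ.* h (suc n))) (cong₂ ℤ._+_ (*ˢ-scale (f 0) (tail g) h n) (*ˢ-assoc (tail f) g h n)) ⟩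
    (f 0 ℤ.* g 0 ℤ.+ 0ℤ) ℤ.* h (suc n) ℤ.+ (f 0 ℤ.* (tail g *ˢ h) n ℤ.+ (tail f *ˢ (g *ˢ h)) n)
      ≡⟨ lem (f 0) (g 0) (h (suc n)) ((tail g *ˢ h) n) ((tail f *ˢ (g *ˢ h)) n) ⟩
    (f *ˢ (g *ˢ h)) (suc n) ∎
    where
    open ≡-Reasoning
    lem : ∀ a b c d e → (a ℤ.* b ℤ.+ 0ℤ) ℤ.* c ℤ.+ (a ℤ.* d ℤ.+ e) ≡ a ℤ.* (b ℤ.* c ℤ.+ d) ℤ.+ e
    lem = solve-∀

  module _ (M : ℕ) where

    ∣-*ˢ : ∀ f g → (∀ n → + M ∣ f n) → ∀ n → + M ∣ (f *ˢ g) n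
    ∣-*ˢ f g p zero    = subst (+ M ∣_) (sym (*ˢ-zero f g)) (∣m⇒∣m*n (g 0) (p 0))
    ∣-*ˢ f g p (suc n) =
      ∣m∣n⇒∣m+n (∣m⇒∣m*n (g (suc n)) (p 0)) (∣-*ˢ (tail f) g (λ i → p (suc i)) n)

    *ˢ-≡ˢˡ : ∀ {f g} h → f ≡ˢ g [mod M ] → f *ˢ h ≡ˢ g *ˢ h [mod M ]
    *ˢ-≡ˢˡ {f} {g} h p n = subst (+ M ∣_) eq (∣-*ˢ (f -ˢ g) h p n)
      where
      lem : ∀ a b → a ℤ.+ -1ℤ ℤ.* b ≡ a ℤ.- b
      lem = solve-∀
      eq : ((f -ˢ g) *ˢ h) n ≡ (f *ˢ h) n ℤ.- (g *ˢ h) n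
      eq = begin
        ((f -ˢ g) *ˢ h) n                        ≡⟨ *ˢ-cong {g = h} (λ i → sym (lem (f i) (g i))) (λ _ → refl) n ⟩
        ((f +ˢ scale -1ℤ g) *ˢ h) n              ≡⟨ *ˢ-distribʳ h f (scale -1ℤ g) n ⟩
        (f *ˢ h) n ℤ.+ (scale -1ℤ g *ˢ h) n      ≡⟨ cong (ℤ._+_ ((f *ˢ h) n)) (*ˢ-scale -1ℤ g h n) ⟩
        (f *ˢ h) n ℤ.+ -1ℤ ℤ.* (g *ˢ h) n        ≡⟨ lem ((f *ˢ h) n) ((g *ˢ h) n) ⟩
        (f *ˢ h) n ℤ.- (g *ˢ h) n                ∎
        where open ≡-Reasoning

  mkCommutativeRing : (A : Set) (_≈_ : A → A → Set) (_+_ _*_ : A → A → A) (-_ : A → A) (0# 1# : A) →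
    IsEquivalence _≈_ →
    (∀ {x y u v} → x ≈ y → u ≈ v → (x + u) ≈ (y + v)) →
    (∀ {x y u v} → x ≈ y → u ≈ v → (x * u) ≈ (y * v)) →
    (∀ {x y} → x ≈ y → (- x) ≈ (- y)) →
    (∀ x y z → ((x + y) + z) ≈ (x + (y + z))) →
    (∀ x y → (x + y) ≈ (y + x)) →
    (∀ x → (0# + x) ≈ x) →
    (∀ x → ((- x) + x) ≈ 0#) →
    (∀ x y z → ((x * y) * z) ≈ (x * (y * z))) →
    (∀ x y → (x * y) ≈ (y * x)) →
    (∀ x → (1# * x) ≈ x) →
    (∀ x y z → ((y + z) * x) ≈ ((y * x) + (z * x))) →
    CommutativeRing 0ℓ 0ℓ
  mkCommutativeRing A _≈_ _+_ _*_ -_ 0# 1# isEq +-cong *-cong -‿cong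
    +-assoc +-comm +-idˡ -‿invˡ *-assoc *-comm *-idˡ distribʳ = record
    { _≈_ = _≈_ ; _+_ = _+_ ; _*_ = _*_ ; -_ = -_ ; 0# = 0# ; 1# = 1#
    ; isCommutativeRing = record
      { isRing = record
        { +-isAbelianGroup = record
          { isGroup = record
            { isMonoid = record
              { isSemigroup = record
                { isMagma = record { isEquivalence = isEq ; ∙-cong = +-cong }
                ; assoc = +-assoc }
              ; identity = comm∧idˡ⇒id +-comm +-idˡ }
            ; inverse = comm∧invˡ⇒inv +-comm -‿invˡ
            ; ⁻¹-cong = -‿cong }
          ; comm = +-comm }
        ; *-cong = *-cong
        ; *-assoc = *-assoc
        ; *-identity = comm∧idˡ⇒id *-comm *-idˡ
        ; distrib = comm∧distrʳ⇒distr +-cong *-comm distribʳ }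
      ; *-comm = *-comm } }
    where
    setoid : Setoid 0ℓ 0ℓ
    setoid = record { isEquivalence = isEq }
    open Consequences setoid

  infix 4 _≈[_]_

  -- A record, so that the two series can be inferred from a proof.
  record _≈[_]_ (f : Series) (M : ℕ) (g : Series) : Set where
    constructor ⌈_⌉
    field ⌊_⌋ : f ≡ˢ g [mod M ]
  open _≈[_]_ public

  ≈ˢ⇒≈[] : ∀ {M f g} → f ≈ˢ g → f ≈[ M ] g
  ≈ˢ⇒≈[] {M} {f} {g} p = ⌈ (λ n → divides 0ℤ (lem (f n) (g n) (p n))) ⌉
    where
    lem : ∀ a b → a ≡ b → a ℤ.- b ≡ 0ℤ
    lem a _ refl = ℤ.+-inverseʳ a

  ≈[]-isEquivalence : ∀ M → IsEquivalence (_≈[ M ]_)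
  ≈[]-isEquivalence M = record
    { refl  = ≈ˢ⇒≈[] (λ _ → refl)
    ; sym   = λ {f} {g} p → ⌈ (λ n → subst (+ M ∣_) (lem₁ (f n) (g n)) (∣m⇒∣-m (⌊ p ⌋ n))) ⌉
    ; trans = λ {f} {g} {h} p q →
        ⌈ (λ n → subst (+ M ∣_) (lem₂ (f n) (g n) (h n)) (∣m∣n⇒∣m+n (⌊ p ⌋ n) (⌊ q ⌋ n))) ⌉
    }
    where
    lem₁ : ∀ a b → ℤ.- (a ℤ.- b) ≡ b ℤ.- a
    lem₁ = solve-∀
    lem₂ : ∀ a b c → a ℤ.- b ℤ.+ (b ℤ.- c) ≡ a ℤ.- c
    lem₂ = solve-∀

  -- Carrier and operations do not depend on `M`; only the equality does. One and the same series
  -- can thus be studied modulo 3 and modulo 3^N without any reduction map.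
  seriesRing : ℕ → CommutativeRing 0ℓ 0ℓ
  seriesRing M = mkCommutativeRing Series (_≈[ M ]_) _+ˢ_ _*ˢ_ -ˢ_ 0ˢ 1ˢ (≈[]-isEquivalence M)
    (λ {f} {g} {h} {k} p q →
      ⌈ (λ n → subst (+ M ∣_) (lem₁ (f n) (g n) (h n) (k n)) (∣m∣n⇒∣m+n (⌊ p ⌋ n) (⌊ q ⌋ n))) ⌉)
    (λ {f} {g} {h} {k} p q → E.trans ⌈ *ˢ-≡ˢˡ M {f} {g} h ⌊ p ⌋ ⌉
      (E.trans (≈ˢ⇒≈[] (*ˢ-comm g h)) (E.trans ⌈ *ˢ-≡ˢˡ M {h} {k} g ⌊ q ⌋ ⌉ (≈ˢ⇒≈[] (*ˢ-comm k g)))))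
    (λ {f} {g} p → ⌈ (λ n → subst (+ M ∣_) (lem₂ (f n) (g n)) (∣m⇒∣-m (⌊ p ⌋ n))) ⌉)
    (λ f g h → ≈ˢ⇒≈[] (λ n → ℤ.+-assoc (f n) (g n) (h n)))
    (λ f g → ≈ˢ⇒≈[] (λ n → ℤ.+-comm (f n) (g n)))
    (λ f → ≈ˢ⇒≈[] (λ { zero → ℤ.+-identityˡ (f 0) ; (suc n) → ℤ.+-identityˡ (f (suc n)) }))
    (λ f → ≈ˢ⇒≈[] (λ { zero → ℤ.+-inverseˡ (f 0) ; (suc n) → ℤ.+-inverseˡ (f (suc n)) }))
    (λ f g h → ≈ˢ⇒≈[] (*ˢ-assoc f g h))
    (λ f g → ≈ˢ⇒≈[] (*ˢ-comm f g))
    (λ f → ≈ˢ⇒≈[] (*ˢ-identityˡ f))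
    (λ h f g → ≈ˢ⇒≈[] (*ˢ-distribʳ h f g))
    where
    module E = IsEquivalence (≈[]-isEquivalence M)
    lem₁ : ∀ a b c d → a ℤ.- b ℤ.+ (c ℤ.- d) ≡ a ℤ.+ c ℤ.- (b ℤ.+ d)
    lem₁ = solve-∀
    lem₂ : ∀ a b → ℤ.- (a ℤ.- b) ≡ ℤ.- a ℤ.- ℤ.- b
    lem₂ = solve-∀

  ℤ-Algebra : CommutativeRing 0ℓ 0ℓ → Set
  ℤ-Algebra R = ℤ.+-*-rawRing -Raw-AlmostCommutative⟶ fromCommutativeRing R

  -- Integer coefficients let the solver decide numerical identities such as 4 = 1 + 3. Zero and one
  -- are mostly written `ι 0ℤ` and `ι 1ℤ` below because `con` evaluates to these terms.
  module ℤ-Solver (R : CommutativeRing 0ℓ 0ℓ) (ι : ℤ-Algebra R) where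
    private
      open CommutativeRing R using (_≈_)
      open _-Raw-AlmostCommutative⟶_ ι renaming (⟦_⟧ to ι⟦_⟧)
      coeff≟ : ∀ a b → Maybe (ι⟦ a ⟧ ≈ ι⟦ b ⟧)
      coeff≟ a b with a ℤ.≟ b
      ... | yes refl = just (CommutativeRing.refl R)
      ... | no _     = nothing
    open RingSolver ℤ.+-*-rawRing (fromCommutativeRing R) ι coeff≟ public
      using (solve; _:=_; _:+_; _:*_; _:-_; :-_; _:^_; con)

  const-algebra : ∀ M → ℤ-Algebra (seriesRing M)
  const-algebra M = record
    { ⟦_⟧    = const
    ; +-homo = λ a b → ≈ˢ⇒≈[] (λ { zero → refl ; (suc n) → refl })
    ; *-homo = λ a b → ≈ˢ⇒≈[] (λ n → trans (const-* a b n) (sym (const*ˢ a (const b) n)))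
    ; -‿homo = λ a → ≈ˢ⇒≈[] (λ { zero → refl ; (suc n) → refl })
    ; 0-homo = ≈ˢ⇒≈[] (λ _ → refl)
    ; 1-homo = ≈ˢ⇒≈[] (λ _ → refl)
    }
    where
    const-* : ∀ a b n → const (a ℤ.* b) n ≡ a ℤ.* const b n
    const-* a b zero    = refl
    const-* a b (suc n) = sym (ℤ.*-zeroʳ a)

-- Filtered differential rings, Newton iteration, and the algebra generated by Ψ

module DifferentialRings where

  open PowerSeries
  open import Defs using (MvPoly)
  open import Algebra.Bundles using (CommutativeRing; Semiring)
  open import Algebra.Solver.Ring.AlmostCommutativeRing using (_-Raw-AlmostCommutative⟶_)
  import Algebra.Properties.Semiring.Exp as Exp
  import Algebra.Properties.Semiring.Sum
  import Algebra.Definitions.RawSemiring as RawSemiringDefs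
  import Relation.Binary.Reasoning.Setoid as SetoidReasoning
  open import Data.Fin using (Fin; zero; suc; toℕ)
  open import Data.Integer as ℤ using (ℤ; +_; 0ℤ; 1ℤ; -1ℤ)
  open import Data.List using ([]; _∷_; foldr)
  open import Data.Nat as ℕ using (ℕ; zero; suc)
  import Data.Nat.Properties as ℕ
  open import Data.Product using (_,_; _×_; ∃-syntax; proj₁; proj₂)
  open import Data.Unit using (⊤; tt)
  open import Data.Vec using (Vec; _∷_; lookup; iterate)
  open import Level using (0ℓ)

  -- The instances are the series modulo some `M`, in particular modulo 3 and modulo 3^N, and the
  -- Laurent ring obtained from them by inverting z.
  record DifferentialRing : Set₁ where
    field commutativeRing : CommutativeRing 0ℓ 0ℓ
    open CommutativeRing commutativeRing public hiding (zero)
    field algebra : ℤ-Algebra commutativeRing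
    open _-Raw-AlmostCommutative⟶_ algebra public using ()
      renaming (⟦_⟧ to ι; +-homo to ι-+; *-homo to ι-*; -‿homo to ι-neg; 0-homo to ι-0; 1-homo to ι-1)
    field
      D      : Carrier → Carrier
      D-cong : ∀ {x y} → x ≈ y → D x ≈ D y
      D-+    : ∀ x y → D (x + y) ≈ D x + D y
      D-*    : ∀ x y → D (x * y) ≈ D x * y + x * D y
      D-ι    : ∀ a → D (ι a) ≈ ι 0ℤ

  module Differential (K : DifferentialRing) where

    open DifferentialRing K
    open ℤ-Solver commutativeRing algebra
    open Exp semiring using (_^_; ^-congˡ)
    open RawSemiringDefs (Semiring.rawSemiring semiring) using (product)
    open Algebra.Properties.Semiring.Sum semiring using (sum; sum-cong-≋; *-distribˡ-sum)
    open SetoidReasoning setoid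

    evaluateTerm : ∀ {n} → ℤ × Vec ℕ n → Vec Carrier n → Carrier
    evaluateTerm {n} (a , es) xs = ι a * product {n} λ i → lookup xs i ^ lookup es i

    eval : ∀ {n} → MvPoly n → Vec Carrier n → Carrier
    eval p xs = foldr (λ t acc → evaluateTerm t xs + acc) (ι 0ℤ) p

    -- I 0 is a differential ℤ-subalgebra, and I 1 ⊇ I 2 ⊇ … are differential
    -- ideals of it with I β · I γ ⊆ I (β + γ) and 3 ∈ I 1.
    record IsFiltration (I : ℕ → Carrier → Set) : Set where
      field
        resp  : ∀ {β x y} → x ≈ y → I β x → I β y
        0∈    : ∀ {β} → I β (ι 0ℤ)
        ι∈    : ∀ a → I 0 (ι a)
        3∈    : I 1 (ι (+ 3))
        +∈    : ∀ {β x y} → I β x → I β y → I β (x + y)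
        *∈    : ∀ {β γ x y} → I β x → I γ y → I (β ℕ.+ γ) (x * y)
        D∈    : ∀ {β x} → I β x → I β (D x)
        weaken : ∀ {β x} → I (suc β) x → I β x

      module _ {β : ℕ} where
        neg∈ : ∀ {x} → I β x → I β (- x)
        neg∈ {x} p = resp (solve 1 (λ x → con -1ℤ :* x := :- x) refl x) (*∈ (ι∈ -1ℤ) p)

        -∈ : ∀ {x y} → I β x → I β y → I β (x - y)
        -∈ p q = +∈ p (neg∈ q)

        *∈ʳ : ∀ {x y} → I β x → I 0 y → I β (x * y)
        *∈ʳ {x} {y} p q = resp (*-comm y x) (*∈ q p)

      to1 : ∀ {β x} → I (suc β) x → I 1 x
      to1 {zero}  p = p
      to1 {suc β} p = to1 (weaken p)

      to0 : ∀ {β x} → I β x → I 0 x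
      to0 {zero}  p = p
      to0 {suc β} p = to0 (weaken p)

      ^∈ : ∀ {x} → I 0 x → ∀ n → I 0 (x ^ n)
      ^∈ p zero    = resp ι-1 (ι∈ 1ℤ)
      ^∈ p (suc n) = *∈ p (^∈ p n)

      product∈ : ∀ {n} (f : Fin n → Carrier) → (∀ i → I 0 (f i)) → I 0 (product f)
      product∈ {zero}  f p = resp ι-1 (ι∈ 1ℤ)
      product∈ {suc n} f p = *∈ (p zero) (product∈ (λ i → f (suc i)) (λ i → p (suc i)))

      eval∈ : ∀ {n} (p : MvPoly n) (xs : Vec Carrier n) → (∀ i → I 0 (lookup xs i)) → I 0 (eval p xs)
      eval∈ []             xs h = 0∈
      eval∈ ((a , es) ∷ p) xs h =
        +∈ (*∈ (ι∈ a) (product∈ _ (λ i → ^∈ (h i) (lookup es i)))) (eval∈ p xs h)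

      module _ {β : ℕ} where

        *-diff : ∀ {x y x′ y′} → I 0 x → I 0 y′ → I β (x - y) → I β (x′ - y′) →
          I β (x * x′ - y * y′)
        *-diff {x} {y} {x′} {y′} px py′ d d′ =
          resp (solve 4 (λ x y x′ y′ → x :* (x′ :- y′) :+ (x :- y) :* y′ := x :* x′ :- y :* y′)
                  refl x y x′ y′)
               (+∈ (*∈ px d′) (*∈ʳ d py′))

        x-x∈ : ∀ x → I β (x - x)
        x-x∈ x = resp (solve 1 (λ x → con 0ℤ := x :- x) refl x) 0∈

        ^-diff : ∀ {x y} → I 0 x → I 0 y → I β (x - y) → ∀ n → I β (x ^ n - y ^ n)
        ^-diff px py d zero    = x-x∈ 1#
        ^-diff px py d (suc n) = *-diff px (^∈ py n) d (^-diff px py d n)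

        product-diff : ∀ {n} (f g : Fin n → Carrier) → (∀ i → I 0 (f i)) → (∀ i → I 0 (g i)) →
          (∀ i → I β (f i - g i)) → I β (product f - product g)
        product-diff {zero}  f g pf pg d = x-x∈ 1#
        product-diff {suc n} f g pf pg d =
          *-diff (pf zero) (product∈ _ (λ i → pg (suc i))) (d zero)
            (product-diff _ _ (λ i → pf (suc i)) (λ i → pg (suc i)) (λ i → d (suc i)))

        eval-diff : ∀ {n} (p : MvPoly n) (xs ys : Vec Carrier n) →
          (∀ i → I 0 (lookup xs i)) → (∀ i → I 0 (lookup ys i)) →
          (∀ i → I β (lookup xs i - lookup ys i)) → I β (eval p xs - eval p ys)
        eval-diff []             xs ys px py d = x-x∈ _
        eval-diff ((a , es) ∷ p) xs ys px py d =
          resp (solve 4 (λ x y x′ y′ → (x :- y) :+ (x′ :- y′) := (x :+ x′) :- (y :+ y′)) refl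
                 (evaluateTerm (a , es) xs) (evaluateTerm (a , es) ys) (eval p xs) (eval p ys))
               (+∈ (*-diff (ι∈ a) (product∈ _ (λ i → ^∈ (py i) (lookup es i))) (x-x∈ _)
                     (product-diff _ _ (λ i → ^∈ (px i) (lookup es i)) (λ i → ^∈ (py i) (lookup es i))
                       (λ i → ^-diff (px i) (py i) (d i) (lookup es i))))
                   (eval-diff p xs ys px py d))

        D-diff : ∀ {x y} → I β (x - y) → I β (D x - D y)
        D-diff {x} {y} d = resp eq (D∈ d)
          where
          eq : D (x - y) ≈ D x - D y
          eq = begin
            D (x - y)                           ≈⟨ D-cong (solve 2 (λ x y → x :- y := x :+ con -1ℤ :* y) refl x y) ⟩
            D (x + ι -1ℤ * y)                   ≈⟨ D-+ _ _ ⟩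
            D x + D (ι -1ℤ * y)                 ≈⟨ +-congˡ (D-* _ _) ⟩
            D x + (D (ι -1ℤ) * y + ι -1ℤ * D y) ≈⟨ +-congˡ (+-congʳ (*-congʳ (D-ι -1ℤ))) ⟩
            D x + (ι 0ℤ * y + ι -1ℤ * D y)      ≈⟨ solve 3 (λ x y y′ → x :+ (con 0ℤ :* y :+ con -1ℤ :* y′) := x :- y′) refl (D x) y (D y) ⟩
            D x - D y                           ∎

      iterate-D∈ : ∀ {x} → I 0 x → ∀ n (i : Fin n) → I 0 (lookup (iterate D x n) i)
      iterate-D∈ p (suc n) zero    = p
      iterate-D∈ p (suc n) (suc i) = iterate-D∈ (D∈ p) n i

      iterate-D-diff : ∀ {β x y} → I β (x - y) → ∀ n (i : Fin n) →
        I β (lookup (iterate D x n) i - lookup (iterate D y n) i)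
      iterate-D-diff d (suc n) zero    = d
      iterate-D-diff d (suc n) (suc i) = iterate-D-diff (D-diff d) n i

      -- `l` is invertible only modulo `I 1`. In p = p l a - (a l - 1) p the error term has one
      -- factor in `I 1` and one factor p, which by induction is already known to lie one step less
      -- deep.
      cancel-unit : ∀ {a l p} → I 0 a → I 0 p → I 1 (a * l - ι 1ℤ) → ∀ β → I β (p * l) → I β p
      cancel-unit pa pp inv zero    pl = pp
      cancel-unit {a} {l} {p} pa pp inv (suc β) pl =
        resp (solve 3 (λ a l p → p :* l :* a :- (a :* l :- con 1ℤ) :* p := p) refl a l p)
             (-∈ (*∈ʳ pl pa) (*∈ inv (cancel-unit pa pp inv β (weaken pl))))

    module Equation (z c₀ c₁ c₂ : Carrier) (s : ℕ) (Q : MvPoly (2 ℕ.+ s)) where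

      arguments : Carrier → Vec Carrier (2 ℕ.+ s)
      arguments x = z ∷ iterate D x (suc s)

      q P A : Carrier → Carrier
      q x = eval Q (arguments x)
      P x = c₂ * x ^ 2 + c₁ * x + c₀ + ι (+ 3) * q x
      A x = ι (+ 2) * c₂ * x + c₁

      module _ {I : ℕ → Carrier → Set} (isFiltration : IsFiltration I)
        (z∈ : I 0 z) (c₀∈ : I 0 c₀) (c₁∈ : I 0 c₁) (c₂∈ : I 0 c₂) where
        open IsFiltration isFiltration

        q-arguments∈ : ∀ {x} → I 0 x → ∀ i → I 0 (lookup (arguments x) i)
        q-arguments∈ px zero    = z∈
        q-arguments∈ px (suc i) = iterate-D∈ px (suc s) i

        q-diff : ∀ {β x y} → I 0 x → I 0 y → I β (x - y) → I β (q x - q y)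
        q-diff {β} {x} {y} px py d = eval-diff Q (arguments x) (arguments y) (q-arguments∈ px) (q-arguments∈ py) lem
          where
          lem : ∀ i → I β (lookup (arguments x) i - lookup (arguments y) i)
          lem zero    = x-x∈ z
          lem (suc i) = iterate-D-diff d (suc s) i

        P∈ : ∀ {x} → I 0 x → I 0 (P x)
        P∈ px = +∈ (+∈ (+∈ (*∈ c₂∈ (^∈ px 2)) (*∈ c₁∈ px)) c₀∈)
                   (*∈ (ι∈ (+ 3)) (eval∈ Q (arguments _) (q-arguments∈ px)))

        -- First-order Taylor expansion at y: the terms that are quadratic in x - y, or that
        -- come from 3 q, lie one step deeper in the filtration.
        linearise : ∀ {β x y l} → I 0 x → I 0 y → I 0 l → I (suc β) (x - y) →
          I 1 (A y * l - ι 1ℤ) → I (suc (suc β)) ((P x - P y) * l - (x - y))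
        linearise {β} {x} {y} {l} px py pl d inv =
          resp (solve 8 (λ x y l c₀ c₁ c₂ qx qy →
                  ((con (+ 2) :* c₂ :* y :+ c₁) :* l :- con 1ℤ) :* (x :- y)
                    :+ (x :- y) :* (x :- y) :* (c₂ :* l) :+ con (+ 3) :* (qx :- qy) :* l
                  := (c₂ :* x :^ 2 :+ c₁ :* x :+ c₀ :+ con (+ 3) :* qx
                       :- (c₂ :* y :^ 2 :+ c₁ :* y :+ c₀ :+ con (+ 3) :* qy)) :* l
                     :- (x :- y))
                  refl x y l c₀ c₁ c₂ (q x) (q y))
            (+∈ (+∈ (*∈ inv d) (*∈ʳ (*∈ (to1 d) d) (*∈ c₂∈ pl)))
                (*∈ʳ (*∈ 3∈ (q-diff px py d)) pl))

        -- Moving the point within its class modulo `I 1` changes `A` by an element of `I 1`; hence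
        -- an approximate inverse found at the starting value serves at every iterate.
        A-invertible : ∀ {x y l} → I 0 l → I 1 (x - y) → I 1 (A y * l - ι 1ℤ) → I 1 (A x * l - ι 1ℤ)
        A-invertible {x} {y} {l} pl d inv =
          resp (solve 5 (λ x y l c₁ c₂ →
                  ((con (+ 2) :* c₂ :* y :+ c₁) :* l :- con 1ℤ) :+ (x :- y) :* (con (+ 2) :* c₂ :* l)
                  := (con (+ 2) :* c₂ :* x :+ c₁) :* l :- con 1ℤ)
                  refl x y l c₁ c₂)
            (+∈ inv (*∈ʳ d (*∈ (*∈ (ι∈ (+ 2)) c₂∈) pl)))

        A∈ : ∀ {x} → I 0 x → I 0 (A x)
        A∈ px = +∈ (*∈ (*∈ (ι∈ (+ 2)) c₂∈) px) c₁∈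

        -- Newton's method with the slope frozen at `x₁`. It gains a single filtration step per
        -- round, which suffices because the filtration has finite length.
        newton : ∀ {x₁ l} → I 0 x₁ → I 0 l → I 1 (P x₁) → I 1 (A x₁ * l - ι 1ℤ) →
          ∀ β → ∃[ x ] I 0 x × I 1 (x - x₁) × I (suc β) (P x)
        newton {x₁} p₁ pl P₁ inv zero = x₁ , p₁ , x-x∈ x₁ , P₁
        newton {x₁} {l} p₁ pl P₁ inv (suc β) with newton p₁ pl P₁ inv β
        ... | x , px , d , Px = x′ , px′ , d′ , Px′
          where
          x′ : Carrier
          x′ = x - P x * l

          px′ : I 0 x′
          px′ = -∈ px (*∈ (to0 Px) pl)

          step : I (suc β) (x′ - x)
          step = resp (solve 3 (λ x p l → :- (p :* l) := x :- p :* l :- x) refl x (P x) l)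
                      (neg∈ (*∈ʳ Px pl))

          d′ : I 1 (x′ - x₁)
          d′ = resp (solve 3 (λ x y z → (x :- y) :+ (y :- z) := x :- z) refl x′ x x₁)
                    (+∈ (to1 step) d)

          -- By the choice of the correction, x′ - x is exactly - P x * l, so the first-order terms
          -- in `linearise` cancel and only `P x′ * l` is left.
          P*l : I (suc (suc β)) (P x′ * l)
          P*l = resp (solve 4 (λ p p′ x l → (p′ :- p) :* l :- (x :- p :* l :- x) := p′ :* l)
                       refl (P x) (P x′) x l)
                     (linearise px′ px pl step (A-invertible pl d inv))

          Px′ : I (suc (suc β)) (P x′)
          Px′ = cancel-unit (A∈ px′) (P∈ px′) (A-invertible pl d′ inv) _ P*l

        -- With both values of `P` equal to zero, `linearise` puts x - y itself one step deeper than
        -- it was known to be.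
        root-unique : ∀ {x y l} → I 0 x → I 0 y → I 0 l → P x ≈ ι 0ℤ → P y ≈ ι 0ℤ →
          I 1 (A y * l - ι 1ℤ) → I 1 (x - y) → ∀ β → I (suc β) (x - y)
        root-unique px py pl Px Py inv d zero    = d
        root-unique {x} {y} {l} px py pl Px Py inv d (suc β) =
          resp (solve 3 (λ x y l → :- ((con 0ℤ :- con 0ℤ) :* l :- (x :- y)) := x :- y) refl x y l)
            (neg∈ (resp (+-congʳ (*-congʳ (+-cong Px (-‿cong Py))))
              (linearise px py pl (root-unique px py pl Px Py inv d β) inv)))

    -- Sums of words in the generators, where β counts the letters from `G₁`. Keeping the words as
    -- data allows a later induction that rewrites an element as a polynomial in Ψ. Negatives come
    -- from the generator -1 rather than from a constructor.
    data Generated (G₀ G₁ : Carrier → Set) : ℕ → Carrier → Set where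
      respᴳ : ∀ {β x y} → x ≈ y → Generated G₀ G₁ β x → Generated G₀ G₁ β y
      0ᴳ    : ∀ {β} → Generated G₀ G₁ β (ι 0ℤ)
      1ᴳ    : Generated G₀ G₁ 0 (ι 1ℤ)
      _+ᴳ_  : ∀ {β x y} → Generated G₀ G₁ β x → Generated G₀ G₁ β y → Generated G₀ G₁ β (x + y)
      _*⁰_  : ∀ {β g x} → G₀ g → Generated G₀ G₁ β x → Generated G₀ G₁ β (g * x)
      _*¹_  : ∀ {β g x} → G₁ g → Generated G₀ G₁ β x → Generated G₀ G₁ (suc β) (g * x)

    module _ {G₀ G₁ : Carrier → Set} where
      private I = Generated G₀ G₁

      gen⁰ : ∀ {g} → G₀ g → I 0 g
      gen⁰ {g} p = respᴳ (solve 1 (λ g → g :* con 1ℤ := g) refl g) (p *⁰ 1ᴳ)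

      gen¹ : ∀ {g} → G₁ g → I 1 g
      gen¹ {g} p = respᴳ (solve 1 (λ g → g :* con 1ℤ := g) refl g) (p *¹ 1ᴳ)

      generated-* : ∀ {β γ x y} → I β x → I γ y → I (β ℕ.+ γ) (x * y)
      generated-* (respᴳ e p) q = respᴳ (*-congʳ e) (generated-* p q)
      generated-* {y = y} 0ᴳ q = respᴳ (solve 1 (λ y → con 0ℤ := con 0ℤ :* y) refl y) 0ᴳ
      generated-* {y = y} 1ᴳ q = respᴳ (solve 1 (λ y → y := con 1ℤ :* y) refl y) q
      generated-* {y = y} (_+ᴳ_ {x = x} {x′} p p′) q =
        respᴳ (sym (distribʳ y x x′)) (generated-* p q +ᴳ generated-* p′ q)
      generated-* {y = y} (_*⁰_ {g = g} {x} h p) q =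
        respᴳ (sym (*-assoc g x y)) (h *⁰ generated-* p q)
      generated-* {y = y} (_*¹_ {g = g} {x} h p) q =
        respᴳ (sym (*-assoc g x y)) (h *¹ generated-* p q)

      generated-weaken : (∀ {g} → G₁ g → I 0 g) → ∀ {β x} → I (suc β) x → I β x
      generated-weaken G₁⊆ (respᴳ e p) = respᴳ e (generated-weaken G₁⊆ p)
      generated-weaken G₁⊆ 0ᴳ          = 0ᴳ
      generated-weaken G₁⊆ (p +ᴳ q)    = generated-weaken G₁⊆ p +ᴳ generated-weaken G₁⊆ q
      generated-weaken G₁⊆ (h *⁰ p)    = h *⁰ generated-weaken G₁⊆ p
      generated-weaken G₁⊆ (h *¹ p)    = generated-* (G₁⊆ h) p

      -- Leibniz's rule differentiates one letter at a time, so stability under `D` is a condition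
      -- on the generators only.
      generated-D : (∀ {g} → G₀ g → I 0 (D g)) → (∀ {g} → G₁ g → I 1 (D g)) →
        ∀ {β x} → I β x → I β (D x)
      generated-D d₀ d₁ (respᴳ e p) = respᴳ (D-cong e) (generated-D d₀ d₁ p)
      generated-D d₀ d₁ 0ᴳ          = respᴳ (sym (D-ι 0ℤ)) 0ᴳ
      generated-D d₀ d₁ 1ᴳ          = respᴳ (sym (D-ι 1ℤ)) 0ᴳ
      generated-D d₀ d₁ (p +ᴳ q)    =
        respᴳ (sym (D-+ _ _)) (generated-D d₀ d₁ p +ᴳ generated-D d₀ d₁ q)
      generated-D d₀ d₁ (h *⁰ p)    =
        respᴳ (sym (D-* _ _)) (generated-* (d₀ h) p +ᴳ (h *⁰ generated-D d₀ d₁ p))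
      generated-D d₀ d₁ (h *¹ p)    =
        respᴳ (sym (D-* _ _)) (generated-* (d₁ h) p +ᴳ (h *¹ generated-D d₀ d₁ p))

      generated-isFiltration : (∀ a → G₀ (ι a)) → G₁ (ι (+ 3)) → (∀ {g} → G₁ g → I 0 g) →
        (∀ {g} → G₀ g → I 0 (D g)) → (∀ {g} → G₁ g → I 1 (D g)) → IsFiltration I
      generated-isFiltration ι∈ 3∈ G₁⊆ d₀ d₁ = record
        { resp = respᴳ ; 0∈ = 0ᴳ ; ι∈ = λ a → gen⁰ (ι∈ a) ; 3∈ = gen¹ 3∈ ; +∈ = _+ᴳ_
        ; *∈ = generated-* ; D∈ = generated-D d₀ d₁ ; weaken = generated-weaken G₁⊆ }

      generated-⊆ : ∀ {J} → IsFiltration J → (∀ {g} → G₀ g → J 0 g) → (∀ {g} → G₁ g → J 1 g) →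
        ∀ {β x} → I β x → J β x
      generated-⊆ {J} isF s₀ s₁ = go
        where
        open IsFiltration isF
        go : ∀ {β x} → I β x → J β x
        go (respᴳ e p) = resp e (go p)
        go 0ᴳ          = 0∈
        go 1ᴳ          = ι∈ 1ℤ
        go (p +ᴳ q)    = +∈ (go p) (go q)
        go (h *⁰ p)    = *∈ (s₀ h) (go p)
        go (h *¹ p)    = *∈ (s₁ h) (go p)

    D-3 : ∀ {G} β → Generated G (_≈ ι (+ 3)) β (D (ι (+ 3)))
    D-3 β = respᴳ (sym (D-ι (+ 3))) 0ᴳ

    -- Every element counts as a generator of degree 0, so these are all the multiples of 3^β in the
    -- ring; phrasing them as `Generated` makes them a filtration by the general construction.
    3-adic : ℕ → Carrier → Set
    3-adic = Generated (λ _ → ⊤) (_≈ ι (+ 3))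

    3-adic-isFiltration : IsFiltration 3-adic
    3-adic-isFiltration = generated-isFiltration (λ _ → tt) refl (λ _ → gen⁰ tt) (λ _ → gen⁰ tt)
      (λ e → respᴳ (D-cong (sym e)) (D-3 1))

    3-adic⇒multiple : ∀ {β x} → 3-adic β x → ∃[ y ] x ≈ ι (+ 3) ^ β * y
    3-adic⇒multiple (respᴳ e p) with y , eq ← 3-adic⇒multiple p = y , trans (sym e) eq
    3-adic⇒multiple {β} 0ᴳ = ι 0ℤ , solve 1 (λ t → con 0ℤ := t :* con 0ℤ) refl (ι (+ 3) ^ β)
    3-adic⇒multiple 1ᴳ = ι 1ℤ , sym (*-identityˡ _)
    3-adic⇒multiple {β} (p +ᴳ q)
      with y , eq ← 3-adic⇒multiple p | y′ , eq′ ← 3-adic⇒multiple q =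
        y + y′ , trans (+-cong eq eq′) (sym (distribˡ _ y y′))
    3-adic⇒multiple {β} (_*⁰_ {g = g} _ p) with y , eq ← 3-adic⇒multiple p =
      g * y , trans (*-congˡ eq)
        (solve 3 (λ g t y → g :* (t :* y) := t :* (g :* y)) refl g (ι (+ 3) ^ β) y)
    3-adic⇒multiple (_*¹_ {g = g} e p) with y , eq ← 3-adic⇒multiple p =
      y , trans (*-cong e eq) (sym (*-assoc _ _ y))

    -- The product of 1 + a^(3ʲ) over j < n, arranged along the functional equation Ψ(a) = (1 + a)
    -- Ψ(a³), which all inductions on it use.
    tower : ℕ → Carrier → Carrier
    tower zero    a = ι 1ℤ
    tower (suc n) a = (ι 1ℤ + a) * tower n (a ^ 3)

    D-1+ : ∀ x → D (ι 1ℤ + x) ≈ D x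
    D-1+ x = begin
      D (ι 1ℤ + x)   ≈⟨ D-+ _ _ ⟩
      D (ι 1ℤ) + D x ≈⟨ +-congʳ (D-ι 1ℤ) ⟩
      ι 0ℤ + D x     ≈⟨ solve 1 (λ x → con 0ℤ :+ x := x) refl (D x) ⟩
      D x            ∎

    -- The factor 3 is what makes every factor of Ψ after the first contribute only a multiple of 3
    -- to the logarithmic derivative.
    D-cube : ∀ x → D (x ^ 3) ≈ ι (+ 3) * (x * x) * D x
    D-cube x = begin
      D (x ^ 3)                              ≈⟨ D-cong (solve 1 (λ x → x :^ 3 := x :* (x :* x)) refl x) ⟩
      D (x * (x * x))                        ≈⟨ D-* _ _ ⟩
      D x * (x * x) + x * D (x * x)          ≈⟨ +-congˡ (*-congˡ (D-* x x)) ⟩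
      D x * (x * x) + x * (D x * x + x * D x)
        ≈⟨ solve 2 (λ x x′ → x′ :* (x :* x) :+ x :* (x′ :* x :+ x :* x′) := con (+ 3) :* (x :* x) :* x′) refl x (D x) ⟩
      ι (+ 3) * (x * x) * D x                ∎

    D-inverse : ∀ {x y} → x * y ≈ ι 1ℤ → D y ≈ ι -1ℤ * (y * y) * D x
    D-inverse {x} {y} xy = begin
      D y
        ≈⟨ solve 1 (λ y′ → y′ := con 1ℤ :* y′) refl (D y) ⟩
      ι 1ℤ * D y
        ≈⟨ *-congʳ (sym xy) ⟩
      x * y * D y
        ≈⟨ solve 4 (λ x y x′ y′ → x :* y :* y′ := y :* (x′ :* y :+ x :* y′) :+ con -1ℤ :* (y :* y) :* x′) refl x y (D x) (D y) ⟩
      y * (D x * y + x * D y) + ι -1ℤ * (y * y) * D x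
        ≈⟨ +-congʳ (*-congˡ (trans (sym (D-* x y)) (trans (D-cong xy) (D-ι 1ℤ)))) ⟩
      y * ι 0ℤ + ι -1ℤ * (y * y) * D x
        ≈⟨ solve 2 (λ y t → y :* con 0ℤ :+ t := t) refl y _ ⟩
      ι -1ℤ * (y * y) * D x ∎

    ^-inverse : ∀ {x y} → x * y ≈ ι 1ℤ → ∀ n → x ^ n * y ^ n ≈ ι 1ℤ
    ^-inverse         xy zero    = solve 0 (con 1ℤ :^ 0 :* con 1ℤ :^ 0 := con 1ℤ) refl
    ^-inverse {x} {y} xy (suc n) = begin
      x * x ^ n * (y * y ^ n)
        ≈⟨ solve 4 (λ x y p q → x :* p :* (y :* q) := x :* y :* (p :* q)) refl x y (x ^ n) (y ^ n) ⟩
      x * y * (x ^ n * y ^ n) ≈⟨ *-cong xy (^-inverse xy n) ⟩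
      ι 1ℤ * ι 1ℤ             ≈⟨ solve 0 (con 1ℤ :* con 1ℤ := con 1ℤ) refl ⟩
      ι 1ℤ                    ∎

    module _ (N : ℕ) (3^N≈0 : ι (+ 3) ^ N ≈ ι 0ℤ) where

      3-adic⇒0 : ∀ {x} → 3-adic N x → x ≈ ι 0ℤ
      3-adic⇒0 p with y , eq ← 3-adic⇒multiple p =
        trans eq (trans (*-congʳ 3^N≈0) (solve 1 (λ y → con 0ℤ :* y := con 0ℤ) refl y))

      -- The inverse of a modulo 3 is corrected by the finite geometric series of 1 - a b.
      unit-mod-3 : ∀ {I} → IsFiltration I → ∀ {a b y} → I 0 a → I 0 b → I 0 y →
        a * b ≈ ι 1ℤ + ι (+ 3) * y → ∃[ c ] I 0 c × a * c ≈ ι 1ℤ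
      unit-mod-3 {I} isF {a} {b} {y} pa pb py ab = c N , pc N , trans (eq N)
        (trans (+-congˡ (-‿cong (*-congʳ 3^N≈0))) (solve 1 (λ t → con 1ℤ :- con 0ℤ :* t := con 1ℤ) refl (r N)))
        where
        open IsFiltration isF
        c r : ℕ → Carrier
        c zero    = ι 0ℤ
        c (suc n) = b - ι (+ 3) * y * c n
        r zero    = ι 1ℤ
        r (suc n) = ι -1ℤ * y * r n
        pc : ∀ n → I 0 (c n)
        pc zero    = 0∈
        pc (suc n) = -∈ pb (*∈ (*∈ (ι∈ (+ 3)) py) (pc n))
        eq : ∀ n → a * c n ≈ ι 1ℤ - ι (+ 3) ^ n * r n
        eq zero    = solve 1 (λ a → a :* con 0ℤ := con 1ℤ :- con 1ℤ :^ 0 :* con 1ℤ) refl a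
        eq (suc n) = begin
          a * (b - ι (+ 3) * y * c n)
            ≈⟨ solve 4 (λ a b y c → a :* (b :- con (+ 3) :* y :* c) := a :* b :- con (+ 3) :* y :* (a :* c)) refl a b y (c n) ⟩
          a * b - ι (+ 3) * y * (a * c n)
            ≈⟨ +-cong ab (-‿cong (*-congˡ (eq n))) ⟩
          ι 1ℤ + ι (+ 3) * y - ι (+ 3) * y * (ι 1ℤ - ι (+ 3) ^ n * r n)
            ≈⟨ solve 3 (λ y t r → con 1ℤ :+ con (+ 3) :* y :- con (+ 3) :* y :* (con 1ℤ :- t :* r)
                          := con 1ℤ :- con (+ 3) :* t :* (con -1ℤ :* y :* r)) refl y (ι (+ 3) ^ n) (r n) ⟩
          ι 1ℤ - ι (+ 3) ^ suc n * r (suc n) ∎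

      -- The logarithmic derivative of a product ∏ (1 + a^(3ʲ)); modulo 3 only
      -- the factor j = 0 contributes.
      D-tower : ∀ {I} → IsFiltration I → ∀ n {a v} → I 0 a → I 0 v → (ι 1ℤ + a) * v ≈ ι 1ℤ →
        ∃[ t ] I 0 t × D (tower (suc n) a) ≈ tower (suc n) a * (D a * (v + ι (+ 3) * t))
      D-tower {I} isF zero {a} {v} pa pv av = ι 0ℤ , IsFiltration.0∈ isF , (begin
        D ((ι 1ℤ + a) * ι 1ℤ)
          ≈⟨ D-cong (solve 1 (λ a → (con 1ℤ :+ a) :* con 1ℤ := con 1ℤ :+ a) refl a) ⟩
        D (ι 1ℤ + a)
          ≈⟨ D-1+ a ⟩
        D a
          ≈⟨ solve 1 (λ a′ → a′ := a′ :* con 1ℤ) refl (D a) ⟩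
        D a * ι 1ℤ
          ≈⟨ *-congˡ (sym av) ⟩
        D a * ((ι 1ℤ + a) * v)
          ≈⟨ solve 3 (λ a a′ v → a′ :* ((con 1ℤ :+ a) :* v)
               := (con 1ℤ :+ a) :* con 1ℤ :* (a′ :* (v :+ con (+ 3) :* con 0ℤ))) refl a (D a) v ⟩
        (ι 1ℤ + a) * ι 1ℤ * (D a * (v + ι (+ 3) * ι 0ℤ)) ∎)
      D-tower {I} isF (suc n) {a} {v} pa pv av = t , pt , (begin
        D ((ι 1ℤ + a) * T)
          ≈⟨ D-* _ _ ⟩
        D (ι 1ℤ + a) * T + (ι 1ℤ + a) * D T
          ≈⟨ +-cong (*-congʳ (D-1+ a)) (*-congˡ DT) ⟩
        D a * T + (ι 1ℤ + a) * (T * (D (a ^ 3) * (c + ι (+ 3) * t′)))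
          ≈⟨ +-cong (solve 2 (λ a′ T → a′ :* T := con 1ℤ :* (a′ :* T)) refl (D a) T)
                    (*-congˡ (*-congˡ (*-congʳ (D-cube a)))) ⟩
        ι 1ℤ * (D a * T) + (ι 1ℤ + a) * (T * (ι (+ 3) * (a * a) * D a * (c + ι (+ 3) * t′)))
          ≈⟨ +-congʳ (*-congʳ (sym av)) ⟩
        (ι 1ℤ + a) * v * (D a * T) + (ι 1ℤ + a) * (T * (ι (+ 3) * (a * a) * D a * (c + ι (+ 3) * t′)))
          ≈⟨ solve 6 (λ a v a′ T c t′ →
               (con 1ℤ :+ a) :* v :* (a′ :* T)
                 :+ (con 1ℤ :+ a) :* (T :* (con (+ 3) :* (a :* a) :* a′ :* (c :+ con (+ 3) :* t′)))
               := (con 1ℤ :+ a) :* T :* (a′ :* (v :+ con (+ 3) :* (a :* a :* (c :+ con (+ 3) :* t′)))))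
               refl a v (D a) T c t′ ⟩
        (ι 1ℤ + a) * T * (D a * (v + ι (+ 3) * t)) ∎)
        where
        open IsFiltration isF
        -- As 1 + a³ = (1 + a)³ - 3 (a + a²), the cube of the inverse of 1 + a inverts it up to a
        -- multiple of 3.
        cube-inverse : ∃[ c ] I 0 c × (ι 1ℤ + a ^ 3) * c ≈ ι 1ℤ
        cube-inverse = unit-mod-3 isF {ι 1ℤ + a ^ 3} {v ^ 3} {ι -1ℤ * (a + a * a) * v ^ 3}
          (+∈ (ι∈ 1ℤ) (^∈ pa 3)) (^∈ pv 3) (*∈ (*∈ (ι∈ -1ℤ) (+∈ pa (*∈ pa pa))) (^∈ pv 3))
          (begin
            (ι 1ℤ + a ^ 3) * v ^ 3
              ≈⟨ solve 2 (λ a v → (con 1ℤ :+ a :^ 3) :* v :^ 3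
                   := ((con 1ℤ :+ a) :* v) :^ 3 :+ con (+ 3) :* (con -1ℤ :* (a :+ a :* a) :* v :^ 3)) refl a v ⟩
            ((ι 1ℤ + a) * v) ^ 3 + ι (+ 3) * (ι -1ℤ * (a + a * a) * v ^ 3)
              ≈⟨ +-congʳ (trans (^-congˡ 3 av) (solve 0 (con 1ℤ :^ 3 := con 1ℤ) refl)) ⟩
            ι 1ℤ + ι (+ 3) * (ι -1ℤ * (a + a * a) * v ^ 3) ∎)
        c = proj₁ cube-inverse
        pc = proj₁ (proj₂ cube-inverse)
        rest = D-tower isF n (^∈ pa 3) pc (proj₂ (proj₂ cube-inverse))
        t′ = proj₁ rest
        T = tower (suc n) (a ^ 3)
        DT : D T ≈ T * (D (a ^ 3) * (c + ι (+ 3) * t′))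
        DT = proj₂ (proj₂ rest)
        t = a * a * (c + ι (+ 3) * t′)
        pt : I 0 t
        pt = *∈ (*∈ pa pa) (+∈ pc (*∈ (ι∈ (+ 3)) (proj₁ (proj₂ rest))))

    -- ρ collects the factors 1 + w^(3ʲ) of Ψ whose derivatives vanish modulo 3ᴺ.
    module Setting (z z⁻¹ w u Ψ θ ρ : Carrier) (ε : ℤ) (γ N : ℕ)
      (3^N≈0 : ι (+ 3) ^ N ≈ ι 0ℤ)
      (z-inverse : z * z⁻¹ ≈ ι 1ℤ)
      (D-z : D z ≈ ι 1ℤ)
      (w≈ : w ≈ ι ε * z ^ γ)
      (w-inverse : (ι 1ℤ + w) * u ≈ ι 1ℤ)
      (Ψ²≈ : Ψ * Ψ ≈ u + ι (+ 3) * θ)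
      (Ψ≈ : Ψ ≈ tower (suc N) w * ρ)
      (D-ρ : D ρ ≈ ι 0ℤ) where

      data IsBase : Carrier → Set where
        base-ι   : ∀ a → IsBase (ι a)
        base-z   : IsBase z
        base-z⁻¹ : IsBase z⁻¹
        base-u   : IsBase u

      -- The differential algebra ℤ[z, z⁻¹, u, Ψ] is filtered by the powers of the ideal
      -- (3, Ψ² - u), all of whose elements are divisible by 3.
      data IsGenerator : Carrier → Set where
        base  : ∀ {g} → IsBase g → IsGenerator g
        gen-Ψ : IsGenerator Ψ

      data IsSmall : Carrier → Set where
        small-3 : IsSmall (ι (+ 3))
        small-θ : IsSmall (Ψ * Ψ - u)

      -- `R 0` is ℤ[z, z⁻¹, u], the ring in which the coefficients of the final expansion must lie;
      -- `I 0` adjoins Ψ to it.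
      R I : ℕ → Carrier → Set
      R = Generated IsBase (_≈ ι (+ 3))
      I = Generated IsGenerator IsSmall

      z^∈ : ∀ n → R 0 (z ^ n)
      z^∈ zero    = respᴳ ι-1 (gen⁰ (base-ι 1ℤ))
      z^∈ (suc n) = base-z *⁰ z^∈ n

      D-z^∈ : ∀ n → R 0 (D (z ^ n))
      D-z^∈ zero    = respᴳ (trans (sym (D-ι 1ℤ)) (D-cong ι-1)) 0ᴳ
      D-z^∈ (suc n) = respᴳ (sym (D-* _ _))
        (respᴳ (*-congʳ (sym D-z)) (base-ι 1ℤ *⁰ z^∈ n) +ᴳ (base-z *⁰ D-z^∈ n))

      w∈ : R 0 w
      w∈ = respᴳ (sym w≈) (base-ι ε *⁰ z^∈ γ)

      D-w∈ : R 0 (D w)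
      D-w∈ = respᴳ (sym (trans (D-cong w≈) (D-* _ _)))
        (generated-* (respᴳ (sym (D-ι ε)) 0ᴳ) (z^∈ γ) +ᴳ (base-ι ε *⁰ D-z^∈ γ))

      D-u : D u ≈ ι -1ℤ * (u * u) * D w
      D-u = trans (D-inverse w-inverse) (*-congˡ (D-1+ w))

      D-base∈ : ∀ {g} → IsBase g → R 0 (D g)
      D-base∈ (base-ι a) = respᴳ (sym (D-ι a)) 0ᴳ
      D-base∈ base-z     = respᴳ (sym D-z) 1ᴳ
      D-base∈ base-z⁻¹   = respᴳ (sym (trans (D-inverse z-inverse) (*-congˡ D-z)))
        (generated-* (base-ι -1ℤ *⁰ (base-z⁻¹ *⁰ gen⁰ base-z⁻¹)) 1ᴳ)
      D-base∈ base-u     = respᴳ (sym D-u) (generated-* (base-ι -1ℤ *⁰ (base-u *⁰ gen⁰ base-u)) D-w∈)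

      R-isFiltration : IsFiltration R
      R-isFiltration = generated-isFiltration base-ι refl (λ e → gen⁰′ e) D-base∈
        (λ e → respᴳ (D-cong (sym e)) (D-3 1))
        where
        gen⁰′ : ∀ {g} → g ≈ ι (+ 3) → R 0 g
        gen⁰′ e = respᴳ (sym e) (gen⁰ (base-ι (+ 3)))

      R⊆I : ∀ {x} → R 0 x → I 0 x
      R⊆I (respᴳ e p) = respᴳ e (R⊆I p)
      R⊆I 0ᴳ          = 0ᴳ
      R⊆I 1ᴳ          = 1ᴳ
      R⊆I (p +ᴳ q)    = R⊆I p +ᴳ R⊆I q
      R⊆I (h *⁰ p)    = base h *⁰ R⊆I p

      private
        D-Ψ-tower = D-tower N 3^N≈0 R-isFiltration N w∈ (gen⁰ base-u) w-inverse
        t = proj₁ D-Ψ-tower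
        t∈ : I 0 t
        t∈ = R⊆I (proj₁ (proj₂ D-Ψ-tower))
        u∈ : I 0 u
        u∈ = gen⁰ (base base-u)
        ιᴳ : ∀ a → I 0 (ι a)
        ιᴳ a = gen⁰ (base (base-ι a))

      -- Since `ρ` is constant for `D`, the logarithmic derivative of Ψ is that of a finite product
      -- and lies in ℤ[z, z⁻¹, u]. This makes the algebra generated by Ψ differential.
      D-Ψ : D Ψ ≈ Ψ * (D w * (u + ι (+ 3) * t))
      D-Ψ = begin
        D Ψ                                         ≈⟨ D-cong Ψ≈ ⟩
        D (T * ρ)                                   ≈⟨ D-* _ _ ⟩
        D T * ρ + T * D ρ                           ≈⟨ +-cong (*-congʳ (proj₂ (proj₂ D-Ψ-tower))) (*-congˡ D-ρ) ⟩
        T * (D w * (u + ι (+ 3) * t)) * ρ + T * ι 0ℤ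
          ≈⟨ solve 3 (λ T L ρ → T :* L :* ρ :+ T :* con 0ℤ := T :* ρ :* L) refl T _ ρ ⟩
        T * ρ * (D w * (u + ι (+ 3) * t))           ≈⟨ *-congʳ (sym Ψ≈) ⟩
        Ψ * (D w * (u + ι (+ 3) * t))               ∎
        where T = tower (suc N) w

      D-generator∈ : ∀ {g} → IsGenerator g → I 0 (D g)
      D-generator∈ (base h) = R⊆I (D-base∈ h)
      D-generator∈ gen-Ψ    = respᴳ (sym D-Ψ)
        (gen-Ψ *⁰ generated-* (R⊆I D-w∈) (u∈ +ᴳ (base (base-ι (+ 3)) *⁰ t∈)))

      -- The derivative of Ψ² - u is again small because D w / (1 + w) is, up to
      -- sign and modulo 3, the logarithmic derivative of both Ψ² and u.
      D-small∈ : ∀ {g} → IsSmall g → I 1 (D g)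
      D-small∈ small-3 = respᴳ (sym (D-ι (+ 3))) 0ᴳ
      D-small∈ small-θ = respᴳ (sym eq)
        ((small-θ *¹ generated-* (ιᴳ (+ 2)) (generated-* (R⊆I D-w∈) (u∈ +ᴳ (base (base-ι (+ 3)) *⁰ t∈))))
          +ᴳ (small-3 *¹ generated-* (u∈ *ᴳ′ R⊆I D-w∈) (u∈ +ᴳ generated-* (ιᴳ (+ 2)) t∈)))
        where
        _*ᴳ′_ : ∀ {x y} → I 0 x → I 0 y → I 0 (x * y)
        _*ᴳ′_ = generated-*
        L = D w * (u + ι (+ 3) * t)
        -- D(Ψ²) = 2 L Ψ² = 2 L (Ψ² - u) + 2 L u and - D u = u² D w; in 2 L u + u² D w the two terms
        -- u² D w, with coefficients 2 and 1, add up to a multiple of 3.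
        eq : D (Ψ * Ψ - u) ≈ (Ψ * Ψ - u) * (ι (+ 2) * L) + ι (+ 3) * (u * D w * (u + ι (+ 2) * t))
        eq = begin
          D (Ψ * Ψ - u)
            ≈⟨ D-cong (solve 2 (λ Ψ u → Ψ :* Ψ :- u := Ψ :* Ψ :+ con -1ℤ :* u) refl Ψ u) ⟩
          D (Ψ * Ψ + ι -1ℤ * u)
            ≈⟨ D-+ _ _ ⟩
          D (Ψ * Ψ) + D (ι -1ℤ * u)
            ≈⟨ +-cong (D-* _ _) (D-* _ _) ⟩
          D Ψ * Ψ + Ψ * D Ψ + (D (ι -1ℤ) * u + ι -1ℤ * D u)
            ≈⟨ +-cong (+-cong (*-congʳ D-Ψ) (*-congˡ D-Ψ)) (+-cong (*-congʳ (D-ι -1ℤ)) (*-congˡ D-u)) ⟩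
          Ψ * L * Ψ + Ψ * (Ψ * L) + (ι 0ℤ * u + ι -1ℤ * (ι -1ℤ * (u * u) * D w))
            ≈⟨ solve 4 (λ Ψ u w′ t → let L = w′ :* (u :+ con (+ 3) :* t) in
                 Ψ :* L :* Ψ :+ Ψ :* (Ψ :* L) :+ (con 0ℤ :* u :+ con -1ℤ :* (con -1ℤ :* (u :* u) :* w′))
                 := (Ψ :* Ψ :- u) :* (con (+ 2) :* L) :+ con (+ 3) :* (u :* w′ :* (u :+ con (+ 2) :* t)))
                 refl Ψ u (D w) t ⟩
          (Ψ * Ψ - u) * (ι (+ 2) * L) + ι (+ 3) * (u * D w * (u + ι (+ 2) * t)) ∎

      I-isFiltration : IsFiltration I
      I-isFiltration = generated-isFiltration (λ a → base (base-ι a)) small-3 small⊆ D-generator∈ D-small∈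
        where
        small⊆ : ∀ {g} → IsSmall g → I 0 g
        small⊆ small-3 = ιᴳ (+ 3)
        small⊆ small-θ = (gen-Ψ *⁰ gen⁰ gen-Ψ) +ᴳ
          respᴳ (solve 1 (λ u → con -1ℤ :* u := :- u) refl u) (base (base-ι -1ℤ) *⁰ u∈)

      -- Here `Ψ²≈` enters: depth β in the formal ideal becomes divisibility by 3^β, so depth N
      -- means zero.
      I⊆3-adic : ∀ {β x} → I β x → 3-adic β x
      I⊆3-adic = generated-⊆ 3-adic-isFiltration (λ _ → gen⁰ tt) small⊆
        where
        small⊆ : ∀ {g} → IsSmall g → 3-adic 1 g
        small⊆ small-3 = gen¹ refl
        small⊆ small-θ = respᴳ (sym (trans (+-congʳ Ψ²≈)
          (solve 2 (λ u θ → u :+ con (+ 3) :* θ :- u := con (+ 3) :* θ) refl u θ))) (refl *¹ gen⁰ tt)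

      -- Elements with a Horner expression in Ψ having n coefficients in `R 0`. Only existence is
      -- recorded; no independence of the powers of Ψ is claimed.
      data PolyΨ : ℕ → Carrier → Set where
        nil  : ∀ {x} → x ≈ ι 0ℤ → PolyΨ 0 x
        cons : ∀ {n x a y} → R 0 a → PolyΨ n y → x ≈ a + Ψ * y → PolyΨ (suc n) x

      poly-resp : ∀ {n x y} → x ≈ y → PolyΨ n x → PolyΨ n y
      poly-resp e (nil eq)      = nil (trans (sym e) eq)
      poly-resp e (cons a p eq) = cons a p (trans (sym e) eq)

      poly-0 : ∀ {n} → PolyΨ n (ι 0ℤ)
      poly-0 {zero}  = nil refl
      poly-0 {suc n} = cons 0ᴳ poly-0 (solve 1 (λ Ψ → con 0ℤ := con 0ℤ :+ Ψ :* con 0ℤ) refl Ψ)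

      poly-+ : ∀ {n x y} → PolyΨ n x → PolyΨ n y → PolyΨ n (x + y)
      poly-+ (nil e) (nil e′) = nil (trans (+-cong e e′) (solve 0 (con 0ℤ :+ con 0ℤ := con 0ℤ) refl))
      poly-+ (cons {a = a} {x} pa px e) (cons {a = b} {y} pb py e′) = cons (pa +ᴳ pb) (poly-+ px py)
        (trans (+-cong e e′) (solve 5 (λ a b x y Ψ → a :+ Ψ :* x :+ (b :+ Ψ :* y) := a :+ b :+ Ψ :* (x :+ y))
          refl a b x y Ψ))

      poly-scale : ∀ {n x c} → R 0 c → PolyΨ n x → PolyΨ n (c * x)
      poly-scale {c = c} pc (nil e) = nil (trans (*-congˡ e) (solve 1 (λ c → c :* con 0ℤ := con 0ℤ) refl c))
      poly-scale {c = c} pc (cons {a = a} {x} pa px e) = cons (generated-* pc pa) (poly-scale pc px)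
        (trans (*-congˡ e) (solve 4 (λ c a x Ψ → c :* (a :+ Ψ :* x) := c :* a :+ Ψ :* (c :* x)) refl c a x Ψ))

      poly-Ψ* : ∀ {n x} → PolyΨ n x → PolyΨ (suc n) (Ψ * x)
      poly-Ψ* {x = x} p = cons 0ᴳ p (solve 2 (λ x Ψ → Ψ :* x := con 0ℤ :+ Ψ :* x) refl x Ψ)

      poly-Ψ^ : ∀ n → PolyΨ (suc n) (Ψ ^ n)
      poly-Ψ^ zero    = cons 1ᴳ (nil refl) (solve 1 (λ Ψ → con 1ℤ :^ 0 := con 1ℤ :+ Ψ :* con 0ℤ) refl Ψ)
      poly-Ψ^ (suc n) = poly-Ψ* (poly-Ψ^ n)

      poly-suc : ∀ {n x} → PolyΨ n x → PolyΨ (suc n) x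
      poly-suc (nil e)       = poly-resp (sym e) poly-0
      poly-suc (cons pa p e) = cons pa (poly-suc p) e

      poly-leading : ∀ {n x} → PolyΨ (suc n) x →
        ∃[ a ] ∃[ y ] R 0 a × PolyΨ n y × x ≈ y + a * Ψ ^ n
      poly-leading {zero} (cons {a = a} {y} pa (nil e) e′) = a , ι 0ℤ , pa , poly-0 ,
        trans e′ (trans (+-congˡ (*-congˡ e))
          (solve 2 (λ a Ψ → a :+ Ψ :* con 0ℤ := con 0ℤ :+ a :* Ψ :^ 0) refl a Ψ))
      poly-leading {suc n} (cons {a = a} pa p e) with b , y , pb , py , e′ ← poly-leading p =
        b , a + Ψ * y , pb , cons pa py refl ,
        trans e (trans (+-congˡ (*-congˡ e′))
          (solve 5 (λ a b y Ψ t → a :+ Ψ :* (y :+ b :* t) := a :+ Ψ :* y :+ b :* (Ψ :* t)) refl a b y Ψ (Ψ ^ n)))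

      -- The leading power cancels because (Ψ² - u)^n is monic in Ψ. With a = Ψ^(2n) and b = (Ψ² -
      -- u)^n, the next difference is Ψ² (a - b) + u b, where b is recovered as a - (a - b).
      poly-θ^ : ∀ n → PolyΨ (n ℕ.* 2) (Ψ ^ (n ℕ.* 2) - (Ψ * Ψ - u) ^ n)
      poly-θ^ zero    = nil (solve 1 (λ x → x :^ 0 :- x :^ 0 := con 0ℤ) refl Ψ)
      poly-θ^ (suc n) = poly-resp
        (solve 4 (λ Ψ u a b → Ψ :* (Ψ :* (a :- b)) :+ u :* (a :+ con -1ℤ :* (a :- b))
          := Ψ :* (Ψ :* a) :- (Ψ :* Ψ :- u) :* b) refl Ψ u (Ψ ^ (n ℕ.* 2)) ((Ψ * Ψ - u) ^ n))
        (poly-+ (poly-Ψ* (poly-Ψ* (poly-θ^ n)))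
                (poly-suc (poly-scale (gen⁰ base-u)
                  (poly-+ (poly-Ψ^ (n ℕ.* 2)) (poly-scale (gen⁰ (base-ι -1ℤ)) (poly-suc (poly-θ^ n)))))))

      θ^N≈0 : (Ψ * Ψ - u) ^ N ≈ ι 0ℤ
      θ^N≈0 = 3-adic⇒0 N 3^N≈0 (go N)
        where
        go : ∀ n → 3-adic n ((Ψ * Ψ - u) ^ n)
        go zero    = gen⁰ tt
        go (suc n) = generated-* (I⊆3-adic (gen¹ small-θ)) (go n)

      -- (Ψ² - u)^N is a monic relation of degree 2N for Ψ, so the top power Ψ^(2N) can be traded
      -- for lower ones.
      poly-reduce : ∀ {x} → PolyΨ (suc (N ℕ.* 2)) x → PolyΨ (N ℕ.* 2) x
      poly-reduce p with a , y , pa , py , e ← poly-leading p = poly-resp (sym eq)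
          (poly-+ py (poly-scale pa (poly-θ^ N)))
        where
        eq : _ ≈ y + a * (Ψ ^ (N ℕ.* 2) - (Ψ * Ψ - u) ^ N)
        eq = trans e (+-congˡ (*-congˡ (trans (solve 1 (λ t → t := t :- con 0ℤ) refl _)
          (+-congˡ (-‿cong (sym θ^N≈0))))))

      poly-1 : PolyΨ (N ℕ.* 2) (ι 1ℤ)
      poly-1 = go N 3^N≈0
        where
        go : ∀ N → ι (+ 3) ^ N ≈ ι 0ℤ → PolyΨ (N ℕ.* 2) (ι 1ℤ)
        -- For N = 0 there is no room for a constant coefficient, but then 3^0 = 0 makes the ring
        -- trivial.
        go zero    e = nil (trans ι-1 e)
        go (suc n) _ = cons 1ᴳ poly-0 (solve 1 (λ Ψ → con 1ℤ := con 1ℤ :+ Ψ :* con 0ℤ) refl Ψ)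

      -- A letter of a word raises the degree in Ψ by at most one, and the excess is removed at
      -- once; the bound 2N is therefore an invariant of the induction.
      poly∈ : ∀ {x} → I 0 x → PolyΨ (N ℕ.* 2) x
      poly∈ (respᴳ e p)      = poly-resp e (poly∈ p)
      poly∈ 0ᴳ               = poly-0
      poly∈ 1ᴳ               = poly-1
      poly∈ (p +ᴳ q)         = poly-+ (poly∈ p) (poly∈ q)
      poly∈ (base g *⁰ p)    = poly-scale (gen⁰ g) (poly∈ p)
      poly∈ (gen-Ψ *⁰ p)     = poly-reduce (poly-Ψ* (poly∈ p))

      poly⇒sum : ∀ {n x} → PolyΨ n x → ∃[ a ] (∀ i → R 0 (a i)) ×
        x ≈ sum {n} (λ i → a i * Ψ ^ toℕ i)
      poly⇒sum (nil e) = (λ ()) , (λ ()) , trans e ι-0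
      poly⇒sum {suc n} (cons {a = a₀} pa p e) with a , ha , eq ← poly⇒sum p =
        (λ { zero → a₀ ; (suc i) → a i }) , (λ { zero → pa ; (suc i) → ha i }) ,
        trans e (+-cong (sym (*-identityʳ a₀)) (begin
          Ψ * _             ≈⟨ *-congˡ eq ⟩
          Ψ * sum (term a)  ≈⟨ *-distribˡ-sum Ψ (term a) ⟩
          sum (λ i → Ψ * term a i)
            ≈⟨ sum-cong-≋ {n} {λ i → Ψ * term a i} {λ i → a i * (Ψ * Ψ ^ toℕ i)}
                 (λ i → solve 3 (λ Ψ a t → Ψ :* (a :* t) := a :* (Ψ :* t)) refl Ψ (a i) (Ψ ^ toℕ i)) ⟩
          sum (λ i → a i * (Ψ * Ψ ^ toℕ i)) ∎))
        where
        term : (Fin n → Carrier) → Fin n → Carrier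
        term a i = a i * Ψ ^ toℕ i

      -- The starting value, its refinement, and the comparison with F

      module Solution (c₀ c₁ c₂ : Carrier) (s : ℕ) (Q : MvPoly (2 ℕ.+ s))
        (c₀∈ : R 0 c₀) (c₁∈ : R 0 c₁) (c₂∈ : R 0 c₂)
        (e₁ e₂ f₁ f₂ : ℕ) (k k′ : Carrier) (k∈ : R 0 k) (k′∈ : R 0 k′)
        (c₂≈ : c₂ ≈ z ^ e₁ * (ι 1ℤ + w) ^ e₂ + ι (+ 3) * k)
        (disc≈ : c₁ ^ 2 - c₀ * c₂ ≈ (z ^ f₁ * (ι 1ℤ + w) ^ f₂) ^ 2 * (ι 1ℤ + w) + ι (+ 3) * k′)
        (F σ y : Carrier) (σ∈ : R 0 σ) (σ² : σ * σ ≈ ι 1ℤ)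
        where

        open Equation z c₀ c₁ c₂ s Q
        open IsFiltration I-isFiltration

        private
          -- `d` inverts c₂ modulo 3, as `c₂d` shows. `l` inverts `B` modulo I, because B² ≡ X² v
          -- and `Y`, `u` are the inverses of `X`, `v`. No division by 2 occurs in `x₁`: modulo 3
          -- the quadratic formula has 2 = -1 and 4 = 1.
          v X B d l x₁ : Carrier
          v = ι 1ℤ + w
          X = z ^ f₁ * v ^ f₂
          Y = z⁻¹ ^ f₁ * u ^ f₂
          B = σ * (X * (v * Ψ))
          d = z⁻¹ ^ e₁ * u ^ e₂
          l = B * (Y * Y * u)
          x₁ = (c₁ - B) * d

          v∈ : R 0 v
          v∈ = 1ᴳ +ᴳ w∈

          X∈ : R 0 X
          X∈ = generated-* (z^∈ f₁) (IsFiltration.^∈ R-isFiltration v∈ f₂)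

          Y∈ : R 0 Y
          Y∈ = generated-* (IsFiltration.^∈ R-isFiltration (gen⁰ base-z⁻¹) f₁)
                           (IsFiltration.^∈ R-isFiltration (gen⁰ base-u) f₂)

          d∈ : I 0 d
          d∈ = R⊆I (generated-* (IsFiltration.^∈ R-isFiltration (gen⁰ base-z⁻¹) e₁)
                                (IsFiltration.^∈ R-isFiltration (gen⁰ base-u) e₂))

          B∈ : I 0 B
          B∈ = *∈ (R⊆I σ∈) (*∈ (R⊆I X∈) (*∈ (R⊆I v∈) (gen⁰ gen-Ψ)))

          l∈ : I 0 l
          l∈ = *∈ B∈ (R⊆I (generated-* (generated-* Y∈ Y∈) (gen⁰ base-u)))

          x₁∈ : I 0 x₁
          x₁∈ = *∈ (-∈ (R⊆I c₁∈) B∈) d∈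

          product-inverse : ∀ m n → (z ^ m * v ^ n) * (z⁻¹ ^ m * u ^ n) ≈ ι 1ℤ
          product-inverse m n = begin
            z ^ m * v ^ n * (z⁻¹ ^ m * u ^ n)
              ≈⟨ solve 4 (λ a b a′ b′ → a :* b :* (a′ :* b′) := a :* a′ :* (b :* b′)) refl (z ^ m) (v ^ n) (z⁻¹ ^ m) (u ^ n) ⟩
            z ^ m * z⁻¹ ^ m * (v ^ n * u ^ n)
              ≈⟨ *-cong (^-inverse z-inverse m) (^-inverse w-inverse n) ⟩
            ι 1ℤ * ι 1ℤ
              ≈⟨ solve 0 (con 1ℤ :* con 1ℤ := con 1ℤ) refl ⟩
            ι 1ℤ ∎

          c₂d : c₂ * d ≈ ι 1ℤ + ι (+ 3) * (k * d)
          c₂d = begin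
            c₂ * d
              ≈⟨ *-congʳ c₂≈ ⟩
            (z ^ e₁ * v ^ e₂ + ι (+ 3) * k) * d
              ≈⟨ solve 3 (λ a k d → (a :+ con (+ 3) :* k) :* d := a :* d :+ con (+ 3) :* (k :* d)) refl _ k d ⟩
            z ^ e₁ * v ^ e₂ * d + ι (+ 3) * (k * d)
              ≈⟨ +-congʳ (product-inverse e₁ e₂) ⟩
            ι 1ℤ + ι (+ 3) * (k * d) ∎

          -- Only σ² = 1 is used, so both signs are treated together. The rest is (v Ψ)² = v² u + v²
          -- (Ψ² - u) together with v u = 1.
          B² : B * B ≈ X * X * v + (Ψ * Ψ - u) * (X * X * (v * v))
          B² = begin
            B * B
              ≈⟨ solve 4 (λ σ X v Ψ → σ :* (X :* (v :* Ψ)) :* (σ :* (X :* (v :* Ψ)))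
                   := σ :* σ :* (X :* X :* (v :* v) :* (Ψ :* Ψ))) refl σ X v Ψ ⟩
            σ * σ * (X * X * (v * v) * (Ψ * Ψ))
              ≈⟨ *-congʳ σ² ⟩
            ι 1ℤ * (X * X * (v * v) * (Ψ * Ψ))
              ≈⟨ solve 4 (λ X v Ψ u → con 1ℤ :* (X :* X :* (v :* v) :* (Ψ :* Ψ))
                   := X :* X :* v :* (v :* u) :+ (Ψ :* Ψ :- u) :* (X :* X :* (v :* v))) refl X v Ψ u ⟩
            X * X * v * (v * u) + (Ψ * Ψ - u) * (X * X * (v * v))
              ≈⟨ +-congʳ (*-congˡ w-inverse) ⟩
            X * X * v * ι 1ℤ + (Ψ * Ψ - u) * (X * X * (v * v))
              ≈⟨ solve 2 (λ a b → a :* con 1ℤ :+ b := a :+ b) refl _ _ ⟩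
            X * X * v + (Ψ * Ψ - u) * (X * X * (v * v)) ∎

          θ∈ : I 1 (Ψ * Ψ - u)
          θ∈ = gen¹ small-θ

          Bl : I 1 (B * l - ι 1ℤ)
          Bl = resp (sym eq) (*∈ʳ θ∈ (R⊆I (generated-* (generated-* (generated-* X∈ X∈) (generated-* v∈ v∈))
                                              (generated-* (generated-* Y∈ Y∈) (gen⁰ base-u)))))
            where
            XY : X * Y ≈ ι 1ℤ
            XY = product-inverse f₁ f₂
            eq : B * l - ι 1ℤ ≈ (Ψ * Ψ - u) * (X * X * (v * v) * (Y * Y * u))
            eq = begin
              B * (B * (Y * Y * u)) - ι 1ℤ
                ≈⟨ solve 2 (λ B m → B :* (B :* m) :- con 1ℤ := B :* B :* m :- con 1ℤ) refl B (Y * Y * u) ⟩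
              B * B * (Y * Y * u) - ι 1ℤ
                ≈⟨ +-congʳ (*-congʳ B²) ⟩
              (X * X * v + (Ψ * Ψ - u) * (X * X * (v * v))) * (Y * Y * u) - ι 1ℤ
                ≈⟨ solve 5 (λ X Y v u t → (X :* X :* v :+ t :* (X :* X :* (v :* v))) :* (Y :* Y :* u) :- con 1ℤ
                     := X :* Y :* (X :* Y) :* (v :* u) :- con 1ℤ :+ t :* (X :* X :* (v :* v) :* (Y :* Y :* u)))
                     refl X Y v u (Ψ * Ψ - u) ⟩
              X * Y * (X * Y) * (v * u) - ι 1ℤ + (Ψ * Ψ - u) * (X * X * (v * v) * (Y * Y * u))
                ≈⟨ +-congʳ (+-congʳ (*-cong (*-cong XY XY) w-inverse)) ⟩
              ι 1ℤ * ι 1ℤ * ι 1ℤ - ι 1ℤ + (Ψ * Ψ - u) * (X * X * (v * v) * (Y * Y * u))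
                ≈⟨ solve 1 (λ t → con 1ℤ :* con 1ℤ :* con 1ℤ :- con 1ℤ :+ t := t) refl _ ⟩
              (Ψ * Ψ - u) * (X * X * (v * v) * (Y * Y * u)) ∎

          three : ∀ {x} → I 0 x → I 1 (ι (+ 3) * x)
          three p = *∈ 3∈ p

          -- Up to multiples of 3, c₂ d = 1 gives 2 c₂ x₁ + c₁ = 2 (c₁ - B) + c₁ = 3 c₁ - 2 B, and
          -- -2 = 1. The slope at the starting value is thus the square root `B`, a unit modulo I.
          A-x₁ : I 1 (A x₁ - B)
          A-x₁ = resp (sym eq) (three (+∈ (-∈ (R⊆I c₁∈) B∈)
                   (*∈ (*∈ (ι∈ (+ 2)) (*∈ (R⊆I k∈) d∈)) (-∈ (R⊆I c₁∈) B∈))))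
            where
            eq : A x₁ - B ≈ ι (+ 3) * (c₁ - B + ι (+ 2) * (k * d) * (c₁ - B))
            eq = begin
              ι (+ 2) * c₂ * ((c₁ - B) * d) + c₁ - B
                ≈⟨ solve 4 (λ c₁ c₂ B d → con (+ 2) :* c₂ :* ((c₁ :- B) :* d) :+ c₁ :- B
                     := con (+ 2) :* (c₂ :* d) :* (c₁ :- B) :+ (c₁ :- B)) refl c₁ c₂ B d ⟩
              ι (+ 2) * (c₂ * d) * (c₁ - B) + (c₁ - B)
                ≈⟨ +-congʳ (*-congʳ (*-congˡ c₂d)) ⟩
              ι (+ 2) * (ι 1ℤ + ι (+ 3) * (k * d)) * (c₁ - B) + (c₁ - B)
                ≈⟨ solve 3 (λ kd c₁ B → con (+ 2) :* (con 1ℤ :+ con (+ 3) :* kd) :* (c₁ :- B) :+ (c₁ :- B)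
                     := con (+ 3) :* (c₁ :- B :+ con (+ 2) :* kd :* (c₁ :- B))) refl (k * d) c₁ B ⟩
              ι (+ 3) * (c₁ - B + ι (+ 2) * (k * d) * (c₁ - B)) ∎

          A-x₁-inverse : I 1 (A x₁ * l - ι 1ℤ)
          A-x₁-inverse = resp
            (solve 3 (λ a B l → (a :- B) :* l :+ (B :* l :- con 1ℤ) := a :* l :- con 1ℤ) refl (A x₁) B l)
            (+∈ (*∈ʳ A-x₁ l∈) Bl)

          B²-disc : I 1 (B * B - (c₁ ^ 2 - c₀ * c₂))
          B²-disc = resp (sym eq) (-∈ (*∈ʳ θ∈ (R⊆I (generated-* (generated-* X∈ X∈) (generated-* v∈ v∈))))
                                      (three (R⊆I k′∈)))
            where
            eq : B * B - (c₁ ^ 2 - c₀ * c₂) ≈ (Ψ * Ψ - u) * (X * X * (v * v)) - ι (+ 3) * k′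
            eq = trans (+-cong B² (-‿cong disc≈))
              (solve 4 (λ X v t k′ → X :* X :* v :+ t :- (X :^ 2 :* v :+ con (+ 3) :* k′)
                := t :- con (+ 3) :* k′) refl X v _ k′)

          -- Completing the square: 4 c₂ p = A² - (c₁² - 4 c₀ c₂).
          P-x₁ : I 1 (P x₁)
          P-x₁ = +∈ p∈ (three (eval∈ Q (arguments x₁) (q-arguments∈ I-isFiltration z∈ c₀∈′ c₁∈′ c₂∈′ x₁∈)))
            where
            z∈ = gen⁰ (base base-z)
            c₀∈′ = R⊆I c₀∈
            c₁∈′ = R⊆I c₁∈
            c₂∈′ = R⊆I c₂∈
            p : Carrier
            p = c₂ * x₁ ^ 2 + c₁ * x₁ + c₀
            p∈₀ : I 0 p
            p∈₀ = +∈ (+∈ (*∈ c₂∈′ (^∈ x₁∈ 2)) (*∈ c₁∈′ x₁∈)) c₀∈′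
            c₂p∈ : I 1 (c₂ * p)
            -- The coefficients 4 on both sides of the completed square are replaced by 1; the last
            -- summand collects the multiples of 3 that this costs.
            c₂p∈ = resp
              (solve 5 (λ x c₀ c₁ c₂ B →
                 let p = c₂ :* x :^ 2 :+ c₁ :* x :+ c₀
                     a = con (+ 2) :* c₂ :* x :+ c₁ in
                 (a :- B) :* (a :+ B) :+ (B :* B :- (c₁ :^ 2 :- c₀ :* c₂))
                   :+ con (+ 3) :* (c₀ :* c₂ :- c₂ :* p) := c₂ :* p) refl x₁ c₀ c₁ c₂ B)
              (+∈ (+∈ (*∈ʳ A-x₁ (+∈ (+∈ (*∈ (*∈ (ι∈ (+ 2)) c₂∈′) x₁∈) c₁∈′) B∈)) B²-disc)
                  (three (-∈ (*∈ c₀∈′ c₂∈′) (*∈ c₂∈′ p∈₀))))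
            p∈ : I 1 p
            -- Multiplication by `d` cancels c₂ up to the multiple 3 k d of p.
            p∈ = resp eq (-∈ (*∈ʳ c₂p∈ d∈) (three (*∈ (*∈ (R⊆I k∈) d∈) p∈₀)))
              where
              eq : c₂ * p * d - ι (+ 3) * (k * d * p) ≈ p
              eq = begin
                c₂ * p * d - ι (+ 3) * (k * d * p)
                  ≈⟨ +-congʳ (solve 3 (λ c p d → c :* p :* d := c :* d :* p) refl c₂ p d) ⟩
                c₂ * d * p - ι (+ 3) * (k * d * p)
                  ≈⟨ +-congʳ (*-congʳ c₂d) ⟩
                (ι 1ℤ + ι (+ 3) * (k * d)) * p - ι (+ 3) * (k * d * p)
                  ≈⟨ solve 2 (λ kd p → (con 1ℤ :+ con (+ 3) :* kd) :* p :- con (+ 3) :* (kd :* p) := p) refl (k * d) p ⟩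
                p ∎

        -- `y` records that `A F` ≡ B modulo 3, that is, that F belongs to the chosen sign. The
        -- iterate x has `A x` ≡ `A x₁` ≡ B as well, and the value of `A` determines its argument
        -- modulo 3. From there uniqueness of the root takes over, in the 3-adic filtration.
        solution∈ : P F ≈ ι 0ℤ → A F ≈ B + ι (+ 3) * y → ∃[ x ] I 0 x × F ≈ x
        solution∈ PF AF = x , proj₁ (proj₂ approximation) , F≈x
          where
          approximation : ∃[ x ] I 0 x × I 1 (x - x₁) × I (suc N) (P x)
          approximation =
            newton I-isFiltration (gen⁰ (base base-z)) (R⊆I c₀∈) (R⊆I c₁∈) (R⊆I c₂∈) x₁∈ l∈ P-x₁ A-x₁-inverse N
          x : Carrier
          x = proj₁ approximation
          module T = IsFiltration 3-adic-isFiltration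
          any : ∀ x → 3-adic 0 x
          any _ = gen⁰ tt
          x≡x₁′ : 3-adic 1 (x - x₁)
          x≡x₁′ = I⊆3-adic (proj₁ (proj₂ (proj₂ approximation)))
          A-diff-identity : ∀ x₁ B →
            ι (+ 3) * y - (A x₁ - B) - (x - x₁) * (ι (+ 2) * c₂) ≈ B + ι (+ 3) * y - A x
          A-diff-identity x₁ B =
            solve 6 (λ x x₁ c₁ c₂ B y →
              con (+ 3) :* y :- (con (+ 2) :* c₂ :* x₁ :+ c₁ :- B) :- (x :- x₁) :* (con (+ 2) :* c₂)
                := B :+ con (+ 3) :* y :- (con (+ 2) :* c₂ :* x :+ c₁))
              refl x x₁ c₁ c₂ B y
          A-diff : 3-adic 1 (A F - A x)
          A-diff = T.resp (trans (A-diff-identity x₁ B) (+-congʳ (sym AF)))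
            (T.-∈ (T.-∈ (T.*∈ T.3∈ (any y)) (I⊆3-adic A-x₁)) (T.*∈ʳ x≡x₁′ (any (ι (+ 2) * c₂))))
          F≡x : 3-adic 1 (F - x)
          F≡x = T.resp eq (T.-∈ (T.*∈ T.3∈ (any (F - x + ι (+ 2) * (k * d) * (F - x)))) (T.*∈ʳ A-diff (any d)))
            where
            -- A F - A x = 2 c₂ (F - x), and -2 c₂ d ≡ 1 modulo 3; hence the minus sign, and the
            -- multiple of 3 that makes the identity exact.
            eq : ι (+ 3) * (F - x + ι (+ 2) * (k * d) * (F - x)) - (A F - A x) * d ≈ F - x
            eq = begin
              ι (+ 3) * (F - x + ι (+ 2) * (k * d) * (F - x)) - (A F - A x) * d
                ≈⟨ solve 6 (λ F x kd c₁ c₂ d →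
                     con (+ 3) :* (F :- x :+ con (+ 2) :* kd :* (F :- x))
                       :- (con (+ 2) :* c₂ :* F :+ c₁ :- (con (+ 2) :* c₂ :* x :+ c₁)) :* d
                     := con (+ 3) :* (F :- x :+ con (+ 2) :* kd :* (F :- x)) :- con (+ 2) :* (c₂ :* d) :* (F :- x))
                     refl F x (k * d) c₁ c₂ d ⟩
              ι (+ 3) * (F - x + ι (+ 2) * (k * d) * (F - x)) - ι (+ 2) * (c₂ * d) * (F - x)
                ≈⟨ +-congˡ (-‿cong (*-congʳ (*-congˡ c₂d))) ⟩
              ι (+ 3) * (F - x + ι (+ 2) * (k * d) * (F - x)) - ι (+ 2) * (ι 1ℤ + ι (+ 3) * (k * d)) * (F - x)
                ≈⟨ solve 3 (λ F x kd →
                     con (+ 3) :* (F :- x :+ con (+ 2) :* kd :* (F :- x))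
                       :- con (+ 2) :* (con 1ℤ :+ con (+ 3) :* kd) :* (F :- x) := F :- x) refl F x (k * d) ⟩
              F - x ∎
          Px≈0 : P x ≈ ι 0ℤ
          -- `newton` at N ends at depth N + 1, while depth N already means zero.
          Px≈0 = 3-adic⇒0 N 3^N≈0 (T.weaken (I⊆3-adic (proj₂ (proj₂ (proj₂ approximation)))))
          A-x-inverse : 3-adic 1 (A x * l - ι 1ℤ)
          A-x-inverse = A-invertible 3-adic-isFiltration (any z) (any c₀) (any c₁) (any c₂) (any l) x≡x₁′ (I⊆3-adic A-x₁-inverse)
          F≈x : F ≈ x
          F≈x = begin
            F           ≈⟨ solve 2 (λ F x → F := x :+ (F :- x)) refl F x ⟩
            x + (F - x) ≈⟨ +-congˡ (3-adic⇒0 N 3^N≈0 (T.weaken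
                             (root-unique 3-adic-isFiltration (any z) (any c₀) (any c₁) (any c₂) (any F) (any x) (any l) PF Px≈0 A-x-inverse F≡x N))) ⟩
            x + ι 0ℤ    ≈⟨ solve 1 (λ x → x :+ con 0ℤ := x) refl x ⟩
            x           ∎

-- The derivation on power series

module SeriesDerivative where

  open PowerSeries
  open DifferentialRings
  open import Defs
  open import Data.Integer as ℤ using (ℤ; +_; 0ℤ; 1ℤ)
  import Data.Integer.Properties as ℤ
  open import Data.Integer.Divisibility.Signed using (_∣_; divides)
  open import Data.Integer.Tactic.RingSolver using (solve-∀)
  open import Data.Nat as ℕ using (ℕ; zero; suc)
  import Data.Nat.Properties as ℕ
  open import Data.Product using (_,_)
  open import Relation.Binary.PropositionalEquality as ≡
    using (_≡_; refl; sym; trans; cong; module ≡-Reasoning)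

  z*-suc : ∀ f n → (z *ˢ f) (suc n) ≡ f n
  z*-suc f n = begin
    0ℤ ℤ.+ (tail z *ˢ f) n ≡⟨ ℤ.+-identityˡ ((tail z *ˢ f) n) ⟩
    (tail z *ˢ f) n        ≡⟨ *ˢ-cong {tail z} {1ˢ} {f} (λ { zero → refl ; (suc _) → refl }) (λ _ → refl) n ⟩
    (1ˢ *ˢ f) n            ≡⟨ *ˢ-identityˡ f n ⟩
    f n                    ∎
    where open ≡-Reasoning

  z^*-+ : ∀ m f n → (z ^ˢ m *ˢ f) (m ℕ.+ n) ≡ f n
  z^*-+ zero    f n = *ˢ-identityˡ f n
  z^*-+ (suc m) f n = begin
    (z *ˢ z ^ˢ m *ˢ f) (suc (m ℕ.+ n))     ≡⟨ *ˢ-assoc z (z ^ˢ m) f (suc (m ℕ.+ n)) ⟩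
    (z *ˢ (z ^ˢ m *ˢ f)) (suc (m ℕ.+ n))   ≡⟨ z*-suc (z ^ˢ m *ˢ f) (m ℕ.+ n) ⟩
    (z ^ˢ m *ˢ f) (m ℕ.+ n)                ≡⟨ z^*-+ m f n ⟩
    f n                                    ∎
    where open ≡-Reasoning

  z^*-< : ∀ m f {n} → n ℕ.< m → (z ^ˢ m *ˢ f) n ≡ 0ℤ
  z^*-< (suc m) f {zero}  _ = *ˢ-assoc z (z ^ˢ m) f 0
  z^*-< (suc m) f {suc n} (ℕ.s≤s n<m) = begin
    (z *ˢ z ^ˢ m *ˢ f) (suc n)     ≡⟨ *ˢ-assoc z (z ^ˢ m) f (suc n) ⟩
    (z *ˢ (z ^ˢ m *ˢ f)) (suc n)   ≡⟨ z*-suc (z ^ˢ m *ˢ f) n ⟩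
    (z ^ˢ m *ˢ f) n                ≡⟨ z^*-< m f n<m ⟩
    0ℤ                             ∎
    where open ≡-Reasoning

  ^ˢ-+ : ∀ f m n → f ^ˢ (m ℕ.+ n) ≈ˢ f ^ˢ m *ˢ f ^ˢ n
  ^ˢ-+ f zero    n i = sym (*ˢ-identityˡ (f ^ˢ n) i)
  ^ˢ-+ f (suc m) n i = trans (*ˢ-cong {f} {f} (λ _ → refl) (^ˢ-+ f m n) i) (sym (*ˢ-assoc f (f ^ˢ m) (f ^ˢ n) i))

  -- The induction uses d(z t) = t + z (d t), where t is the tail of f.
  deriv-* : ∀ f g → deriv (f *ˢ g) ≈ˢ deriv f *ˢ g +ˢ f *ˢ deriv g
  deriv-* f g zero = lem (f 0) (f 1) (g 0) (g 1)
    where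
    lem : ∀ a b c d → 1ℤ ℤ.* (a ℤ.* d ℤ.+ (b ℤ.* c ℤ.+ 0ℤ)) ≡ 1ℤ ℤ.* b ℤ.* c ℤ.+ 0ℤ ℤ.+ (a ℤ.* (1ℤ ℤ.* d) ℤ.+ 0ℤ)
    lem = solve-∀
  deriv-* f g (suc n) = begin
    + suc (suc n) ℤ.* (f 0 ℤ.* g (suc (suc n)) ℤ.+ (t *ˢ g) (suc n))
      ≡⟨ lem₁ (+ suc n) (f 0) (g (suc (suc n))) ((t *ˢ g) (suc n)) ⟩
    f 0 ℤ.* (+ suc (suc n) ℤ.* g (suc (suc n))) ℤ.+ ((t *ˢ g) (suc n) ℤ.+ + suc n ℤ.* (t *ˢ g) (suc n))
      ≡⟨ cong (λ e → f 0 ℤ.* (+ suc (suc n) ℤ.* g (suc (suc n))) ℤ.+ ((t *ˢ g) (suc n) ℤ.+ e)) (deriv-* t g n) ⟩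
    f 0 ℤ.* (+ suc (suc n) ℤ.* g (suc (suc n))) ℤ.+ ((t *ˢ g) (suc n) ℤ.+ ((deriv t *ˢ g) n ℤ.+ (t *ˢ deriv g) n))
      ≡⟨ lem₂ (f 0 ℤ.* (+ suc (suc n) ℤ.* g (suc (suc n)))) ((t *ˢ g) (suc n)) ((deriv t *ˢ g) n) ((t *ˢ deriv g) n) ⟩
    ((t *ˢ g) (suc n) ℤ.+ (deriv t *ˢ g) n) ℤ.+ (f *ˢ deriv g) (suc n)
      ≡⟨ cong (ℤ._+ (f *ˢ deriv g) (suc n)) (sym df*g) ⟩
    (deriv f *ˢ g) (suc n) ℤ.+ (f *ˢ deriv g) (suc n) ∎
    where
    open ≡-Reasoning
    t = tail f
    lem₁ : ∀ m a b e → (1ℤ ℤ.+ m) ℤ.* (a ℤ.* b ℤ.+ e) ≡ a ℤ.* ((1ℤ ℤ.+ m) ℤ.* b) ℤ.+ (e ℤ.+ m ℤ.* e)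
    lem₁ = solve-∀
    lem₂ : ∀ a b c d → a ℤ.+ (b ℤ.+ (c ℤ.+ d)) ≡ (b ℤ.+ c) ℤ.+ (a ℤ.+ d)
    lem₂ = solve-∀
    lem₃ : ∀ m e → (1ℤ ℤ.+ m) ℤ.* e ≡ e ℤ.+ m ℤ.* e
    lem₃ = solve-∀
    df : deriv f ≈ˢ t +ˢ z *ˢ deriv t
    df zero    = trans (ℤ.*-identityˡ (f 1)) (sym (ℤ.+-identityʳ (f 1)))
    df (suc i) = trans (lem₃ (+ suc i) (f (suc (suc i)))) (cong (ℤ._+_ (f (suc (suc i)))) (sym (z*-suc (deriv t) i)))
    df*g : (deriv f *ˢ g) (suc n) ≡ (t *ˢ g) (suc n) ℤ.+ (deriv t *ˢ g) n
    df*g = begin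
      (deriv f *ˢ g) (suc n)                             ≡⟨ *ˢ-cong {g = g} df (λ _ → refl) (suc n) ⟩
      ((t +ˢ z *ˢ deriv t) *ˢ g) (suc n)                 ≡⟨ *ˢ-distribʳ g t (z *ˢ deriv t) (suc n) ⟩
      (t *ˢ g) (suc n) ℤ.+ (z *ˢ deriv t *ˢ g) (suc n)   ≡⟨ cong (ℤ._+_ ((t *ˢ g) (suc n))) (*ˢ-assoc z (deriv t) g (suc n)) ⟩
      (t *ˢ g) (suc n) ℤ.+ (z *ˢ (deriv t *ˢ g)) (suc n) ≡⟨ cong (ℤ._+_ ((t *ˢ g) (suc n))) (z*-suc (deriv t *ˢ g) n) ⟩
      (t *ˢ g) (suc n) ℤ.+ (deriv t *ˢ g) n              ∎

  deriv-const : ∀ a → deriv (const a) ≈ˢ 0ˢ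
  deriv-const a zero    = refl
  deriv-const a (suc n) = ℤ.*-zeroʳ (+ suc (suc n))

  deriv-z : deriv z ≈ˢ 1ˢ
  deriv-z zero    = refl
  deriv-z (suc n) = ℤ.*-zeroʳ (+ suc (suc n))

  seriesDifferentialRing : ℕ → DifferentialRing
  seriesDifferentialRing M = record
    { commutativeRing = seriesRing M
    ; algebra = const-algebra M
    ; D = deriv
    ; D-cong = λ {f} {g} p → ⌈ (λ n → D-cong {f (suc n)} {g (suc n)} (⌊ p ⌋ (suc n)) (+ suc n)) ⌉
    ; D-+ = λ f g → ≈ˢ⇒≈[] (λ n → ℤ.*-distribˡ-+ (+ suc n) (f (suc n)) (g (suc n)))
    ; D-* = λ f g → ≈ˢ⇒≈[] (deriv-* f g)
    ; D-ι = λ a → ≈ˢ⇒≈[] (deriv-const a)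
    }
    where
    lem : ∀ k a b → k ℤ.* a ℤ.- k ℤ.* b ≡ k ℤ.* (a ℤ.- b)
    lem = solve-∀
    D-cong : ∀ {a b} → + M ∣ a ℤ.- b → ∀ k → + M ∣ k ℤ.* a ℤ.- k ℤ.* b
    D-cong {a} {b} (divides q eq) k = divides (k ℤ.* q)
      (trans (lem k a b) (trans (cong (ℤ._*_ k) eq) (sym (ℤ.*-assoc k q (+ M)))))

-- Laurent series as fractions with powers of z as denominators

module Localisations where

  open PowerSeries
  open DifferentialRings
  open import Algebra.Bundles using (CommutativeRing)
  import Algebra.Properties.Semiring.Exp as Exp
  import Relation.Binary.Reasoning.Setoid as SetoidReasoning
  open import Data.Integer as ℤ using (+_; 0ℤ; 1ℤ)
  open import Data.Nat as ℕ using (ℕ; zero; suc)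
  import Data.Nat.Properties as ℕ
  open import Data.Nat.Tactic.RingSolver using (solve-∀)
  open import Level using (0ℓ)
  open import Relation.Binary.Structures using (IsEquivalence)
  import Relation.Binary.PropositionalEquality as ≡

  module Localisation (B : DifferentialRing)
    (z : DifferentialRing.Carrier B)
    (z-cancel : ∀ {f g} → DifferentialRing._≈_ B (DifferentialRing._*_ B z f) (DifferentialRing._*_ B z g) →
      DifferentialRing._≈_ B f g)
    (D-z : DifferentialRing._≈_ B (DifferentialRing.D B z) (DifferentialRing.ι B 1ℤ)) where

    open DifferentialRing B
    open ℤ-Solver commutativeRing algebra
    open Exp semiring using (_^_; ^-homo-*)
    open SetoidReasoning setoid

    z^-cancel : ∀ m {f g} → z ^ m * f ≈ z ^ m * g → f ≈ g
    z^-cancel zero    p = trans (sym (*-identityˡ _)) (trans p (*-identityˡ _))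
    z^-cancel (suc m) p = z^-cancel m (z-cancel (trans (sym (*-assoc _ _ _)) (trans p (*-assoc _ _ _))))

    infix 6 _/z^_

    record Fraction : Set where
      constructor _/z^_
      field
        numerator : Carrier
        exponent  : ℕ

    infixl 6 _+ᶠ_
    infixl 7 _*ᶠ_

    embed : Carrier → Fraction
    embed f = f /z^ 0

    -- Without reduction to lowest terms, in the same shape as `_+ᴸ_` and `_*ᴸ_`, so that
    -- `toLaurent` preserves these operations up to propositional equality.
    _+ᶠ_ _*ᶠ_ : Fraction → Fraction → Fraction
    (f /z^ m) +ᶠ (g /z^ n) = (z ^ n * f + z ^ m * g) /z^ (m ℕ.+ n)
    (f /z^ m) *ᶠ (g /z^ n) = (f * g) /z^ (m ℕ.+ n)

    infix 4 _~_

    -- Cross multiplication without an extra factor; it is transitive because powers of z can be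
    -- cancelled.
    record _~_ (x y : Fraction) : Set where
      constructor ⟪_⟫
      field cleared : z ^ Fraction.exponent y * Fraction.numerator x ≈ z ^ Fraction.exponent x * Fraction.numerator y

    ~-body : ∀ {m n f g} → m ≡.≡ n → f ≈ g → f /z^ m ~ g /z^ n
    ~-body ≡.refl p = ⟪ *-congˡ p ⟫

    ~-expand : ∀ p {m n f g} → m ℕ.+ p ≡.≡ n → z ^ p * f ≈ g → f /z^ m ~ g /z^ n
    ~-expand p {m} {f = f} {g} ≡.refl e = ⟪ (begin
      z ^ (m ℕ.+ p) * f      ≈⟨ *-congʳ (^-homo-* z m p) ⟩
      z ^ m * z ^ p * f    ≈⟨ *-assoc (z ^ m) (z ^ p) f ⟩
      z ^ m * (z ^ p * f)  ≈⟨ *-congˡ e ⟩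
      z ^ m * g              ∎) ⟫

    ~-isEquivalence : IsEquivalence _~_
    ~-isEquivalence = record
      { refl  = ⟪ refl ⟫
      ; sym   = λ { ⟪ p ⟫ → ⟪ sym p ⟫ }
      ; trans = ~-trans }
      where
      ~-trans : ∀ {x y t} → x ~ y → y ~ t → x ~ t
      ~-trans {f /z^ m} {g /z^ n} {h /z^ p} ⟪ e ⟫ ⟪ e′ ⟫ = ⟪ z^-cancel n (begin
        z ^ n * (z ^ p * f)
          ≈⟨ solve 3 (λ a b f → a :* (b :* f) := b :* (a :* f)) refl (z ^ n) (z ^ p) f ⟩
        z ^ p * (z ^ n * f)
          ≈⟨ *-congˡ e ⟩
        z ^ p * (z ^ m * g)
          ≈⟨ solve 3 (λ a b f → a :* (b :* f) := b :* (a :* f)) refl (z ^ p) (z ^ m) g ⟩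
        z ^ m * (z ^ p * g)
          ≈⟨ *-congˡ e′ ⟩
        z ^ m * (z ^ n * h)
          ≈⟨ solve 3 (λ a b f → a :* (b :* f) := b :* (a :* f)) refl (z ^ m) (z ^ n) h ⟩
        z ^ n * (z ^ m * h) ∎) ⟫

    negate : Fraction → Fraction
    negate (f /z^ m) = (- f) /z^ m

    +ᶠ-cong : ∀ {x y s t} → x ~ y → s ~ t → x +ᶠ s ~ y +ᶠ t
    +ᶠ-cong {f /z^ m} {f′ /z^ m′} {g /z^ n} {g′ /z^ n′} ⟪ e ⟫ ⟪ e′ ⟫ = ⟪ (begin
      z ^ (m′ ℕ.+ n′) * (z ^ n * f + z ^ m * g)
        ≈⟨ *-congʳ (^-homo-* z m′ n′) ⟩
      z ^ m′ * z ^ n′ * (z ^ n * f + z ^ m * g)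
        ≈⟨ solve 6 (λ m n m′ n′ f g → m′ :* n′ :* (n :* f :+ m :* g)
             := n :* n′ :* (m′ :* f) :+ m :* m′ :* (n′ :* g)) refl (z ^ m) (z ^ n) (z ^ m′) (z ^ n′) f g ⟩
      z ^ n * z ^ n′ * (z ^ m′ * f) + z ^ m * z ^ m′ * (z ^ n′ * g)
        ≈⟨ +-cong (*-congˡ e) (*-congˡ e′) ⟩
      z ^ n * z ^ n′ * (z ^ m * f′) + z ^ m * z ^ m′ * (z ^ n * g′)
        ≈⟨ solve 6 (λ m n m′ n′ f g → n :* n′ :* (m :* f) :+ m :* m′ :* (n :* g)
             := m :* n :* (n′ :* f :+ m′ :* g)) refl (z ^ m) (z ^ n) (z ^ m′) (z ^ n′) f′ g′ ⟩
      z ^ m * z ^ n * (z ^ n′ * f′ + z ^ m′ * g′)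
        ≈⟨ *-congʳ (sym (^-homo-* z m n)) ⟩
      z ^ (m ℕ.+ n) * (z ^ n′ * f′ + z ^ m′ * g′) ∎) ⟫

    *ᶠ-cong : ∀ {x y s t} → x ~ y → s ~ t → x *ᶠ s ~ y *ᶠ t
    *ᶠ-cong {f /z^ m} {f′ /z^ m′} {g /z^ n} {g′ /z^ n′} ⟪ e ⟫ ⟪ e′ ⟫ = ⟪ (begin
      z ^ (m′ ℕ.+ n′) * (f * g)
        ≈⟨ *-congʳ (^-homo-* z m′ n′) ⟩
      z ^ m′ * z ^ n′ * (f * g)
        ≈⟨ solve 4 (λ m n f g → m :* n :* (f :* g) := m :* f :* (n :* g)) refl (z ^ m′) (z ^ n′) f g ⟩
      z ^ m′ * f * (z ^ n′ * g)
        ≈⟨ *-cong e e′ ⟩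
      z ^ m * f′ * (z ^ n * g′)
        ≈⟨ solve 4 (λ m n f g → m :* f :* (n :* g) := m :* n :* (f :* g)) refl (z ^ m) (z ^ n) f′ g′ ⟩
      z ^ m * z ^ n * (f′ * g′)
        ≈⟨ *-congʳ (sym (^-homo-* z m n)) ⟩
      z ^ (m ℕ.+ n) * (f′ * g′) ∎) ⟫

    negate-cong : ∀ {x y} → x ~ y → negate x ~ negate y
    negate-cong {f /z^ m} {g /z^ n} ⟪ e ⟫ = ⟪ (begin
      z ^ n * (- f)  ≈⟨ solve 2 (λ a f → a :* (:- f) := :- (a :* f)) refl (z ^ n) f ⟩
      - (z ^ n * f)  ≈⟨ -‿cong e ⟩
      - (z ^ m * g)  ≈⟨ solve 2 (λ a f → :- (a :* f) := a :* (:- f)) refl (z ^ m) g ⟩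
      z ^ m * (- g)  ∎) ⟫

    fractionRing : CommutativeRing 0ℓ 0ℓ
    fractionRing = mkCommutativeRing Fraction _~_ _+ᶠ_ _*ᶠ_ negate (embed (ι 0ℤ)) (embed (ι 1ℤ))
      ~-isEquivalence +ᶠ-cong *ᶠ-cong negate-cong
      (λ { (f /z^ m) (g /z^ n) (h /z^ p) → ~-body (ℕ.+-assoc m n p) (begin
         z ^ p * (z ^ n * f + z ^ m * g) + z ^ (m ℕ.+ n) * h
           ≈⟨ +-congˡ (*-congʳ (^-homo-* z m n)) ⟩
         z ^ p * (z ^ n * f + z ^ m * g) + z ^ m * z ^ n * h
           ≈⟨ solve 6 (λ m n p f g h → p :* (n :* f :+ m :* g) :+ m :* n :* h
                := n :* p :* f :+ m :* (p :* g :+ n :* h)) refl (z ^ m) (z ^ n) (z ^ p) f g h ⟩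
         z ^ n * z ^ p * f + z ^ m * (z ^ p * g + z ^ n * h)
           ≈⟨ +-congʳ (*-congʳ (sym (^-homo-* z n p))) ⟩
         z ^ (n ℕ.+ p) * f + z ^ m * (z ^ p * g + z ^ n * h) ∎) })
      (λ { (f /z^ m) (g /z^ n) → ~-body (ℕ.+-comm m n) (+-comm (z ^ n * f) (z ^ m * g)) })
      (λ { (f /z^ m) → ~-body ≡.refl
         (solve 2 (λ a f → a :* con 0ℤ :+ a :^ 0 :* f := f) refl (z ^ m) f) })
      (λ { (f /z^ m) → ⟪ solve 3 (λ a b f → b :^ 0 :* (a :* (:- f) :+ a :* f) := b :* con 0ℤ)
             refl (z ^ m) (z ^ (m ℕ.+ m)) f ⟫ })
      (λ { (f /z^ m) (g /z^ n) (h /z^ p) → ~-body (ℕ.+-assoc m n p) (*-assoc f g h) })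
      (λ { (f /z^ m) (g /z^ n) → ~-body (ℕ.+-comm m n) (*-comm f g) })
      (λ { (f /z^ m) → ~-body ≡.refl (trans (*-congʳ ι-1) (*-identityˡ f)) })
      -- Expanding uses the denominator z^p of h twice, factoring uses it once; the two sides differ
      -- by an expansion with z^p.
      (λ { (h /z^ p) (f /z^ m) (g /z^ n) → ~-expand p {m ℕ.+ n ℕ.+ p} (shifts m n p) (begin
         z ^ p * ((z ^ n * f + z ^ m * g) * h)
           ≈⟨ solve 6 (λ m n p f g h → p :* ((n :* f :+ m :* g) :* h)
                := n :* p :* (f :* h) :+ m :* p :* (g :* h)) refl (z ^ m) (z ^ n) (z ^ p) f g h ⟩
         z ^ n * z ^ p * (f * h) + z ^ m * z ^ p * (g * h)
           ≈⟨ +-cong (*-congʳ (sym (^-homo-* z n p))) (*-congʳ (sym (^-homo-* z m p))) ⟩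
         z ^ (n ℕ.+ p) * (f * h) + z ^ (m ℕ.+ p) * (g * h) ∎) })
      where
      shifts : ∀ m n p → m ℕ.+ n ℕ.+ p ℕ.+ p ≡.≡ m ℕ.+ p ℕ.+ (n ℕ.+ p)
      shifts = solve-∀

    ι-suc : ∀ m → ι (+ suc m) ≈ ι 1ℤ + ι (+ m)
    ι-suc m = ι-+ 1ℤ (+ m)

    -- The operator z d/dz multiplies z^m by m, which avoids the exponent m - 1.
    z-D-z^ : ∀ m → z * D (z ^ m) ≈ ι (+ m) * z ^ m
    z-D-z^ zero    = trans (*-congˡ (trans (D-cong (sym ι-1)) (D-ι 1ℤ)))
      (solve 1 (λ z → z :* con 0ℤ := con 0ℤ :* z :^ 0) refl z)
    z-D-z^ (suc m) = begin
      z * D (z * z ^ m)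
        ≈⟨ *-congˡ (D-* z (z ^ m)) ⟩
      z * (D z * z ^ m + z * D (z ^ m))
        ≈⟨ solve 4 (λ z z′ p p′ → z :* (z′ :* p :+ z :* p′) := z :* (z′ :* p) :+ z :* (z :* p′))
             refl z (D z) (z ^ m) (D (z ^ m)) ⟩
      z * (D z * z ^ m) + z * (z * D (z ^ m))
        ≈⟨ +-cong (*-congˡ (*-congʳ D-z)) (*-congˡ (z-D-z^ m)) ⟩
      z * (ι 1ℤ * z ^ m) + z * (ι (+ m) * z ^ m)
        ≈⟨ solve 3 (λ z p m → z :* (con 1ℤ :* p) :+ z :* (m :* p) := (con 1ℤ :+ m) :* (z :* p))
             refl z (z ^ m) (ι (+ m)) ⟩
      (ι 1ℤ + ι (+ m)) * (z * z ^ m)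
        ≈⟨ *-congʳ (sym (ι-suc m)) ⟩
      ι (+ suc m) * (z * z ^ m) ∎

    -- The quotient rule for f / z^m with z^(m-1) cancelled, valid for m = 0 too.
    Dᶠ : Fraction → Fraction
    Dᶠ (f /z^ m) = (z * D f - ι (+ m) * f) /z^ suc m

    z-D : ∀ n f → z * D (z ^ n * f) ≈ ι (+ n) * (z ^ n * f) + z ^ n * (z * D f)
    z-D n f = begin
      z * D (z ^ n * f)
        ≈⟨ *-congˡ (D-* (z ^ n) f) ⟩
      z * (D (z ^ n) * f + z ^ n * D f)
        ≈⟨ solve 5 (λ z p p′ f f′ → z :* (p′ :* f :+ p :* f′) := z :* p′ :* f :+ p :* (z :* f′))
             refl z (z ^ n) (D (z ^ n)) f (D f) ⟩
      z * D (z ^ n) * f + z ^ n * (z * D f)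
        ≈⟨ +-congʳ (trans (*-congʳ (z-D-z^ n)) (*-assoc _ _ _)) ⟩
      ι (+ n) * (z ^ n * f) + z ^ n * (z * D f) ∎

    Dᶠ-cong : ∀ {x y} → x ~ y → Dᶠ x ~ Dᶠ y
    Dᶠ-cong {f /z^ m} {g /z^ n} ⟪ e ⟫ = ⟪ trans (half m n f)
        (trans (*-congˡ (+-cong (*-congˡ (D-cong e)) (-‿cong (*-congˡ e)))) (trans
          (*-congˡ (+-congˡ (-‿cong (*-congʳ (+-comm (ι (+ m)) (ι (+ n)))))))
          (sym (half n m g)))) ⟫
      where
      -- Each side of the cleared equation becomes an expression in the cross product z^n f and the
      -- sum m + n alone, and these agree for the two fractions.
      half : ∀ m n f → z ^ suc n * (z * D f - ι (+ m) * f)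
        ≈ z * (z * D (z ^ n * f) - (ι (+ m) + ι (+ n)) * (z ^ n * f))
      half m n f = begin
        z * z ^ n * (z * D f - ι (+ m) * f)
          ≈⟨ solve 6 (λ z p f f′ m n → z :* p :* (z :* f′ :- m :* f)
               := z :* (n :* (p :* f) :+ p :* (z :* f′) :- (m :+ n) :* (p :* f)))
               refl z (z ^ n) f (D f) (ι (+ m)) (ι (+ n)) ⟩
        z * (ι (+ n) * (z ^ n * f) + z ^ n * (z * D f) - (ι (+ m) + ι (+ n)) * (z ^ n * f))
          ≈⟨ *-congˡ (+-congʳ (sym (z-D n f))) ⟩
        z * (z * D (z ^ n * f) - (ι (+ m) + ι (+ n)) * (z ^ n * f)) ∎

    Dᶠ-+ : ∀ x y → Dᶠ (x +ᶠ y) ~ Dᶠ x +ᶠ Dᶠ y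
    Dᶠ-+ (f /z^ m) (g /z^ n) = ~-expand 1 {suc (m ℕ.+ n)}
      (≡.cong suc (≡.trans (ℕ.+-comm (m ℕ.+ n) 1) (≡.sym (ℕ.+-suc m n)))) (begin
      z ^ 1 * (z * D (z ^ n * f + z ^ m * g) - ι (+ (m ℕ.+ n)) * (z ^ n * f + z ^ m * g))
        ≈⟨ *-congˡ (+-cong (trans (*-congˡ (D-+ _ _)) (distribˡ _ _ _)) (-‿cong (*-congʳ (ι-+ (+ m) (+ n))))) ⟩
      z ^ 1 * (z * D (z ^ n * f) + z * D (z ^ m * g) - (ι (+ m) + ι (+ n)) * (z ^ n * f + z ^ m * g))
        ≈⟨ *-congˡ (+-congʳ (+-cong (z-D n f) (z-D m g))) ⟩
      z ^ 1 * (ι (+ n) * (z ^ n * f) + z ^ n * (z * D f) + (ι (+ m) * (z ^ m * g) + z ^ m * (z * D g))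
        - (ι (+ m) + ι (+ n)) * (z ^ n * f + z ^ m * g))
        ≈⟨ solve 9 (λ z p q f f′ g g′ m n →
             z :^ 1 :* (n :* (p :* f) :+ p :* (z :* f′) :+ (m :* (q :* g) :+ q :* (z :* g′))
               :- (m :+ n) :* (p :* f :+ q :* g))
             := z :* p :* (z :* f′ :- m :* f) :+ z :* q :* (z :* g′ :- n :* g))
             refl z (z ^ n) (z ^ m) f (D f) g (D g) (ι (+ m)) (ι (+ n)) ⟩
      z ^ suc n * (z * D f - ι (+ m) * f) + z ^ suc m * (z * D g - ι (+ n) * g) ∎)

    Dᶠ-* : ∀ x y → Dᶠ (x *ᶠ y) ~ Dᶠ x *ᶠ y +ᶠ x *ᶠ Dᶠ y
    Dᶠ-* (f /z^ m) (g /z^ n) = ~-expand (suc (m ℕ.+ n)) {suc (m ℕ.+ n)}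
      (≡.cong (λ k → suc (m ℕ.+ n) ℕ.+ k) (≡.sym (ℕ.+-suc m n))) (begin
      z ^ suc (m ℕ.+ n) * (z * D (f * g) - ι (+ (m ℕ.+ n)) * (f * g))
        ≈⟨ *-congˡ (+-cong (*-congˡ (D-* f g)) (-‿cong (*-congʳ (ι-+ (+ m) (+ n))))) ⟩
      z ^ suc (m ℕ.+ n) * (z * (D f * g + f * D g) - (ι (+ m) + ι (+ n)) * (f * g))
        ≈⟨ solve 8 (λ z p f f′ g g′ m n →
             p :* (z :* (f′ :* g :+ f :* g′) :- (m :+ n) :* (f :* g))
             := p :* ((z :* f′ :- m :* f) :* g) :+ p :* (f :* (z :* g′ :- n :* g)))
             refl z (z ^ suc (m ℕ.+ n)) f (D f) g (D g) (ι (+ m)) (ι (+ n)) ⟩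
      z ^ suc (m ℕ.+ n) * ((z * D f - ι (+ m) * f) * g) + z ^ suc (m ℕ.+ n) * (f * (z * D g - ι (+ n) * g))
        ≈⟨ +-congʳ (*-congʳ (reflexive (≡.cong (z ^_) (≡.sym (ℕ.+-suc m n))))) ⟩
      z ^ (m ℕ.+ suc n) * ((z * D f - ι (+ m) * f) * g) + z ^ suc (m ℕ.+ n) * (f * (z * D g - ι (+ n) * g)) ∎)

    embed-cong : ∀ {f g} → f ≈ g → embed f ~ embed g
    embed-cong = ~-body ≡.refl

    embed-+ : ∀ f g → embed (f + g) ~ embed f +ᶠ embed g
    embed-+ f g = ~-body ≡.refl (solve 2 (λ f g → f :+ g := f :^ 0 :* f :+ f :^ 0 :* g) refl f g)

    embed-D : ∀ f → embed (D f) ~ Dᶠ (embed f)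
    embed-D f = ~-expand 1 ≡.refl
      (solve 3 (λ z f f′ → z :^ 1 :* f′ := z :* f′ :- con 0ℤ :* f) refl z f (D f))

    fractionAlgebra : ℤ-Algebra fractionRing
    fractionAlgebra = record
      { ⟦_⟧    = λ a → embed (ι a)
      ; +-homo = λ a b → IsEquivalence.trans ~-isEquivalence (embed-cong (ι-+ a b)) (embed-+ (ι a) (ι b))
      ; *-homo = λ a b → embed-cong (ι-* a b)
      ; -‿homo = λ a → embed-cong (ι-neg a)
      ; 0-homo = IsEquivalence.refl ~-isEquivalence
      ; 1-homo = IsEquivalence.refl ~-isEquivalence
      }

    fractionDifferentialRing : DifferentialRing
    fractionDifferentialRing = record
      { commutativeRing = fractionRing
      ; algebra = fractionAlgebra
      ; D      = Dᶠ
      ; D-cong = Dᶠ-cong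
      ; D-+    = Dᶠ-+
      ; D-*    = Dᶠ-*
      ; D-ι    = λ a → ⟪ (begin
          z ^ 0 * (z * D (ι a) - ι 0ℤ * ι a)
            ≈⟨ *-congˡ (+-congʳ (*-congˡ (D-ι a))) ⟩
          z ^ 0 * (z * ι 0ℤ - ι 0ℤ * ι a)
            ≈⟨ solve 2 (λ z a → z :^ 0 :* (z :* con 0ℤ :- con 0ℤ :* a) := z :^ 1 :* con 0ℤ) refl z (ι a) ⟩
          z ^ 1 * ι 0ℤ ∎) ⟫
      }

-- Identities for Ψ and the geometric series as z-adic limits

module InfiniteProducts where

  open PowerSeries
  open DifferentialRings
  import Algebra.Properties.Semiring.Exp as Exp
  import Relation.Binary.Reasoning.Setoid as SetoidReasoning
  open import Data.Integer as ℤ using (+_; 0ℤ; 1ℤ; -1ℤ)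
  open import Data.Nat as ℕ using (ℕ; zero; suc)
  import Data.Nat.Properties as ℕ
  open import Data.Product using (_,_; ∃-syntax; proj₂)
  import Relation.Binary.PropositionalEquality as ≡

  module Tower (B : DifferentialRing) where

    open DifferentialRing B
    open Differential B using (tower; D-cube; D-1+)
    open ℤ-Solver commutativeRing algebra
    open Exp semiring using (_^_; ^-congˡ; ^-homo-*; ^-assocʳ)
    open SetoidReasoning setoid

    ^-3^suc : ∀ a n → (a ^ 3) ^ (3 ℕ.^ n) ≈ a ^ (3 ℕ.^ suc n)
    ^-3^suc a n = ^-assocʳ a 3 (3 ℕ.^ n)

    tower-cong : ∀ n {a b} → a ≈ b → tower n a ≈ tower n b
    tower-cong zero    e = refl
    tower-cong (suc n) e = *-cong (+-congˡ e) (tower-cong n (^-congˡ 3 e))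

    tower-+ : ∀ m n a → tower (m ℕ.+ n) a ≈ tower m a * tower n (a ^ (3 ℕ.^ m))
    tower-+ zero    n a = begin
      tower n a                 ≈⟨ tower-cong n (sym (*-identityʳ a)) ⟩
      tower n (a ^ 1)           ≈⟨ solve 1 (λ t → t := con 1ℤ :* t) refl _ ⟩
      ι 1ℤ * tower n (a ^ 1)    ∎
    tower-+ (suc m) n a = begin
      (ι 1ℤ + a) * tower (m ℕ.+ n) (a ^ 3)
        ≈⟨ *-congˡ (tower-+ m n (a ^ 3)) ⟩
      (ι 1ℤ + a) * (tower m (a ^ 3) * tower n ((a ^ 3) ^ (3 ℕ.^ m)))
        ≈⟨ sym (*-assoc _ _ _) ⟩
      (ι 1ℤ + a) * tower m (a ^ 3) * tower n ((a ^ 3) ^ (3 ℕ.^ m))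
        ≈⟨ *-congˡ (tower-cong n (^-3^suc a m)) ⟩
      (ι 1ℤ + a) * tower m (a ^ 3) * tower n (a ^ (3 ℕ.^ suc m)) ∎

    -- By (1 + a)³ ≡ 1 + a³ modulo 3, the expression (1 + a) T² passes from a to a³ when one factor
    -- is removed from the product T. In the limit this yields (1 + w) Ψ² ≡ 1 modulo 3.
    tower-square : ∀ n a → ∃[ y ] (ι 1ℤ + a) * (tower n a * tower n a) ≈ ι 1ℤ + a ^ (3 ℕ.^ n) + ι (+ 3) * y
    tower-square zero a = ι 0ℤ ,
      solve 1 (λ a → (con 1ℤ :+ a) :* (con 1ℤ :* con 1ℤ) := con 1ℤ :+ a :^ 1 :+ con (+ 3) :* con 0ℤ) refl a
    tower-square (suc n) a with y , eq ← tower-square n (a ^ 3) =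
      y + (a + a * a) * (T * T) , (begin
      (ι 1ℤ + a) * ((ι 1ℤ + a) * T * ((ι 1ℤ + a) * T))
        ≈⟨ solve 2 (λ a T → (con 1ℤ :+ a) :* ((con 1ℤ :+ a) :* T :* ((con 1ℤ :+ a) :* T))
             := (con 1ℤ :+ a :^ 3) :* (T :* T) :+ con (+ 3) :* ((a :+ a :* a) :* (T :* T))) refl a T ⟩
      (ι 1ℤ + a ^ 3) * (T * T) + ι (+ 3) * ((a + a * a) * (T * T))
        ≈⟨ +-congʳ (trans eq (+-congʳ (+-congˡ (^-3^suc a n)))) ⟩
      ι 1ℤ + a ^ (3 ℕ.^ suc n) + ι (+ 3) * y + ι (+ 3) * ((a + a * a) * (T * T))
        ≈⟨ solve 3 (λ b y t → con 1ℤ :+ b :+ con (+ 3) :* y :+ con (+ 3) :* t := con 1ℤ :+ b :+ con (+ 3) :* (y :+ t))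
             refl (a ^ (3 ℕ.^ suc n)) y ((a + a * a) * (T * T)) ⟩
      ι 1ℤ + a ^ (3 ℕ.^ suc n) + ι (+ 3) * (y + (a + a * a) * (T * T)) ∎)
      where T = tower n (a ^ 3)

    -- Each of the n cubings contributes one factor 3 through `D-cube`.
    D-^3^ : ∀ n a → ∃[ y ] D (a ^ (3 ℕ.^ n)) ≈ ι (+ 3) ^ n * y * D a
    D-^3^ zero a = ι 1ℤ , trans (D-cong (*-identityʳ a))
      (solve 1 (λ a′ → a′ := con 1ℤ :^ 0 :* con 1ℤ :* a′) refl (D a))
    D-^3^ (suc n) a with y , eq ← D-^3^ n (a ^ 3) = y * (a * a) , (begin
      D (a ^ (3 ℕ.^ suc n))                      ≈⟨ D-cong (sym (^-3^suc a n)) ⟩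
      D ((a ^ 3) ^ (3 ℕ.^ n))                    ≈⟨ eq ⟩
      ι (+ 3) ^ n * y * D (a ^ 3)                ≈⟨ *-congˡ (D-cube a) ⟩
      ι (+ 3) ^ n * y * (ι (+ 3) * (a * a) * D a)
        ≈⟨ solve 4 (λ t y a a′ → t :* y :* (con (+ 3) :* (a :* a) :* a′) := con (+ 3) :* t :* (y :* (a :* a)) :* a′)
             refl (ι (+ 3) ^ n) y a (D a) ⟩
      ι (+ 3) * ι (+ 3) ^ n * (y * (a * a)) * D a ∎)

    D-tower-constant : ∀ n {a} → D a ≈ ι 0ℤ → D (tower n a) ≈ ι 0ℤ
    D-tower-constant zero    e = D-ι 1ℤ
    D-tower-constant (suc n) {a} e = begin
      D ((ι 1ℤ + a) * tower n (a ^ 3))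
        ≈⟨ D-* _ _ ⟩
      D (ι 1ℤ + a) * tower n (a ^ 3) + (ι 1ℤ + a) * D (tower n (a ^ 3))
        ≈⟨ +-cong (*-congʳ (trans (D-1+ a) e)) (*-congˡ (D-tower-constant n (begin
             D (a ^ 3)                     ≈⟨ D-cube a ⟩
             ι (+ 3) * (a * a) * D a       ≈⟨ *-congˡ e ⟩
             ι (+ 3) * (a * a) * ι 0ℤ      ≈⟨ solve 1 (λ t → t :* con 0ℤ := con 0ℤ) refl _ ⟩
             ι 0ℤ                          ∎))) ⟩
      ι 0ℤ * tower n (a ^ 3) + (ι 1ℤ + a) * ι 0ℤ
        ≈⟨ solve 2 (λ s t → con 0ℤ :* s :+ t :* con 0ℤ := con 0ℤ) refl _ _ ⟩
      ι 0ℤ ∎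

    geometric : ℕ → Carrier → Carrier
    geometric zero    x = ι 0ℤ
    geometric (suc n) x = ι 1ℤ + x * geometric n x

    geometric-+ : ∀ m n x → geometric (m ℕ.+ n) x ≈ geometric m x + x ^ m * geometric n x
    geometric-+ zero    n x = solve 2 (λ x g → g := con 0ℤ :+ x :^ 0 :* g) refl x (geometric n x)
    geometric-+ (suc m) n x = trans (+-congˡ (*-congˡ (geometric-+ m n x)))
      (solve 4 (λ x g h p → con 1ℤ :+ x :* (g :+ p :* h) := con 1ℤ :+ x :* g :+ x :* p :* h)
        refl x (geometric m x) (geometric n x) (x ^ m))

    geometric-telescope : ∀ n x → (ι 1ℤ - x) * geometric n x ≈ ι 1ℤ - x ^ n
    geometric-telescope zero    x = solve 1 (λ x → (con 1ℤ :- x) :* con 0ℤ := con 1ℤ :- x :^ 0) refl x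
    geometric-telescope (suc n) x = begin
      (ι 1ℤ - x) * (ι 1ℤ + x * g)
        ≈⟨ solve 2 (λ x g → (con 1ℤ :- x) :* (con 1ℤ :+ x :* g) := con 1ℤ :- x :+ x :* ((con 1ℤ :- x) :* g)) refl x g ⟩
      ι 1ℤ - x + x * ((ι 1ℤ - x) * g)
        ≈⟨ +-congˡ (*-congˡ (geometric-telescope n x)) ⟩
      ι 1ℤ - x + x * (ι 1ℤ - x ^ n)
        ≈⟨ solve 2 (λ x p → con 1ℤ :- x :+ x :* (con 1ℤ :- p) := con 1ℤ :- x :* p) refl x (x ^ n) ⟩
      ι 1ℤ - x * x ^ n ∎
      where g = geometric n x

    module ZAdic (z : Carrier) where

      infix 4 _≡_mod-z^_
      -- An algebraic form of agreement of the first k coefficients, so that passages to the limit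
      -- can be written with ring operations only.
      record _≡_mod-z^_ (f g : Carrier) (k : ℕ) : Set where
        constructor remainder
        field
          h  : Carrier
          eq : f ≈ g + z ^ k * h

      z-reflexive : ∀ {k f g} → f ≈ g → f ≡ g mod-z^ k
      z-reflexive {k} e = remainder (ι 0ℤ)
        (trans e (solve 2 (λ g t → g := g :+ t :* con 0ℤ) refl _ (z ^ k)))

      z-sym : ∀ {k f g} → f ≡ g mod-z^ k → g ≡ f mod-z^ k
      z-sym {k} {f} {g} (remainder h e) = remainder (- h)
        (trans (solve 3 (λ g t h → g := g :+ t :* h :+ t :* (:- h)) refl g (z ^ k) h) (+-congʳ (sym e)))

      z-trans : ∀ {k f g h} → f ≡ g mod-z^ k → g ≡ h mod-z^ k → f ≡ h mod-z^ k
      z-trans {k} {h = h} (remainder a e) (remainder b e′) = remainder (b + a)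
        (trans e (trans (+-congʳ e′) (solve 4 (λ h t a b → h :+ t :* b :+ t :* a := h :+ t :* (b :+ a)) refl h (z ^ k) a b)))

      z-* : ∀ {k f g f′ g′} → f ≡ g mod-z^ k → f′ ≡ g′ mod-z^ k → f * f′ ≡ g * g′ mod-z^ k
      z-* {k} {f} {g} {f′} {g′} (remainder a e) (remainder b e′) = remainder (a * g′ + f * b) (begin
        f * f′
          ≈⟨ *-congˡ e′ ⟩
        f * (g′ + z ^ k * b)
          ≈⟨ solve 4 (λ f g′ t b → f :* (g′ :+ t :* b) := f :* g′ :+ t :* (f :* b)) refl f g′ (z ^ k) b ⟩
        f * g′ + z ^ k * (f * b)
          ≈⟨ +-congʳ (*-congʳ e) ⟩
        (g + z ^ k * a) * g′ + z ^ k * (f * b)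
          ≈⟨ solve 6 (λ f g g′ t a b → (g :+ t :* a) :* g′ :+ t :* (f :* b) := g :* g′ :+ t :* (a :* g′ :+ f :* b))
               refl f g g′ (z ^ k) a b ⟩
        g * g′ + z ^ k * (a * g′ + f * b) ∎)

      z-weaken : ∀ m {k f g} → f ≡ g mod-z^ (m ℕ.+ k) → f ≡ g mod-z^ k
      z-weaken m {k} {f} {g} (remainder h e) = remainder (z ^ m * h) (trans e (+-congˡ
        (trans (*-congʳ (^-homo-* z m k)) (solve 3 (λ a b h → a :* b :* h := b :* (a :* h)) refl (z ^ m) (z ^ k) h))))

      z-+ : ∀ {k f g f′ g′} → f ≡ g mod-z^ k → f′ ≡ g′ mod-z^ k → f + f′ ≡ g + g′ mod-z^ k
      z-+ {k} {g = g} {g′ = g′} (remainder a e) (remainder b e′) = remainder (a + b)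
        (trans (+-cong e e′) (solve 5 (λ g g′ t a b → g :+ t :* a :+ (g′ :+ t :* b) := g :+ g′ :+ t :* (a :+ b))
          refl g g′ (z ^ k) a b))

      D-z^ : ∀ k → ∃[ h ] D (z ^ suc k) ≈ z ^ k * h
      D-z^ zero    = D z , trans (D-cong (*-identityʳ z)) (sym (*-identityˡ (D z)))
      D-z^ (suc k) with h , e ← D-z^ k = D z + h , (begin
        D (z * z ^ suc k)                   ≈⟨ D-* _ _ ⟩
        D z * z ^ suc k + z * D (z ^ suc k) ≈⟨ +-congˡ (*-congˡ e) ⟩
        D z * (z * z ^ k) + z * (z ^ k * h)
          ≈⟨ solve 4 (λ d z t h → d :* (z :* t) :+ z :* (t :* h) := z :* t :* (d :+ h)) refl (D z) z (z ^ k) h ⟩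
        z ^ suc k * (D z + h)               ∎)

      z-D : ∀ {k f g} → f ≡ g mod-z^ (suc k) → D f ≡ D g mod-z^ k
      z-D {k} {f} {g} (remainder h e) with h′ , e′ ← D-z^ k = remainder (h′ * h + z * D h) (begin
        D f                                     ≈⟨ D-cong e ⟩
        D (g + z ^ suc k * h)                   ≈⟨ D-+ _ _ ⟩
        D g + D (z ^ suc k * h)                 ≈⟨ +-congˡ (D-* _ _) ⟩
        D g + (D (z ^ suc k) * h + z ^ suc k * D h)
          ≈⟨ +-congˡ (+-congʳ (*-congʳ e′)) ⟩
        D g + (z ^ k * h′ * h + z * z ^ k * D h)
          ≈⟨ solve 6 (λ g t h′ h z d → g :+ (t :* h′ :* h :+ z :* t :* d) := g :+ t :* (h′ :* h :+ z :* d))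
               refl (D g) (z ^ k) h′ h z (D h) ⟩
        D g + z ^ k * (h′ * h + z * D h)        ∎)

      ^-low : ∀ {w t} → w ≈ z * t → ∀ k → w ^ k ≡ ι 0ℤ mod-z^ k
      ^-low {w} {t} e k = remainder (t ^ k) (trans (^-low′ k) (solve 1 (λ x → x := con 0ℤ :+ x) refl _))
        where
        ^-low′ : ∀ k → w ^ k ≈ z ^ k * t ^ k
        ^-low′ zero    = sym (*-identityˡ _)
        ^-low′ (suc k) = trans (*-cong e (^-low′ k))
          (solve 4 (λ z t a b → z :* t :* (a :* b) := z :* a :* (t :* b)) refl z t (z ^ k) (t ^ k))

      -‿multiple : ∀ {w t} → w ≈ z * t → - w ≈ z * - t
      -‿multiple {t = t} e = trans (-‿cong e) (solve 2 (λ z t → :- (z :* t) := z :* (:- t)) refl z t)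

      ^-3^-multiple : ∀ n {w t} → w ≈ z * t → ∃[ t′ ] w ^ (3 ℕ.^ n) ≈ z * t′
      ^-3^-multiple zero    {w} {t} e = t , trans (*-identityʳ w) e
      ^-3^-multiple (suc n) {w} {t} e
        with t′ , e′ ← ^-3^-multiple n {w ^ 3} (trans (*-congʳ e) (*-assoc z t (w ^ 2))) =
          t′ , trans (sym (^-3^suc w n)) e′

      k≤3^k : ∀ k → k ℕ.≤ 3 ℕ.^ k
      k≤3^k zero    = ℕ.z≤n
      k≤3^k (suc k) = ℕ.+-mono-≤ (ℕ.m^n>0 3 k) (ℕ.≤-trans (k≤3^k k) (ℕ.m≤m+n (3 ℕ.^ k) _))

      -- The crude bound k ≤ 3^k is enough: the partial product with k factors then determines Ψ
      -- modulo z^k.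
      ^-3^-low : ∀ {w t} → w ≈ z * t → ∀ k → w ^ (3 ℕ.^ k) ≡ ι 0ℤ mod-z^ k
      ^-3^-low {w} e k = z-weaken (3 ℕ.^ k ℕ.∸ k)
        (≡.subst (λ j → w ^ (3 ℕ.^ k) ≡ ι 0ℤ mod-z^ j) (≡.sym (ℕ.m∸n+n≡m (k≤3^k k))) (^-low e (3 ℕ.^ k)))

      geometric-stable : ∀ {w t} → w ≈ z * t → ∀ m n →
        geometric (m ℕ.+ n) (- w) ≡ geometric m (- w) mod-z^ m
      geometric-stable {w} {t} e m n =
        z-trans (z-reflexive (geometric-+ m n (- w)))
        (z-trans (z-+ (z-reflexive refl) (z-* (^-low (-‿multiple e) m) (z-reflexive refl)))
          (z-reflexive (solve 2 (λ g h → g :+ con 0ℤ :* h := g) refl (geometric m (- w)) (geometric n (- w)))))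

      tower-low : ∀ {k} n {b} → b ≡ ι 0ℤ mod-z^ k → tower n b ≡ ι 1ℤ mod-z^ k
      tower-low zero    e = z-reflexive refl
      tower-low (suc n) {b} e =
        z-trans (z-* (z-+ (z-reflexive refl) e) (tower-low n (z-trans (z-* e (z-reflexive refl))
          (z-reflexive (solve 1 (λ b → con 0ℤ :* b := con 0ℤ) refl (b ^ 2))))))
          (z-reflexive (solve 0 ((con 1ℤ :+ con 0ℤ) :* con 1ℤ := con 1ℤ) refl))

      tower-stable : ∀ {w t} → w ≈ z * t → ∀ m n → tower (m ℕ.+ n) w ≡ tower m w mod-z^ m
      tower-stable {w} e m n =
        z-trans (z-reflexive (tower-+ m n w))
        (z-trans (z-* (z-reflexive refl) (tower-low n (^-3^-low e m)))
          (z-reflexive (solve 1 (λ t → t :* con 1ℤ := t) refl (tower m w))))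

      -- An identity between limits is verified on partial sums or products modulo every z^k;
      -- separatedness turns this into equality.
      module _ (separated : ∀ {f g} → (∀ k → f ≡ g mod-z^ k) → f ≈ g) where

        geometric-inverse : ∀ {w t v} → w ≈ z * t → (∀ k → v ≡ geometric k (- w) mod-z^ k) →
          (ι 1ℤ + w) * v ≈ ι 1ℤ
        geometric-inverse {w} {t} {v} e partial = separated λ k →
          z-trans (z-* (z-reflexive refl) (partial k))
          (z-trans (z-reflexive (begin
            (ι 1ℤ + w) * geometric k (- w)
              ≈⟨ solve 2 (λ w g → (con 1ℤ :+ w) :* g := (con 1ℤ :- (:- w)) :* g) refl w (geometric k (- w)) ⟩
            (ι 1ℤ - - w) * geometric k (- w)
              ≈⟨ geometric-telescope k (- w) ⟩
            ι 1ℤ - (- w) ^ k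
              ≈⟨ solve 1 (λ p → con 1ℤ :- p := con 1ℤ :+ con -1ℤ :* p) refl ((- w) ^ k) ⟩
            ι 1ℤ + ι -1ℤ * (- w) ^ k ∎))
          (z-trans (z-+ (z-reflexive refl) (z-* (z-reflexive refl) (^-low (-‿multiple e) k)))
            (z-reflexive (solve 0 (con 1ℤ :+ con -1ℤ :* con 0ℤ := con 1ℤ) refl))))

        module _ (Ψ : Carrier → Carrier)
          (partial : ∀ {w t} → w ≈ z * t → ∀ k → Ψ w ≡ tower k w mod-z^ k) where

          Ψ-tower : ∀ n {w t} → w ≈ z * t → Ψ w ≈ tower n w * Ψ (w ^ (3 ℕ.^ n))
          Ψ-tower n {w} e = separated λ k →
            -- The accuracy n + k leaves k factors for the tail once n have been split off.
            z-trans (z-weaken n (partial e (n ℕ.+ k)))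
            (z-trans (z-reflexive (tower-+ n k w))
              (z-* (z-reflexive refl) (z-sym (partial (proj₂ (^-3^-multiple n e)) k))))

          D-Ψ-constant : ∀ {a t} → a ≈ z * t → D a ≈ ι 0ℤ → D (Ψ a) ≈ ι 0ℤ
          D-Ψ-constant e Da = separated λ k →
            -- Differentiation loses one power of z, so one more factor is taken.
            z-trans (z-D (partial e (suc k))) (z-reflexive (D-tower-constant (suc k) Da))

          Ψ-square : ι (+ 3) ≈ ι 0ℤ → ∀ {w t} → w ≈ z * t → (ι 1ℤ + w) * (Ψ w * Ψ w) ≈ ι 1ℤ
          Ψ-square 3≈0 {w} e = separated λ k → go k (tower-square k w)
            where
            go : ∀ k → ∃[ y ] (ι 1ℤ + w) * (tower k w * tower k w) ≈ ι 1ℤ + w ^ (3 ℕ.^ k) + ι (+ 3) * y →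
              (ι 1ℤ + w) * (Ψ w * Ψ w) ≡ ι 1ℤ mod-z^ k
            go k (y , eq) =
              z-trans (z-* (z-reflexive refl) (z-* (partial e k) (partial e k)))
              (z-trans (z-reflexive (trans eq (+-congˡ (*-congʳ 3≈0))))
              (z-trans (z-+ (z-+ (z-reflexive refl) (^-3^-low e k)) (z-reflexive refl))
                (z-reflexive (solve 1 (λ y → con 1ℤ :+ con 0ℤ :+ con 0ℤ :* y := con 1ℤ) refl y))))

          -- The argument of this tail has derivative divisible by 3^(n+1), hence zero, and Ψ of a
          -- constant for `D` is a constant for `D`.
          D-Ψ-tail : ∀ n → ι (+ 3) ^ n ≈ ι 0ℤ → ∀ {w t} → w ≈ z * t →
            D (Ψ (w ^ (3 ℕ.^ suc n))) ≈ ι 0ℤ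
          D-Ψ-tail n 3^n≈0 {w} e with y , eq ← D-^3^ (suc n) w =
            D-Ψ-constant (proj₂ (^-3^-multiple (suc n) e)) (begin
              D (w ^ (3 ℕ.^ suc n))                  ≈⟨ eq ⟩
              ι (+ 3) * ι (+ 3) ^ n * y * D w        ≈⟨ *-congʳ (*-congʳ (*-congˡ 3^n≈0)) ⟩
              ι (+ 3) * ι 0ℤ * y * D w
                ≈⟨ solve 2 (λ y d → con (+ 3) :* con 0ℤ :* y :* d := con 0ℤ) refl y (D w) ⟩
              ι 0ℤ                                   ∎)

-- Coefficients of infinite sums and products

module SeriesLimits where

  open PowerSeries
  open DifferentialRings
  open SeriesDerivative
  open InfiniteProducts
  open import Defs
  import Algebra.Properties.Semiring.Exp as Exp
  import Algebra.Properties.Semiring.Sum as Sum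
  open import Data.Fin using (toℕ) renaming (zero to fzero; suc to fsuc)
  open import Data.Integer as ℤ using (ℤ; +_; 0ℤ)
  import Data.Integer.Properties as ℤ
  open import Data.Integer.Divisibility.Signed using (_∣_; divides; ∣m∣n⇒∣m-n)
  open import Data.Integer.Tactic.RingSolver using (solve-∀)
  open import Data.Nat as ℕ using (ℕ; zero; suc)
  import Data.Nat.Properties as ℕ
  open import Relation.Binary.PropositionalEquality as ≡
    using (_≡_; refl; sym; trans; cong; subst)
  open import Relation.Nullary using (Dec; yes; no)

  module SeriesModulo (M : ℕ) where

    private
      module S = DifferentialRing (seriesDifferentialRing M)
      open Exp S.semiring using (_^_)
      open Sum S.semiring using (*-distribˡ-sum)
    open Tower (seriesDifferentialRing M)
    open ZAdic z
    open Differential (seriesDifferentialRing M) using (tower)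

    -- Both powers are the same recursion, taken over different raw semirings; they are identified
    -- by induction on the exponent.
    ^ˢ≡^ : ∀ f n → f ^ˢ n ≡ f ^ n
    ^ˢ≡^ f zero    = refl
    ^ˢ≡^ f (suc n) = cong (f *ˢ_) (^ˢ≡^ f n)

    mod-z^⇒low : ∀ {k f g} → f ≡ g mod-z^ k → ∀ i → i ℕ.< k → + M ∣ f i ℤ.- g i
    mod-z^⇒low {k} {f} {g} (remainder h eq) i i<k = subst (λ e → + M ∣ f i ℤ.- e) g+z^kh (⌊ eq ⌋ i)
      where
      g+z^kh : (g +ˢ z ^ k *ˢ h) i ≡ g i
      g+z^kh = trans (cong (ℤ._+_ (g i)) (trans (cong (λ p → (p *ˢ h) i) (sym (^ˢ≡^ z k))) (z^*-< k h i<k)))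
                     (ℤ.+-identityʳ (g i))

    -- With the shifted difference f - g as quotient, the coefficients from index k on match
    -- exactly, so only those below k need the hypothesis.
    low⇒mod-z^ : ∀ {k f g} → (∀ i → i ℕ.< k → + M ∣ f i ℤ.- g i) → f ≡ g mod-z^ k
    low⇒mod-z^ {k} {f} {g} low = remainder h ⌈ (λ n → go n (n ℕ.<? k)) ⌉
      where
      h p : Series
      h i = f (k ℕ.+ i) ℤ.- g (k ℕ.+ i)
      p = z ^ k *ˢ h
      p≡ : ∀ n → p n ≡ (z ^ˢ k *ˢ h) n
      p≡ n = cong (λ p → (p *ˢ h) n) (sym (^ˢ≡^ z k))
      lem₁ : ∀ a b c → c ≡ 0ℤ → a ℤ.- b ≡ a ℤ.- (b ℤ.+ c)
      lem₁ a b _ refl = cong (ℤ._-_ a) (sym (ℤ.+-identityʳ b))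
      lem₂ : ∀ a b c → c ≡ a ℤ.- b → a ℤ.- (b ℤ.+ c) ≡ 0ℤ
      lem₂ a b _ refl = cancel a b
        where
        cancel : ∀ a b → a ℤ.- (b ℤ.+ (a ℤ.- b)) ≡ 0ℤ
        cancel = solve-∀
      high : ∀ i → f (k ℕ.+ i) ℤ.- (g (k ℕ.+ i) ℤ.+ p (k ℕ.+ i)) ≡ 0ℤ
      high i = lem₂ (f (k ℕ.+ i)) (g (k ℕ.+ i)) (p (k ℕ.+ i)) (trans (p≡ (k ℕ.+ i)) (z^*-+ k h i))
      go : ∀ n → Dec (n ℕ.< k) → + M ∣ f n ℤ.- (g n ℤ.+ p n)
      go n (yes n<k) = subst (+ M ∣_) (lem₁ (f n) (g n) (p n) (trans (p≡ n) (z^*-< k h n<k))) (low n n<k)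
      go n (no n≮k)  = divides 0ℤ (subst (λ j → f j ℤ.- (g j ℤ.+ p j) ≡ 0ℤ) (ℕ.m+[n∸m]≡n (ℕ.≮⇒≥ n≮k)) (high (n ℕ.∸ k)))

    separated : ∀ {f g} → (∀ k → f ≡ g mod-z^ k) → f ≈[ M ] g
    separated p = ⌈ (λ n → mod-z^⇒low (p (suc n)) n ℕ.≤-refl) ⌉

    -- `∑∞` and `∏∞` read coefficient n off the partial result with n + 1 terms. Stability allows
    -- any later partial result to be used for that coefficient instead.
    limit : ∀ (P : ℕ → Series) {f} → (∀ m n → P (m ℕ.+ n) ≡ P m mod-z^ m) →
      (∀ n → + M ∣ f n ℤ.- P (suc n) n) → ∀ k → f ≡ P k mod-z^ k
    limit P {f} stable diagonal k = low⇒mod-z^ λ i i<k →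
      subst (λ j → + M ∣ f i ℤ.- P j i) (ℕ.m+[n∸m]≡n i<k)
        (subst (+ M ∣_) (lem (f i) (P (suc i) i) _)
          (∣m∣n⇒∣m-n (diagonal i) (mod-z^⇒low (stable (suc i) (k ℕ.∸ suc i)) i ℕ.≤-refl)))
      where
      lem : ∀ a b c → a ℤ.- b ℤ.- (c ℤ.- b) ≡ a ℤ.- c
      lem = solve-∀

    sum-geometric : ∀ n x → sumˢ {n} (λ j → x ^ˢ toℕ j) ≈[ M ] geometric n x
    sum-geometric zero    x = S.refl
    sum-geometric (suc n) x = S.+-congˡ {1ˢ} {sumˢ {n} (λ j → x *ˢ x ^ˢ toℕ j)} {x *ˢ geometric n x}
      (S.trans (S.sym (*-distribˡ-sum {n} x (λ j → x ^ˢ toℕ j)))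
        (S.*-congˡ {x} {sumˢ {n} (λ j → x ^ˢ toℕ j)} {geometric n x} (sum-geometric n x)))

    inv1+-inverse : ∀ {w t} → w ≈[ M ] z *ˢ t → (1ˢ +ˢ w) *ˢ inv1+ w ≈[ M ] 1ˢ
    inv1+-inverse {w} {t} e = geometric-inverse separated {w} {t} {inv1+ w} e
      (limit (λ k → geometric k (-ˢ w)) (geometric-stable {w} {t} e) (λ n → ⌊ sum-geometric (suc n) (-ˢ w) ⌋ n))

    -- `Ψ` raises w to the exponent 3ʲ at once, `tower` cubes its argument repeatedly; (w³)^(3ʲ) =
    -- w^(3^(j+1)) matches them.
    product-tower : ∀ n w → productˢ {n} (λ j → 1ˢ +ˢ w ^ˢ (3 ℕ.^ toℕ j)) ≈[ M ] tower n w
    product-tower zero    w = S.refl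
    product-tower (suc n) w = S.*-cong {1ˢ +ˢ w ^ˢ 1} {1ˢ +ˢ w}
      (S.+-congˡ {1ˢ} {w ^ˢ 1} {w} (S.*-identityʳ w))
      (S.trans (product-cong n (λ j → 1ˢ +ˢ w ^ˢ (3 ℕ.^ suc j)) (λ j → 1ˢ +ˢ (w ^ 3) ^ˢ (3 ℕ.^ j))
        (λ j → S.+-congˡ {1ˢ} {w ^ˢ (3 ℕ.^ suc j)} {(w ^ 3) ^ˢ (3 ℕ.^ j)} (cube j)))
        (product-tower n (w ^ 3)))
      where
      cube : ∀ j → w ^ˢ (3 ℕ.^ suc j) ≈[ M ] (w ^ 3) ^ˢ (3 ℕ.^ j)
      cube j = ≡.subst₂ (_≈[ M ]_) (sym (^ˢ≡^ w (3 ℕ.^ suc j))) (sym (^ˢ≡^ (w ^ 3) (3 ℕ.^ j)))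
        (S.sym (^-3^suc w j))
      product-cong : ∀ n (u v : ℕ → Series) → (∀ j → u j ≈[ M ] v j) →
        productˢ {n} (λ j → u (toℕ j)) ≈[ M ] productˢ {n} (λ j → v (toℕ j))
      product-cong zero    u v e = S.refl
      product-cong (suc n) u v e = S.*-cong {u 0} {v 0} (e 0)
        (product-cong n (λ j → u (suc j)) (λ j → v (suc j)) (λ j → e (suc j)))

    Ψ-partial : ∀ {w t} → w ≈[ M ] z *ˢ t → ∀ k → Ψ w ≡ tower k w mod-z^ k
    Ψ-partial {w} {t} e = limit (λ k → tower k w) (tower-stable {w} {t} e) (λ n → ⌊ product-tower (suc n) w ⌋ n)

-- Transport of the equation along a differential homomorphism

module Homomorphisms where

  open PowerSeries
  open DifferentialRings
  open SeriesDerivative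
  open InfiniteProducts
  open import Defs hiding (eval; evalTerm)
  open import Algebra.Bundles using (CommutativeRing; Semiring)
  import Algebra.Properties.Semiring.Exp as Exp
  import Algebra.Definitions.RawSemiring as RawSemiringDefs
  import Relation.Binary.Reasoning.Setoid as SetoidReasoning
  open import Data.Empty using (⊥-elim)
  open import Data.Fin using (Fin; zero; suc)
  open import Data.Integer as ℤ using (ℤ; +_; 0ℤ; 1ℤ; -1ℤ)
  import Data.Integer.Properties as ℤ
  import Data.Nat.Divisibility as ℕ∣
  open import Data.Integer.Divisibility.Signed using (_∣_; divides; _∣?_; ∣m∣n⇒∣m-n; ∣ᵤ⇒∣; ∣⇒∣ᵤ)
  open import Data.Integer.Tactic.RingSolver using (solve-∀)
  open import Data.List using ([]; _∷_)
  open import Data.Nat as ℕ using (ℕ; zero; suc)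
  import Data.Nat.Properties as ℕ
  open import Data.Nat.Primality using (prime?; euclidsLemma)
  open import Data.Product using (_,_; _×_; ∃-syntax)
  open import Data.Sum using (_⊎_; inj₁; inj₂)
  open import Data.Vec as Vec using (lookup; iterate)
  open import Relation.Binary.PropositionalEquality as ≡
    using (_≡_; refl; sym; trans; cong; subst)
  open import Relation.Nullary using (¬_; Dec; yes; no)
  open import Relation.Nullary.Decidable using (toWitness; toWitnessFalse)

  module _ (K : DifferentialRing) where
    open DifferentialRing K
    open Exp semiring using (_^_)

    ι-power : ∀ a n → ι (+ (a ℕ.^ n)) ≈ ι (+ a) ^ n
    ι-power a zero    = ι-1
    ι-power a (suc n) = CommutativeRing.trans commutativeRing
      (reflexive (cong ι (ℤ.pos-* a (a ℕ.^ n))))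
      (CommutativeRing.trans commutativeRing (ι-* (+ a) (+ (a ℕ.^ n))) (*-congˡ (ι-power a n)))

  -- The hypotheses speak of power series, while the argument inverts z. Everything is carried along
  -- this map, which is later the embedding into fractions.
  module Homomorphism (B K : DifferentialRing)
    (e : DifferentialRing.Carrier B → DifferentialRing.Carrier K)
    (e-cong : ∀ {x y} → DifferentialRing._≈_ B x y → DifferentialRing._≈_ K (e x) (e y))
    (e-+ : ∀ x y → DifferentialRing._≈_ K (e (DifferentialRing._+_ B x y)) (DifferentialRing._+_ K (e x) (e y)))
    (e-* : ∀ x y → DifferentialRing._≈_ K (e (DifferentialRing._*_ B x y)) (DifferentialRing._*_ K (e x) (e y)))
    (e-D : ∀ x → DifferentialRing._≈_ K (e (DifferentialRing.D B x)) (DifferentialRing.D K (e x)))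
    (e-ι : ∀ a → DifferentialRing._≈_ K (e (DifferentialRing.ι B a)) (DifferentialRing.ι K a)) where

    private
      module B = DifferentialRing B
      module K = DifferentialRing K
      module DB = Differential B
      module DK = Differential K
      module EB = Exp B.semiring
      module EK = Exp K.semiring
      module PB = RawSemiringDefs (Semiring.rawSemiring B.semiring)
      module PK = RawSemiringDefs (Semiring.rawSemiring K.semiring)

    e-1 : e B.1# K.≈ K.1#
    e-1 = K.trans (e-cong (B.sym B.ι-1)) (K.trans (e-ι 1ℤ) K.ι-1)

    e-^ : ∀ x n → e (x EB.^ n) K.≈ e x EK.^ n
    e-^ x zero    = e-1
    e-^ x (suc n) = K.trans (e-* x _) (K.*-congˡ (e-^ x n))

    e-product : ∀ {n} (f : Fin n → B.Carrier) (g : Fin n → K.Carrier) → (∀ i → e (f i) K.≈ g i) →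
      e (PB.product f) K.≈ PK.product g
    e-product {zero}  f g h = e-1
    e-product {suc n} f g h = K.trans (e-* _ _)
      (K.*-cong (h zero) (e-product (λ i → f (suc i)) (λ i → g (suc i)) (λ i → h (suc i))))

    e-tower : ∀ n a → e (DB.tower n a) K.≈ DK.tower n (e a)
    e-tower zero    a = e-ι 1ℤ
    e-tower (suc n) a = K.trans (e-* _ _) (K.*-cong
      (K.trans (e-+ _ _) (K.+-congʳ (e-ι 1ℤ)))
      (K.trans (e-tower n (a EB.^ 3)) (Tower.tower-cong K n (e-^ a 3))))

    e-iterate : ∀ n x y → e x K.≈ y → ∀ i → e (lookup (iterate B.D x n) i) K.≈ lookup (iterate K.D y n) i
    e-iterate (suc n) x y p zero    = p
    e-iterate (suc n) x y p (suc i) = e-iterate n (B.D x) (K.D y) (K.trans (e-D x) (K.D-cong p)) i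

    e-eval : ∀ {n} (p : MvPoly n) xs ys → (∀ i → e (lookup xs i) K.≈ lookup ys i) →
      e (DB.eval p xs) K.≈ DK.eval p ys
    e-eval []             xs ys h = e-ι 0ℤ
    e-eval ((a , es) ∷ p) xs ys h = K.trans (e-+ _ _) (K.+-cong
      (K.trans (e-* _ _) (K.*-cong (e-ι a) (e-product _ _ (λ i →
        K.trans (e-^ (lookup xs i) (lookup es i)) (EK.^-congˡ (lookup es i) (h i))))))
      (e-eval p xs ys h))

    module _ (z c₀ c₁ c₂ : B.Carrier) (s : ℕ) (Q : MvPoly (2 ℕ.+ s)) where
      private
        module PB′ = DB.Equation z c₀ c₁ c₂ s Q
        module PK′ = DK.Equation (e z) (e c₀) (e c₁) (e c₂) s Q

      e-P : ∀ x → e (PB′.P x) K.≈ PK′.P (e x)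
      e-P x = K.trans (e-+ _ _) (K.+-cong
        (K.trans (e-+ _ _) (K.+-congʳ (K.trans (e-+ _ _) (K.+-cong
          (K.trans (e-* _ _) (K.*-congˡ (e-^ x 2))) (e-* _ _)))))
        (K.trans (e-* _ _) (K.*-cong (e-ι (+ 3)) (e-eval Q (PB′.arguments x) (PK′.arguments (e x)) args))))
        where
        args : ∀ i → e (lookup (PB′.arguments x) i) K.≈ lookup (PK′.arguments (e x)) i
        args zero    = K.refl
        args (suc i) = e-iterate (suc s) x (e x) K.refl i

      e-A : ∀ x → e (PB′.A x) K.≈ PK′.A (e x)
      e-A x = K.trans (e-+ _ _) (K.+-congʳ
        (K.trans (e-* _ _) (K.*-congʳ (K.trans (e-* _ _) (K.*-congʳ (e-ι (+ 2)))))))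

    private
      module SolverB = ℤ-Solver B.commutativeRing B.algebra
      module SolverK = ℤ-Solver K.commutativeRing K.algebra

    e-neg : ∀ x → e (B.- x) K.≈ K.- e x
    e-neg x = K.trans (e-cong (solve 1 (λ x → :- x := con -1ℤ :* x) B.refl x))
      (K.trans (e-* _ _) (K.trans (K.*-congʳ (e-ι -1ℤ)) (negative (e x))))
      where
      open SolverB
      negative : ∀ y → K.ι -1ℤ K.* y K.≈ K.- y
      negative = SolverK.solve 1 (λ y → SolverK.con -1ℤ SolverK.:* y SolverK.:= SolverK.:- y) K.refl

    module _ (z w : B.Carrier) where
      private
        v = B.ι 1ℤ B.+ w
        v′ = K.ι 1ℤ K.+ e w

      e-1+ : e v K.≈ v′
      e-1+ = K.trans (e-+ _ _) (K.+-congʳ (e-ι 1ℤ))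

      e-monomial : ∀ m n → e (z EB.^ m B.* v EB.^ n) K.≈ e z EK.^ m K.* v′ EK.^ n
      e-monomial m n = K.trans (e-* _ _) (K.*-cong (e-^ z m) (K.trans (e-^ v n) (EK.^-congˡ n e-1+)))

      e-+3 : ∀ x y {y′} → e x K.≈ y′ → e (x B.+ B.ι (+ 3) B.* y) K.≈ y′ K.+ K.ι (+ 3) K.* e y
      e-+3 x y p = K.trans (e-+ _ _) (K.+-cong p (K.trans (e-* _ _) (K.*-congʳ (e-ι (+ 3)))))

      e-leading : ∀ {c k} m n → c B.≈ z EB.^ m B.* v EB.^ n B.+ B.ι (+ 3) B.* k →
        e c K.≈ e z EK.^ m K.* v′ EK.^ n K.+ K.ι (+ 3) K.* e k
      e-leading {k = k} m n p = K.trans (e-cong p) (e-+3 _ k (e-monomial m n))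

      e-discriminant : ∀ {c₀ c₁ c₂ k} m n →
        c₁ EB.^ 2 B.- c₀ B.* c₂ B.≈ (z EB.^ m B.* v EB.^ n) EB.^ 2 B.* v B.+ B.ι (+ 3) B.* k →
        e c₁ EK.^ 2 K.- e c₀ K.* e c₂ K.≈ (e z EK.^ m K.* v′ EK.^ n) EK.^ 2 K.* v′ K.+ K.ι (+ 3) K.* e k
      e-discriminant {c₀} {c₁} {c₂} {k} m n p = K.trans
        (K.sym (K.trans (e-+ _ _) (K.+-cong (e-^ c₁ 2) (K.trans (e-neg _) (K.-‿cong (e-* c₀ c₂))))))
        (K.trans (e-cong p) (e-+3 _ k (K.trans (e-* _ _)
          (K.*-cong (K.trans (e-^ _ 2) (EK.^-congˡ 2 (e-monomial m n))) e-1+))))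

      e-root : ∀ {a Ψ y} σ m n →
        a B.≈ B.ι σ B.* (z EB.^ m B.* v EB.^ n B.* (v B.* Ψ)) B.+ B.ι (+ 3) B.* y →
        e a K.≈ K.ι σ K.* (e z EK.^ m K.* v′ EK.^ n K.* (v′ K.* e Ψ)) K.+ K.ι (+ 3) K.* e y
      e-root {y = y} σ m n p = K.trans (e-cong p) (e-+3 _ y (K.trans (e-* _ _) (K.*-cong (e-ι σ)
        (K.trans (e-* _ _) (K.*-cong (e-monomial m n) (K.trans (e-* _ _) (K.*-congʳ e-1+)))))))

  module _ (K : DifferentialRing) where
    open DifferentialRing K
    open Exp semiring using (_^_; ^-homo-*)
    open ℤ-Solver commutativeRing algebra
    open SetoidReasoning setoid
    open Differential K using (module Equation)

    even-odd-powers : ∀ x v f g →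
      x ^ (2 ℕ.* f) * v ^ (2 ℕ.* g ℕ.+ 1) ≈ (x ^ f * v ^ g) ^ 2 * v
    even-odd-powers x v f g = begin
      x ^ (2 ℕ.* f) * v ^ (2 ℕ.* g ℕ.+ 1)
        ≈⟨ *-cong (double x f) (CommutativeRing.trans commutativeRing (^-homo-* v (2 ℕ.* g) 1) (*-congʳ (double v g))) ⟩
      x ^ f * x ^ f * (v ^ g * v ^ g * v ^ 1)
        ≈⟨ solve 3 (λ p q v → p :* p :* (q :* q :* v :^ 1) := (p :* q) :^ 2 :* v) (CommutativeRing.refl commutativeRing) (x ^ f) (v ^ g) v ⟩
      (x ^ f * v ^ g) ^ 2 * v ∎
      where
      double : ∀ x f → x ^ (2 ℕ.* f) ≈ x ^ f * x ^ f
      double x f = CommutativeRing.trans commutativeRing (^-homo-* x f (f ℕ.+ 0))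
        (*-congˡ (reflexive (cong (x ^_) (ℕ.+-identityʳ f))))

    -- With v Ψ² = 1 the discriminant X² v is the square of X v Ψ.
    discriminant-square : ι (+ 3) ≈ ι 0ℤ → ∀ (z c₀ c₁ c₂ : Carrier) s Q {F X v Ψ} →
      (let open Equation z c₀ c₁ c₂ s Q) → P F ≈ ι 0ℤ →
      c₁ ^ 2 - c₀ * c₂ ≈ X ^ 2 * v → v * (Ψ * Ψ) ≈ ι 1ℤ →
      A F * A F ≈ X * (v * Ψ) * (X * (v * Ψ))
    discriminant-square 3≈0 z c₀ c₁ c₂ s Q {F} {X} {v} {Ψ} PF disc vΨ² = begin
      A F * A F
        ≈⟨ solve 5 (λ F c₀ c₁ c₂ q → let a = con (+ 2) :* c₂ :* F :+ c₁
                                         p = c₂ :* F :^ 2 :+ c₁ :* F :+ c₀ :+ con (+ 3) :* q in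
             a :* a := con (+ 4) :* c₂ :* p :+ (c₁ :^ 2 :- c₀ :* c₂) :- con (+ 3) :* (con (+ 4) :* c₂ :* q :+ c₀ :* c₂))
             (CommutativeRing.refl commutativeRing) F c₀ c₁ c₂ (q F) ⟩
      ι (+ 4) * c₂ * P F + (c₁ ^ 2 - c₀ * c₂) - ι (+ 3) * (ι (+ 4) * c₂ * q F + c₀ * c₂)
        ≈⟨ +-cong (+-cong (*-congˡ PF) disc) (-‿cong (*-congʳ 3≈0)) ⟩
      ι (+ 4) * c₂ * ι 0ℤ + X ^ 2 * v - ι 0ℤ * (ι (+ 4) * c₂ * q F + c₀ * c₂)
        ≈⟨ solve 4 (λ c X v t → con (+ 4) :* c :* con 0ℤ :+ X :^ 2 :* v :- con 0ℤ :* t := X :* X :* v :* con 1ℤ)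
             (CommutativeRing.refl commutativeRing) c₂ X v (ι (+ 4) * c₂ * q F + c₀ * c₂) ⟩
      X * X * v * ι 1ℤ
        ≈⟨ *-congˡ (CommutativeRing.sym commutativeRing vΨ²) ⟩
      X * X * v * (v * (Ψ * Ψ))
        ≈⟨ solve 3 (λ X v Ψ → X :* X :* v :* (v :* (Ψ :* Ψ)) := X :* (v :* Ψ) :* (X :* (v :* Ψ)))
             (CommutativeRing.refl commutativeRing) X v Ψ ⟩
      X * (v * Ψ) * (X * (v * Ψ)) ∎
      where open Equation z c₀ c₁ c₂ s Q

    square-lift : ∀ {v u Ψ y} → v * u ≈ ι 1ℤ → v * (Ψ * Ψ) ≈ ι 1ℤ + ι (+ 3) * y →
      Ψ * Ψ ≈ u + ι (+ 3) * (u * y)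
    square-lift {v} {u} {Ψ} {y} vu vΨ² = begin
      Ψ * Ψ
        ≈⟨ solve 1 (λ Ψ → Ψ :* Ψ := con 1ℤ :* (Ψ :* Ψ)) (CommutativeRing.refl commutativeRing) Ψ ⟩
      ι 1ℤ * (Ψ * Ψ)
        ≈⟨ *-congʳ (CommutativeRing.sym commutativeRing vu) ⟩
      v * u * (Ψ * Ψ)
        ≈⟨ solve 3 (λ v u Ψ → v :* u :* (Ψ :* Ψ) := u :* (v :* (Ψ :* Ψ))) (CommutativeRing.refl commutativeRing) v u Ψ ⟩
      u * (v * (Ψ * Ψ))
        ≈⟨ *-congˡ vΨ² ⟩
      u * (ι 1ℤ + ι (+ 3) * y)
        ≈⟨ solve 2 (λ u y → u :* (con 1ℤ :+ con (+ 3) :* y) := u :+ con (+ 3) :* (u :* y)) (CommutativeRing.refl commutativeRing) u y ⟩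
      u + ι (+ 3) * (u * y) ∎

    -- Addition of p / v^m and q / v^n; the new numerator uses only v, so it stays polynomial when
    -- p, q and v are.
    common-denominator : ∀ {v u} → v * u ≈ ι 1ℤ → ∀ a b p q m n →
      (a * (p * v ^ n) + b * (q * v ^ m)) * u ^ (m ℕ.+ n) ≈ a * (p * u ^ m) + b * (q * u ^ n)
    common-denominator {v} {u} vu a b p q m n = begin
      (a * (p * v ^ n) + b * (q * v ^ m)) * u ^ (m ℕ.+ n)
        ≈⟨ *-congˡ (^-homo-* u m n) ⟩
      (a * (p * v ^ n) + b * (q * v ^ m)) * (u ^ m * u ^ n)
        ≈⟨ solve 8 (λ a b p q v v′ u u′ → (a :* (p :* v′) :+ b :* (q :* v)) :* (u :* u′)
             := a :* (p :* u) :* (v′ :* u′) :+ b :* (q :* u′) :* (v :* u))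
             (CommutativeRing.refl commutativeRing) a b p q (v ^ m) (v ^ n) (u ^ m) (u ^ n) ⟩
      a * (p * u ^ m) * (v ^ n * u ^ n) + b * (q * u ^ n) * (v ^ m * u ^ m)
        ≈⟨ +-cong (*-congˡ (Differential.^-inverse K vu n)) (*-congˡ (Differential.^-inverse K vu m)) ⟩
      a * (p * u ^ m) * ι 1ℤ + b * (q * u ^ n) * ι 1ℤ
        ≈⟨ solve 2 (λ x y → x :* con 1ℤ :+ y :* con 1ℤ := x :+ y) (CommutativeRing.refl commutativeRing) _ _ ⟩
      a * (p * u ^ m) + b * (q * u ^ n) ∎

    *-swap : ∀ a b c → a * (b * c) ≈ b * (a * c)
    *-swap a b c = solve 3 (λ a b c → a :* (b :* c) := b :* (a :* c)) (CommutativeRing.refl commutativeRing) a b c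

  -- Square roots of power series over 𝔽₃

  module SquareRoots where

    3-prime : ∀ a b → + 3 ∣ a ℤ.* b → ¬ (+ 3 ∣ a) → + 3 ∣ b
    3-prime a b 3∣ab 3∤a
      with euclidsLemma ℤ.∣ a ∣ ℤ.∣ b ∣ (toWitness {a? = prime? 3} _)
             (subst (3 ℕ∣.∣_) (ℤ.abs-* a b) (∣⇒∣ᵤ 3∣ab))

    ... | inj₁ d = ⊥-elim (3∤a (∣ᵤ⇒∣ d))
    ... | inj₂ d = ∣ᵤ⇒∣ d

    private module S = DifferentialRing (seriesDifferentialRing 3)

    ∣-0 : ∀ {a} → + 3 ∣ a ℤ.- 0ℤ → + 3 ∣ a
    ∣-0 {a} = subst (+ 3 ∣_) (ℤ.+-identityʳ a)

    0ˢ-coefficient : ∀ n → 0ˢ n ≡ 0ℤ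
    0ˢ-coefficient zero    = refl
    0ˢ-coefficient (suc n) = refl

    ∣⇒≈0 : ∀ {f} → (∀ n → + 3 ∣ f n) → f ≈[ 3 ] 0ˢ
    ∣⇒≈0 {f} p = ⌈ (λ n → subst (+ 3 ∣_) (sym (trans (cong (ℤ._-_ (f n)) (0ˢ-coefficient n)) (ℤ.+-identityʳ (f n)))) (p n)) ⌉

    ≈0⇒∣ : ∀ {f} → f ≈[ 3 ] 0ˢ → ∀ n → + 3 ∣ f n
    ≈0⇒∣ {f} p n = ∣-0 (subst (λ a → + 3 ∣ f n ℤ.- a) (0ˢ-coefficient n) (⌊ p ⌋ n))

    divide-by-z : ∀ {f} → + 3 ∣ f 0 → f ≈[ 3 ] z *ˢ tail f
    divide-by-z {f} p = ⌈ (λ { zero → subst (+ 3 ∣_) (sym (ℤ.+-identityʳ (f 0))) p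
                             ; (suc n) → subst (λ a → + 3 ∣ f (suc n) ℤ.- a) (sym (z*-suc (tail f) n))
                                 (divides 0ℤ (ℤ.+-inverseʳ (f (suc n)))) }) ⌉

    z-cancel-0 : ∀ {f} → z *ˢ f ≈[ 3 ] 0ˢ → f ≈[ 3 ] 0ˢ
    z-cancel-0 {f} p = ∣⇒≈0 (λ n → subst (+ 3 ∣_) (z*-suc f n) (≈0⇒∣ p (suc n)))

    -- The index m of a coefficient that is nonzero modulo 3 makes this constructive.
    no-zero-divisors : ∀ m f g → ¬ (+ 3 ∣ f m) → f *ˢ g ≈[ 3 ] 0ˢ → g ≈[ 3 ] 0ˢ
    no-zero-divisors zero f g f₀ fg = ∣⇒≈0 (go g fg)
      where
      go : ∀ g → f *ˢ g ≈[ 3 ] 0ˢ → ∀ n → + 3 ∣ g n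
      g₀ : ∀ g → f *ˢ g ≈[ 3 ] 0ˢ → + 3 ∣ g 0
      g₀ g fg = 3-prime (f 0) (g 0) (subst (+ 3 ∣_) (*ˢ-zero f g) (≈0⇒∣ fg 0)) f₀
      go g fg zero    = g₀ g fg
      -- The lowest coefficient of g vanishes modulo 3, so g is z times its tail; after cancelling z
      -- the tail satisfies the same hypothesis.
      go g fg (suc n) = go (tail g) (z-cancel-0 {f *ˢ tail g} (S.trans {z *ˢ (f *ˢ tail g)} {f *ˢ (z *ˢ tail g)}
        (≈ˢ⇒≈[] swap)
        (S.trans {f *ˢ (z *ˢ tail g)} {f *ˢ g} (S.*-congˡ {f} (S.sym (divide-by-z {g} (g₀ g fg)))) fg))) n
        where
        swap : z *ˢ (f *ˢ tail g) ≈ˢ f *ˢ (z *ˢ tail g)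
        swap i = trans (sym (*ˢ-assoc z f (tail g) i))
          (trans (*ˢ-cong {z *ˢ f} {f *ˢ z} {tail g} (*ˢ-comm z f) (λ _ → refl) i) (*ˢ-assoc f z (tail g) i))
    no-zero-divisors (suc m) f g fₘ fg = by-cases (+ 3 ∣? f 0)
      where
      by-cases : Dec (+ 3 ∣ f 0) → g ≈[ 3 ] 0ˢ
      by-cases (no f₀)  = no-zero-divisors zero f g f₀ fg
      by-cases (yes f₀) = no-zero-divisors m (tail f) g fₘ (z-cancel-0 {tail f *ˢ g}
        (S.trans {z *ˢ (tail f *ˢ g)} {z *ˢ tail f *ˢ g} (S.sym (S.*-assoc z (tail f) g))
          (S.trans {z *ˢ tail f *ˢ g} {f *ˢ g} (S.*-congʳ {g} (S.sym (divide-by-z {f} f₀))) fg)))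

    open ℤ-Solver (seriesRing 3) (const-algebra 3)

    -- (a + b)(a - b) vanishes modulo 3. At index m the two factors differ by 2, so one of them has
    -- a coefficient there prime to 3, and the other must vanish.
    square-root-unique : ∀ m {a b} → b m ≡ 1ℤ → a *ˢ a ≈[ 3 ] b *ˢ b →
      ∃[ σ ] (σ ≡ 1ℤ ⊎ σ ≡ -1ℤ) × a ≈[ 3 ] const σ *ˢ b
    square-root-unique m {a} {b} bₘ a²≈b² = by-cases (+ 3 ∣? (a +ˢ b) m)
      where
      difference : (a +ˢ b) *ˢ (a -ˢ b) ≈[ 3 ] 0ˢ
      difference = S.trans {(a +ˢ b) *ˢ (a -ˢ b)} {a *ˢ a -ˢ b *ˢ b}
        (solve 2 (λ a b → (a :+ b) :* (a :- b) := a :* a :- b :* b) S.refl a b)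
        (S.trans {a *ˢ a -ˢ b *ˢ b} {b *ˢ b -ˢ b *ˢ b} (S.+-congʳ { -ˢ (b *ˢ b)} a²≈b²)
          (solve 1 (λ t → t :- t := con 0ℤ) S.refl (b *ˢ b)))
      lem : ∀ a b → b ≡ 1ℤ → a ℤ.+ b ℤ.- (a ℤ.- b) ≡ + 2
      lem a _ refl = lem′ a
        where
        lem′ : ∀ a → a ℤ.+ 1ℤ ℤ.- (a ℤ.- 1ℤ) ≡ + 2
        lem′ = solve-∀
      by-cases : Dec (+ 3 ∣ (a +ˢ b) m) → ∃[ σ ] (σ ≡ 1ℤ ⊎ σ ≡ -1ℤ) × a ≈[ 3 ] const σ *ˢ b
      by-cases (no 3∤) = 1ℤ , inj₁ refl ,
        S.trans {a} {b +ˢ (a -ˢ b)} (solve 2 (λ a b → a := b :+ (a :- b)) S.refl a b)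
        (S.trans {b +ˢ (a -ˢ b)} {b +ˢ 0ˢ} (S.+-congˡ {b} (no-zero-divisors m (a +ˢ b) (a -ˢ b) 3∤ difference))
          (solve 1 (λ b → b :+ con 0ℤ := con 1ℤ :* b) S.refl b))
      by-cases (yes 3∣) = -1ℤ , inj₂ refl ,
        S.trans {a} {(a +ˢ b) -ˢ b} (solve 2 (λ a b → a := (a :+ b) :- b) S.refl a b)
        (S.trans {(a +ˢ b) -ˢ b} {0ˢ -ˢ b} (S.+-congʳ { -ˢ b} (no-zero-divisors m (a -ˢ b) (a +ˢ b) 3∤
            (S.trans {(a -ˢ b) *ˢ (a +ˢ b)} {(a +ˢ b) *ˢ (a -ˢ b)} (S.*-comm (a -ˢ b) (a +ˢ b)) difference)))
          (solve 1 (λ b → con 0ℤ :- b := con -1ℤ :* b) S.refl b))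
        where
        3∤ : ¬ (+ 3 ∣ (a -ˢ b) m)
        3∤ 3∣′ = 3∤2 (subst (+ 3 ∣_) (lem (a m) (b m) bₘ) (∣m∣n⇒∣m-n 3∣ 3∣′))
          where
          3∤2 : ¬ (+ 3 ∣ + 2)
          3∤2 d = toWitnessFalse {a? = + 3 ∣? + 2} _ d

-- Polynomial series, quotients of congruences, and Laurent coefficients

module PolynomialsAndLaurentSeries where

  open PowerSeries
  open DifferentialRings
  open SeriesDerivative
  open Localisations
  open SeriesLimits
  open import Defs
  open import Algebra.Bundles using (Semiring)
  import Algebra.Properties.Semiring.Exp as Exp
  import Algebra.Definitions.RawSemiring as RawSemiringDefs
  open import Data.Fin using (Fin; zero; suc)
  open import Data.Integer as ℤ using (ℤ; +_; -[1+_]; 0ℤ; 1ℤ; -1ℤ)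
  import Data.Integer.Properties as ℤ
  open import Data.Integer.Divisibility.Signed using (_∣_; divides)
  open import Data.Integer.Tactic.RingSolver using (solve-∀)
  open import Data.List using ([]; _∷_)
  open import Data.Nat as ℕ using (ℕ; zero; suc)
  import Data.Nat.Properties as ℕ
  open import Data.Product using (_,_; ∃-syntax; proj₁; proj₂)
  open import Relation.Binary.PropositionalEquality as ≡
    using (_≡_; refl; sym; trans; cong; cong₂; subst; module ≡-Reasoning)

  IsPoly : Series → Set
  IsPoly f = ∃[ p ] ⟦ p ⟧ ≈ˢ f

  poly-≈ˢ : ∀ {f g} → f ≈ˢ g → IsPoly f → IsPoly g
  poly-≈ˢ e (p , eq) = p , λ n → trans (eq n) (e n)

  poly-const : ∀ a → IsPoly (const a)
  poly-const a = (a ∷ []) , λ { zero → refl ; (suc n) → refl }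

  poly-z : IsPoly z
  poly-z = (0ℤ ∷ 1ℤ ∷ []) , λ { zero → refl ; (suc zero) → refl ; (suc (suc n)) → refl }

  _+ᴾ_ : Poly → Poly → Poly
  []      +ᴾ q       = q
  (a ∷ p) +ᴾ []      = a ∷ p
  (a ∷ p) +ᴾ (b ∷ q) = (a ℤ.+ b) ∷ (p +ᴾ q)

  ⟦⟧-+ : ∀ p q → ⟦ p +ᴾ q ⟧ ≈ˢ ⟦ p ⟧ +ˢ ⟦ q ⟧
  ⟦⟧-+ []      q       n       = sym (ℤ.+-identityˡ _)
  ⟦⟧-+ (a ∷ p) []      n       = sym (ℤ.+-identityʳ _)
  ⟦⟧-+ (a ∷ p) (b ∷ q) zero    = refl
  ⟦⟧-+ (a ∷ p) (b ∷ q) (suc n) = ⟦⟧-+ p q n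

  poly-+ : ∀ {f g} → IsPoly f → IsPoly g → IsPoly (f +ˢ g)
  poly-+ (p , e) (q , e′) = p +ᴾ q , λ n → trans (⟦⟧-+ p q n) (cong₂ ℤ._+_ (e n) (e′ n))

  poly-scale : ∀ a {f} → IsPoly f → IsPoly (scale a f)
  poly-scale a (p , e) = go p , λ n → trans (go-correct p n) (cong (ℤ._*_ a) (e n))
    where
    go : Poly → Poly
    go []      = []
    go (b ∷ p) = (a ℤ.* b) ∷ go p
    go-correct : ∀ p → ⟦ go p ⟧ ≈ˢ scale a ⟦ p ⟧
    go-correct []      n       = sym (ℤ.*-zeroʳ a)
    go-correct (b ∷ p) zero    = refl
    go-correct (b ∷ p) (suc n) = go-correct p n

  ⟦∷⟧ : ∀ a p → ⟦ a ∷ p ⟧ ≈ˢ const a +ˢ z *ˢ ⟦ p ⟧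
  ⟦∷⟧ a p zero    = sym (ℤ.+-identityʳ a)
  ⟦∷⟧ a p (suc n) = trans (sym (z*-suc ⟦ p ⟧ n)) (sym (ℤ.+-identityˡ _))

  poly-z* : ∀ {f} → IsPoly f → IsPoly (z *ˢ f)
  poly-z* {f} (p , e) = (0ℤ ∷ p) , λ { zero → refl ; (suc n) → trans (e n) (sym (z*-suc f n)) }

  poly-* : ∀ {f g} → IsPoly f → IsPoly g → IsPoly (f *ˢ g)
  poly-* {f} {g} (p , e) q = poly-≈ˢ (*ˢ-cong {⟦ p ⟧} {f} {g} e (λ _ → refl)) (go p)
    where
    go : ∀ p → IsPoly (⟦ p ⟧ *ˢ g)
    go []      = [] , λ n → sym (0*ˢ ⟦ [] ⟧ g (λ _ → refl) n)
    go (a ∷ p) = poly-≈ˢ eq (poly-+ (poly-scale a q) (poly-z* (go p)))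
      where
      eq : scale a g +ˢ z *ˢ (⟦ p ⟧ *ˢ g) ≈ˢ ⟦ a ∷ p ⟧ *ˢ g
      eq n = sym (trans (*ˢ-cong {⟦ a ∷ p ⟧} {const a +ˢ z *ˢ ⟦ p ⟧} {g} (⟦∷⟧ a p) (λ _ → refl) n)
        (trans (*ˢ-distribʳ g (const a) (z *ˢ ⟦ p ⟧) n) (cong₂ ℤ._+_ (const*ˢ a g n) (*ˢ-assoc z ⟦ p ⟧ g n))))

  poly-- : ∀ {f g} → IsPoly f → IsPoly g → IsPoly (f -ˢ g)
  poly-- {f} {g} p q = poly-≈ˢ (λ n → lem (f n) (g n)) (poly-+ p (poly-scale -1ℤ q))
    where
    lem : ∀ a b → a ℤ.+ -1ℤ ℤ.* b ≡ a ℤ.- b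
    lem = solve-∀

  poly-^ : ∀ {f} → IsPoly f → ∀ n → IsPoly (f ^ˢ n)
  poly-^ p zero    = poly-const 1ℤ
  poly-^ p (suc n) = poly-* p (poly-^ p n)

  poly-monomial : ∀ ε γ → IsPoly (monomial ε γ)
  poly-monomial ε γ = poly-* (poly-const ε) (poly-^ poly-z γ)

  poly-quotient : ∀ M p → (∀ n → + M ∣ ⟦ p ⟧ n) → ∃[ q ] ⟦ p ⟧ ≈ˢ scale (+ M) ⟦ q ⟧
  poly-quotient M []      d = [] , λ n → sym (ℤ.*-zeroʳ (+ M))
  poly-quotient M (a ∷ p) d with divides b eq ← d 0 | q , e ← poly-quotient M p (λ n → d (suc n)) =
    (b ∷ q) , λ { zero → trans eq (ℤ.*-comm b (+ M)) ; (suc n) → e n }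

  -- A congruence modulo 3 says nothing about higher powers of 3, but the exact identity over ℤ can
  -- be read again modulo 3^N.
  ≡ˢ⇒quotient : ∀ {M f g} → f ≡ˢ g [mod M ] → ∃[ h ] f ≈ˢ g +ˢ const (+ M) *ˢ h
  ≡ˢ⇒quotient {M} {f} {g} d = h , λ n → trans (eq (f n) (g n) (d n)) (cong (ℤ._+_ (g n)) (sym (const*ˢ (+ M) h n)))
    where
    h : Series
    h n = _∣_.quotient (d n)
    lem : ∀ a b → a ≡ b ℤ.+ (a ℤ.- b)
    lem = solve-∀
    eq : ∀ a b (d : + M ∣ a ℤ.- b) → a ≡ b ℤ.+ + M ℤ.* _∣_.quotient d
    eq a b (divides q e) = trans (lem a b) (cong (ℤ._+_ b) (trans e (ℤ.*-comm q (+ M))))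

  -- For the quotients in the conditions on c₂ and the discriminant a series is not enough: they
  -- have to lie in ℤ[z, z⁻¹, u].
  ≡ˢ⇒poly-quotient : ∀ {M f g} → IsPoly f → IsPoly g → f ≡ˢ g [mod M ] →
    ∃[ p ] f ≈ˢ g +ˢ const (+ M) *ˢ ⟦ p ⟧
  ≡ˢ⇒poly-quotient {M} {f} {g} pf pg d = proj₁ quotient , λ n → trans (lem₂ (f n) (g n)) (cong (ℤ._+_ (g n))
      (trans (sym (proj₂ difference n)) (trans (proj₂ quotient n) (sym (const*ˢ (+ M) ⟦ proj₁ quotient ⟧ n)))))
    where
    lem₁ : ∀ a b → a ℤ.+ -1ℤ ℤ.* b ≡ a ℤ.- b
    lem₁ = solve-∀
    lem₂ : ∀ a b → a ≡ b ℤ.+ (a ℤ.+ -1ℤ ℤ.* b)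
    lem₂ = solve-∀
    difference : IsPoly (f +ˢ scale -1ℤ g)
    difference = poly-+ pf (poly-scale -1ℤ pg)
    quotient : ∃[ q ] ⟦ proj₁ difference ⟧ ≈ˢ scale (+ M) ⟦ q ⟧
    quotient = poly-quotient M (proj₁ difference)
      (λ n → subst (+ M ∣_) (sym (trans (proj₂ difference n) (lem₁ (f n) (g n)))) (d n))

  module LaurentSeries (M : ℕ) where

    private
      B = seriesDifferentialRing M
      module B = DifferentialRing B
      open SeriesModulo M using (^ˢ≡^)
      open Exp B.semiring using () renaming (_^_ to _B^_)

    -- Multiplication by z only shifts coefficients, so z is cancellable for every `M`.
    z-cancel : ∀ {f g} → z *ˢ f ≈[ M ] z *ˢ g → f ≈[ M ] g
    z-cancel {f} {g} p = ⌈ (λ n → ≡.subst₂ (λ a b → + M ∣ a ℤ.- b) (z*-suc f n) (z*-suc g n) (⌊ p ⌋ (suc n))) ⌉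

    open Localisation B z (λ {f} {g} → z-cancel {f} {g}) (≈ˢ⇒≈[] deriv-z) public

    K : DifferentialRing
    K = fractionDifferentialRing

    open Exp (DifferentialRing.semiring K) using (_^_)
    open RawSemiringDefs (Semiring.rawSemiring (DifferentialRing.semiring K)) using (sum)

    toLaurent : Fraction → Laurent
    toLaurent (f /z^ m) = z^- m · f

    toLaurent-+ : ∀ x y → toLaurent (x +ᶠ y) ≡ toLaurent x +ᴸ toLaurent y
    toLaurent-+ (f /z^ m) (g /z^ n) = cong₂ (λ p q → z^- (m ℕ.+ n) · (p *ˢ f +ˢ q *ˢ g)) (sym (^ˢ≡^ z n)) (sym (^ˢ≡^ z m))

    toLaurent-^ : ∀ x n → toLaurent (x ^ n) ≡ toLaurent x ^ᴸ n
    toLaurent-^ x zero    = refl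
    toLaurent-^ x (suc n) = cong (toLaurent x *ᴸ_) (toLaurent-^ x n)

    toLaurent-sum : ∀ {n} (t : Fin n → Fraction) (t′ : Fin n → Laurent) → (∀ i → toLaurent (t i) ≡ t′ i) →
      toLaurent (sum t) ≡ sumᴸ t′
    toLaurent-sum {zero}  t t′ e = refl
    toLaurent-sum {suc n} t t′ e = trans (toLaurent-+ (t zero) (sum (λ i → t (suc i))))
      (cong₂ _+ᴸ_ (e zero) (toLaurent-sum (λ i → t (suc i)) (λ i → t′ (suc i)) (λ i → e (suc i))))

    private
      -- `coeff` with its index made an explicit argument, so that the indices of two fractions can
      -- be split into cases independently.
      at : Series → ℤ → ℤ
      at f (+ n)    = f n
      at f -[1+ _ ] = 0ℤ

      coeff≡ : ∀ m f k → coeff (z^- m · f) k ≡ at f (k ℤ.+ + m)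
      coeff≡ m f k with k ℤ.+ + m
      ... | + n      = refl
      ... | -[1+ _ ] = refl

      reassociate : ∀ n k m → n ℤ.+ (k ℤ.+ m) ≡ m ℤ.+ (k ℤ.+ n)
      reassociate = solve-∀

      same : ∀ k {m n a b} → k ℤ.+ + m ≡ + a → k ℤ.+ + n ≡ + b → n ℕ.+ a ≡ m ℕ.+ b
      same k {m} {n} p q = ℤ.+-injective (trans (cong (ℤ._+_ (+ n)) (sym p))
        (trans (reassociate (+ n) k (+ m)) (cong (ℤ._+_ (+ m)) q)))

      -- If z^k lies below the range of z^(-n) g, the matching index in the cleared equation is less
      -- than m, where z^m g has only zeros.
      below : ∀ k {m n a b} → k ℤ.+ + m ≡ + a → k ℤ.+ + n ≡ -[1+ b ] → n ℕ.+ a ℕ.< m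
      below k {m} {n} {a} {b} p q = ℕ.m+n≤o⇒m≤o (suc (n ℕ.+ a)) (ℕ.≤-reflexive (ℤ.+-injective (begin
        + (suc (n ℕ.+ a) ℕ.+ b)              ≡⟨ cong +_ (sym (ℕ.+-suc (n ℕ.+ a) b)) ⟩
        + (n ℕ.+ a) ℤ.+ + suc b              ≡⟨ cong (λ t → + n ℤ.+ t ℤ.+ + suc b) (sym p) ⟩
        + n ℤ.+ (k ℤ.+ + m) ℤ.+ + suc b      ≡⟨ cong (ℤ._+ + suc b) (reassociate (+ n) k (+ m)) ⟩
        + m ℤ.+ (k ℤ.+ + n) ℤ.+ + suc b      ≡⟨ cong (λ t → + m ℤ.+ t ℤ.+ + suc b) q ⟩
        + m ℤ.+ -[1+ b ] ℤ.+ + suc b         ≡⟨ cancel (+ m) (+ suc b) ⟩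
        + m                                  ∎)))
        where
        open ≡-Reasoning
        cancel : ∀ m b → m ℤ.+ ℤ.- b ℤ.+ b ≡ m
        cancel = solve-∀

      cleared : ∀ m n f g → z B^ n *ˢ f ≈[ M ] z B^ m *ˢ g →
        ∀ i → + M ∣ (z ^ˢ n *ˢ f) i ℤ.- (z ^ˢ m *ˢ g) i
      cleared m n f g e i = ≡.subst₂ (λ p q → + M ∣ (p *ˢ f) i ℤ.- (q *ˢ g) i)
        (sym (^ˢ≡^ z n)) (sym (^ˢ≡^ z m)) (⌊ e ⌋ i)

    -- The coefficients of z^k in both series sit at index k + m + n of the cleared equation, or are
    -- zero there when their own index is negative.
    ~⇒≡ᴸ : ∀ {x y} → x ~ y → toLaurent x ≡ᴸ toLaurent y [mod M ]
    ~⇒≡ᴸ {f /z^ m} {g /z^ n} ⟪ e ⟫ k =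
      ≡.subst₂ (λ s t → + M ∣ s ℤ.- t) (sym (coeff≡ m f k)) (sym (coeff≡ n g k)) (go (k ℤ.+ + m) (k ℤ.+ + n) refl refl)
      where
      go : ∀ i j → k ℤ.+ + m ≡ i → k ℤ.+ + n ≡ j → + M ∣ at f i ℤ.- at g j
      go (+ a) (+ b) p q = ≡.subst₂ (λ s t → + M ∣ s ℤ.- t) (z^*-+ n f a)
        (trans (cong (z ^ˢ m *ˢ g) (same k p q)) (z^*-+ m g b)) (cleared m n f g e (n ℕ.+ a))
      go (+ a) -[1+ b ] p q = ≡.subst₂ (λ s t → + M ∣ s ℤ.- t) (z^*-+ n f a)
        (z^*-< m g (below k p q)) (cleared m n f g e (n ℕ.+ a))
      go -[1+ a ] (+ b) p q = ≡.subst₂ (λ s t → + M ∣ s ℤ.- t) (z^*-< n f (below k q p))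
        (z^*-+ m g b) (cleared m n f g e (m ℕ.+ b))
      go -[1+ a ] -[1+ b ] p q = divides 0ℤ refl

-- Application to w = ε z^γ modulo 3^N

module Conclusion where

  open PowerSeries
  open DifferentialRings
  open SeriesDerivative
  open InfiniteProducts
  open SeriesLimits
  open Homomorphisms
  open PolynomialsAndLaurentSeries
  open import Defs
  open import Algebra.Bundles using (Semiring)
  import Algebra.Properties.Semiring.Exp as Exp
  import Algebra.Definitions.RawSemiring as RawSemiringDefs
  open import Data.Fin using (Fin; toℕ)
  open import Data.Integer as ℤ using (ℤ; +_; 0ℤ; 1ℤ; -1ℤ)
  import Data.Integer.Properties as ℤ
  open import Data.Integer.Divisibility.Signed using (divides)
  open import Data.List using ([]; _∷_)
  open import Data.Nat as ℕ using (ℕ; zero; suc)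
  import Data.Nat.Properties as ℕ
  open import Data.Product using (_,_; _×_; ∃-syntax; Σ-syntax; proj₁; proj₂)
  open import Data.Sum using (_⊎_; inj₁; inj₂)
  open import Data.Vec as Vec using (Vec; lookup; iterate)
  open import Relation.Binary.PropositionalEquality as ≡
    using (_≡_; refl; sym; trans; cong; cong₂; subst)

  module _ (M : ℕ) where
    private
      module S = DifferentialRing (seriesDifferentialRing M)
      module DS = Differential (seriesDifferentialRing M)
      open SeriesModulo M using (^ˢ≡^)
      open RawSemiringDefs (Semiring.rawSemiring S.semiring) using (product)

    productˢ≡product : ∀ {n} (f g : Fin n → Series) → (∀ i → f i ≡ g i) → productˢ f ≡ product g
    productˢ≡product {zero}  f g e = refl
    productˢ≡product {suc n} f g e = cong₂ _*ˢ_ (e Fin.zero)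
      (productˢ≡product (λ i → f (Fin.suc i)) (λ i → g (Fin.suc i)) (λ i → e (Fin.suc i)))

    eval≡ : ∀ {n} (p : MvPoly n) fs → eval p fs ≡ DS.eval p fs
    eval≡ []             fs = refl
    eval≡ ((a , es) ∷ p) fs = cong₂ _+ˢ_ (cong (const a *ˢ_) (productˢ≡product
      (λ i → lookup fs i ^ˢ lookup es i) _ (λ i → ^ˢ≡^ (lookup fs i) (lookup es i)))) (eval≡ p fs)

    equationLHS≡P : ∀ c₀ c₁ c₂ s Q F →
      equationLHS c₀ c₁ c₂ s Q F ≡ DS.Equation.P z ⟦ c₀ ⟧ ⟦ c₁ ⟧ ⟦ c₂ ⟧ s Q F
    equationLHS≡P c₀ c₁ c₂ s Q F = cong (λ q → ⟦ c₂ ⟧ *ˢ F ^ˢ 2 +ˢ ⟦ c₁ ⟧ *ˢ F +ˢ ⟦ c₀ ⟧ +ˢ const (+ 3) *ˢ q)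
      (eval≡ Q (z Vec.∷ iterate deriv F (suc s)))

  -- The exponent is a successor, so w has no constant term; all limits in w rest on this.
  monomial-multiple : ∀ M ε γ → monomial ε (suc γ) ≈[ M ] z *ˢ (const ε *ˢ z ^ˢ γ)
  monomial-multiple M ε γ = ≈ˢ⇒≈[] λ n →
    trans (sym (*ˢ-assoc (const ε) z (z ^ˢ γ) n))
      (trans (*ˢ-cong {const ε *ˢ z} {z *ˢ const ε} {z ^ˢ γ} (*ˢ-comm (const ε) z) (λ _ → refl) n)
        (*ˢ-assoc z (const ε) (z ^ˢ γ) n))

  Ψ-square-mod-3 : ∀ ε γ → let w = monomial ε (suc γ) in (1ˢ +ˢ w) *ˢ (Ψ w *ˢ Ψ w) ≈[ 3 ] 1ˢ
  Ψ-square-mod-3 ε γ = Ψ-square separated Ψ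
      (λ {w} {t} → Ψ-partial {w} {t}) ⌈ (λ { zero → divides 1ℤ refl ; (suc n) → divides 0ℤ refl }) ⌉
      {monomial ε (suc γ)} {const ε *ˢ z ^ˢ γ} (monomial-multiple 3 ε γ)
    where
    open SeriesModulo 3
    open Tower.ZAdic (seriesDifferentialRing 3) z

  module Representation (N γ : ℕ) (ε : ℤ) where

    M : ℕ
    M = 3 ℕ.^ N

    w wTail : Series
    w = monomial ε (suc γ)
    wTail = const ε *ˢ z ^ˢ γ

    B : DifferentialRing
    B = seriesDifferentialRing M
    module B = DifferentialRing B
    module EB = Exp B.semiring

    open SeriesModulo M
    open LaurentSeries M
    open Tower.ZAdic B z

    module K = DifferentialRing K
    module EK = Exp K.semiring
    module H = Homomorphism B K embed (λ {x} {y} → embed-cong {x} {y}) embed-+ (λ x y → K.refl) embed-D (λ a → K.refl)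

    v u : Series
    v = 1ˢ +ˢ w
    u = inv1+ w

    w≈ : w ≈[ M ] z *ˢ wTail
    w≈ = monomial-multiple M ε γ

    vu≈1 : v *ˢ u ≈[ M ] 1ˢ
    vu≈1 = inv1+-inverse {w} {wTail} w≈

    3^N≈0ˢ : const (+ 3) EB.^ N ≈[ M ] const 0ℤ
    3^N≈0ˢ = B.trans {_} {const (+ M)} (B.sym {const (+ M)} (ι-power B 3 N))
      ⌈ (λ { zero → divides 1ℤ (trans (ℤ.+-identityʳ (+ M)) (sym (ℤ.*-identityˡ (+ M)))) ; (suc n) → divides 0ℤ refl }) ⌉

    3^N≈0 : K.ι (+ 3) EK.^ N K.≈ K.ι 0ℤ
    3^N≈0 = K.trans (K.sym (H.e-^ (const (+ 3)) N)) (embed-cong 3^N≈0ˢ)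

    -- The relation is proved over 𝔽₃, lifted to an identity over ℤ, and then used modulo 3^N.
    lift-Ψ² : ∃[ y ] v *ˢ (Ψ w *ˢ Ψ w) ≈ˢ 1ˢ +ˢ const (+ 3) *ˢ y
    lift-Ψ² = ≡ˢ⇒quotient {3} {v *ˢ (Ψ w *ˢ Ψ w)} {1ˢ} ⌊ Ψ-square-mod-3 ε γ ⌋

    θ ρ : Series
    θ = u *ˢ proj₁ lift-Ψ²
    ρ = Ψ (w EB.^ (3 ℕ.^ suc N))

    z⁻¹ : Fraction
    z⁻¹ = 1ˢ /z^ 1

    z-inverse : embed z *ᶠ z⁻¹ K.≈ K.ι 1ℤ
    z-inverse = K.sym (~-expand 1 {0} {1} {1ˢ} {z *ˢ 1ˢ} refl
      (B.trans {z EB.^ 1 *ˢ 1ˢ} {z EB.^ 1} (B.*-identityʳ (z EB.^ 1)) B.refl))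

    module Setting = Differential.Setting K (embed z) z⁻¹ (embed w) (embed u) (embed (Ψ w)) (embed θ) (embed ρ)
      ε (suc γ) N 3^N≈0 z-inverse
      (K.trans (K.sym (embed-D z)) (embed-cong (≈ˢ⇒≈[] deriv-z)))
      (K.*-congˡ {K.ι ε} (K.trans (K.reflexive (cong embed (^ˢ≡^ z (suc γ)))) (H.e-^ z (suc γ))))
      (K.trans (K.sym (K.*-congʳ (H.e-1+ z w))) (embed-cong vu≈1))
      (K.trans (embed-cong (square-lift B {v} {u} {Ψ w} {proj₁ lift-Ψ²} vu≈1 (≈ˢ⇒≈[] (proj₂ lift-Ψ²))))
        (H.e-+3 z w u θ K.refl))
      (K.trans (embed-cong (Ψ-tower separated Ψ (λ {w} {t} → Ψ-partial {w} {t}) (suc N) {w} {wTail} w≈))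
        (K.*-congʳ {embed ρ} (H.e-tower (suc N) w)))
      (K.trans (K.sym (embed-D ρ)) (embed-cong (D-Ψ-tail separated Ψ (λ {w} {t} → Ψ-partial {w} {t}) N 3^N≈0ˢ {w} {wTail} w≈)))

    open Differential K using (Generated; respᴳ; 0ᴳ; 1ᴳ; _+ᴳ_; _*⁰_; _*¹_; gen⁰)
    open Setting using (R; base-ι; base-z; base-z⁻¹; base-u; poly∈; poly⇒sum)

    poly∈R : ∀ {f} → IsPoly f → R 0 (embed f)
    poly∈R (p , e) = respᴳ (embed-cong (≈ˢ⇒≈[] e)) (go p)
      where
      go : ∀ p → R 0 (embed ⟦ p ⟧)
      go []      = respᴳ (embed-cong (≈ˢ⇒≈[] (λ { zero → refl ; (suc n) → refl }))) 0ᴳ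
      go (a ∷ p) = respᴳ
        (K.sym (K.trans (embed-cong (≈ˢ⇒≈[] (⟦∷⟧ a p))) (embed-+ (const a) (z *ˢ ⟦ p ⟧))))
        (gen⁰ (base-ι a) +ᴳ (base-z *⁰ go p))

    locFraction : LocPoly → Fraction
    locFraction a = (⟦ numerator ⟧ *ˢ u ^ˢ wExp) /z^ zExp
      where open LocPoly a

    IsLocPoly : Fraction → Set
    IsLocPoly x = ∃[ a ] locFraction a K.≈ x

    locPoly : ∀ {f} → IsPoly f → ∀ m n → IsLocPoly ((f *ˢ u ^ˢ n) /z^ m)
    locPoly {f} (p , e) m n = mkLocPoly p m n ,
      ~-body refl (≈ˢ⇒≈[] (*ˢ-cong {⟦ p ⟧} {f} {u ^ˢ n} e (λ _ → refl)))

    poly-v : IsPoly v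
    poly-v = poly-+ (poly-const 1ℤ) (poly-monomial ε (suc γ))

    locPoly-+ : ∀ {x y} → IsLocPoly x → IsLocPoly y → IsLocPoly (x K.+ y)
    locPoly-+ {x} {y} (mkLocPoly p k m , e) (mkLocPoly q l n , e′) =
      proj₁ sum , K.trans (proj₂ sum) (K.trans (~-body refl eq) (K.+-cong e e′))
      where
      -- Each numerator is extended by the power of the polynomial v missing from its own
      -- denominator, and by the missing power of z.
      num : Series
      num = z ^ˢ l *ˢ (⟦ p ⟧ *ˢ v ^ˢ n) +ˢ z ^ˢ k *ˢ (⟦ q ⟧ *ˢ v ^ˢ m)
      sum : IsLocPoly ((num *ˢ u ^ˢ (m ℕ.+ n)) /z^ (k ℕ.+ l))
      sum = locPoly (poly-+ (poly-* (poly-^ poly-z l) (poly-* (p , λ _ → refl) (poly-^ poly-v n)))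
                            (poly-* (poly-^ poly-z k) (poly-* (q , λ _ → refl) (poly-^ poly-v m)))) (k ℕ.+ l) (m ℕ.+ n)
      eq : num *ˢ u ^ˢ (m ℕ.+ n) ≈[ M ]
        z EB.^ l *ˢ (⟦ p ⟧ *ˢ u ^ˢ m) +ˢ z EB.^ k *ˢ (⟦ q ⟧ *ˢ u ^ˢ n)
      eq = B.trans (B.reflexive (cong₂ _*ˢ_ (cong₂ _+ˢ_
             (cong₂ (λ a b → a *ˢ (⟦ p ⟧ *ˢ b)) (^ˢ≡^ z l) (^ˢ≡^ v n))
             (cong₂ (λ a b → a *ˢ (⟦ q ⟧ *ˢ b)) (^ˢ≡^ z k) (^ˢ≡^ v m))) (^ˢ≡^ u (m ℕ.+ n))))
        (B.trans (common-denominator B {v} {u} vu≈1 (z EB.^ l) (z EB.^ k) ⟦ p ⟧ ⟦ q ⟧ m n)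
          (B.reflexive (cong₂ _+ˢ_
            (cong (λ a → z EB.^ l *ˢ (⟦ p ⟧ *ˢ a)) (sym (^ˢ≡^ u m)))
            (cong (λ a → z EB.^ k *ˢ (⟦ q ⟧ *ˢ a)) (sym (^ˢ≡^ u n))))))

    locPoly-resp : ∀ {x y} → x K.≈ y → IsLocPoly x → IsLocPoly y
    locPoly-resp e (a , e′) = a , K.trans e′ e

    locPoly-0 : IsLocPoly (K.ι 0ℤ)
    locPoly-0 = mkLocPoly [] 0 0 , embed-cong (≈ˢ⇒≈[] (λ n → trans (0*ˢ ⟦ [] ⟧ 1ˢ (λ _ → refl) n) (zeros n)))
      where
      zeros : ∀ n → 0ℤ ≡ const 0ℤ n
      zeros zero    = refl
      zeros (suc n) = refl

    locPoly-poly* : ∀ {f x} → IsPoly f → IsLocPoly x → IsLocPoly (embed f K.* x)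
    locPoly-poly* {f} pf (mkLocPoly q k m , e) =
      locPoly-resp (K.trans (~-body refl (B.*-assoc f ⟦ q ⟧ (u ^ˢ m))) (K.*-congˡ {embed f} e))
        (locPoly (poly-* pf (q , λ _ → refl)) k m)

    locPoly-z⁻¹* : ∀ {x} → IsLocPoly x → IsLocPoly (z⁻¹ K.* x)
    locPoly-z⁻¹* (mkLocPoly q k m , e) = mkLocPoly q (suc k) m ,
      K.trans (~-body refl (B.sym (B.*-identityˡ (⟦ q ⟧ *ˢ u ^ˢ m)))) (K.*-congˡ {z⁻¹} e)

    locPoly-u* : ∀ {x} → IsLocPoly x → IsLocPoly (embed u K.* x)
    locPoly-u* (mkLocPoly q k m , e) = mkLocPoly q k (suc m) ,
      K.trans (~-body refl (*-swap B ⟦ q ⟧ u (u ^ˢ m))) (K.*-congˡ {embed u} e)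

    -- Membership in ℤ[z, z⁻¹, u] is a sum of words; this collects it into one fraction, letter by
    -- letter.
    R⇒locPoly : ∀ {x} → R 0 x → IsLocPoly x
    R⇒locPoly (respᴳ e p)       = locPoly-resp e (R⇒locPoly p)
    R⇒locPoly 0ᴳ                = locPoly-0
    R⇒locPoly 1ᴳ                = locPoly-resp (embed-cong (≈ˢ⇒≈[] (*ˢ-identityˡ 1ˢ))) (locPoly (poly-const 1ℤ) 0 0)
    R⇒locPoly (p +ᴳ q)          = locPoly-+ (R⇒locPoly p) (R⇒locPoly q)
    R⇒locPoly (base-ι a *⁰ p)   = locPoly-poly* (poly-const a) (R⇒locPoly p)
    R⇒locPoly (base-z *⁰ p)     = locPoly-poly* poly-z (R⇒locPoly p)
    R⇒locPoly (base-z⁻¹ *⁰ p)   = locPoly-z⁻¹* (R⇒locPoly p)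
    R⇒locPoly (base-u *⁰ p)     = locPoly-u* (R⇒locPoly p)

    open RawSemiringDefs (Semiring.rawSemiring K.semiring) using (sum)

    Representable : Series → Set
    Representable F = Σ[ a ∈ (Fin (2 ℕ.* N) → LocPoly) ]
      fromSeries F ≡ᴸ sumᴸ (λ i → expand w (a i) *ᴸ fromSeries (Ψ w) ^ᴸ toℕ i) [mod M ]

    representable : ∀ {F x} → Setting.I 0 x → embed F K.≈ x → Representable F
    -- Degrees were bounded by `N ℕ.* 2` because `suc n ℕ.* 2` unfolds to two successors; the bound
    -- is turned around here.
    representable {F} {x} x∈ F≈x = subst (λ n → Σ[ a ∈ (Fin n → LocPoly) ]
      fromSeries F ≡ᴸ sumᴸ (λ i → expand w (a i) *ᴸ fromSeries (Ψ w) ^ᴸ toℕ i) [mod M ]) (ℕ.*-comm N 2)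
      (a , subst (fromSeries F ≡ᴸ_[mod M ])
        (toLaurent-sum term _ (λ i → cong (expand w (a i) *ᴸ_) (toLaurent-^ (embed (Ψ w)) (toℕ i))))
        (~⇒≡ᴸ (K.trans F≈x (K.trans (proj₂ (proj₂ expansion)) (sum-cong (λ i → K.*-congʳ {embed (Ψ w) EK.^ toℕ i} (K.sym (proj₂ (loc i)))))))))
      where
      expansion : ∃[ c ] (∀ i → R 0 (c i)) × x K.≈ sum {N ℕ.* 2} (λ i → c i K.* embed (Ψ w) EK.^ toℕ i)
      expansion = poly⇒sum (poly∈ x∈)
      loc : ∀ i → IsLocPoly (proj₁ expansion i)
      loc i = R⇒locPoly (proj₁ (proj₂ expansion) i)
      a : Fin (N ℕ.* 2) → LocPoly
      a i = proj₁ (loc i)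
      term : Fin (N ℕ.* 2) → Fraction
      term i = locFraction (a i) K.* embed (Ψ w) EK.^ toℕ i
      sum-cong : ∀ {n} {f g : Fin n → Fraction} → (∀ i → f i K.≈ g i) → sum f K.≈ sum g
      sum-cong {zero}  e = K.refl
      sum-cong {suc n} e = K.+-cong (e Fin.zero) (sum-cong (λ i → e (Fin.suc i)))

    constant-* : ∀ {f g} → f 0 ≡ 1ℤ → g 0 ≡ 1ℤ → (f *ˢ g) 0 ≡ 1ℤ
    constant-* {f} {g} p q = trans (*ˢ-zero f g) (cong₂ ℤ._*_ p q)

    constant-^ : ∀ {f} → f 0 ≡ 1ℤ → ∀ n → (f ^ˢ n) 0 ≡ 1ℤ
    constant-^ p zero    = refl
    constant-^ {f} p (suc n) = constant-* {f} {f ^ˢ n} p (constant-^ p n)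

    w₀ : w 0 ≡ 0ℤ
    w₀ = trans (*ˢ-zero (const ε) (z ^ˢ suc γ)) (ℤ.*-zeroʳ ε)

    v₀ : v 0 ≡ 1ℤ
    v₀ = cong (ℤ._+_ 1ℤ) w₀

    -- The constant coefficient of `∏∞` is read off the product with the single factor j = 0.
    Ψ₀ : Ψ w 0 ≡ 1ℤ
    Ψ₀ = constant-* {1ˢ +ˢ w ^ˢ 1} {1ˢ} (cong (ℤ._+_ 1ℤ)
      (trans (*ˢ-zero w 1ˢ) (trans (ℤ.*-identityʳ (w 0)) w₀))) refl

    module _ (c₀ c₁ c₂ : Poly) (s : ℕ) (Q : MvPoly (2 ℕ.+ s)) (F : Series)
      (solves : equationLHS c₀ c₁ c₂ s Q F ≈ˢ 0ˢ) (e₁ e₂ f₁ f₂ : ℕ)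
      (leading : ⟦ c₂ ⟧ ≡ˢ z ^ˢ e₁ *ˢ v ^ˢ e₂ [mod 3 ])
      (discriminant : ⟦ c₁ ⟧ ^ˢ 2 -ˢ ⟦ c₀ ⟧ *ˢ ⟦ c₂ ⟧ ≡ˢ z ^ˢ (2 ℕ.* f₁) *ˢ v ^ˢ (2 ℕ.* f₂ ℕ.+ 1) [mod 3 ]) where

      private
        B₃ : DifferentialRing
        B₃ = seriesDifferentialRing 3
        module B₃ = DifferentialRing B₃
        module E₃ = Exp B₃.semiring
        module S₃ = SeriesModulo 3
        -- `A F` is formed with operations that do not depend on the modulus, so it can be examined
        -- modulo 3 as well as modulo `M`.
        open Differential.Equation B z ⟦ c₀ ⟧ ⟦ c₁ ⟧ ⟦ c₂ ⟧ s Q using (P; A)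

        isPoly : ∀ p → IsPoly ⟦ p ⟧
        isPoly p = p , λ _ → refl

        leading-quotient : ∃[ k ] ⟦ c₂ ⟧ ≈ˢ z ^ˢ e₁ *ˢ v ^ˢ e₂ +ˢ const (+ 3) *ˢ ⟦ k ⟧
        leading-quotient = ≡ˢ⇒poly-quotient (isPoly c₂) (poly-* (poly-^ poly-z e₁) (poly-^ poly-v e₂)) leading

        discriminant-quotient : ∃[ k ] ⟦ c₁ ⟧ ^ˢ 2 -ˢ ⟦ c₀ ⟧ *ˢ ⟦ c₂ ⟧
          ≈ˢ z ^ˢ (2 ℕ.* f₁) *ˢ v ^ˢ (2 ℕ.* f₂ ℕ.+ 1) +ˢ const (+ 3) *ˢ ⟦ k ⟧
        discriminant-quotient = ≡ˢ⇒poly-quotient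
          (poly-- (poly-^ (isPoly c₁) 2) (poly-* (isPoly c₀) (isPoly c₂)))
          (poly-* (poly-^ poly-z (2 ℕ.* f₁)) (poly-^ poly-v (2 ℕ.* f₂ ℕ.+ 1))) discriminant

        k k′ : Series
        k  = ⟦ proj₁ leading-quotient ⟧
        k′ = ⟦ proj₁ discriminant-quotient ⟧

        c₂≈ : ⟦ c₂ ⟧ ≈[ M ] z EB.^ e₁ *ˢ v EB.^ e₂ +ˢ const (+ 3) *ˢ k
        c₂≈ = B.trans (≈ˢ⇒≈[] (proj₂ leading-quotient))
          (B.reflexive (cong₂ (λ a b → a *ˢ b +ˢ const (+ 3) *ˢ k) (^ˢ≡^ z e₁) (^ˢ≡^ v e₂)))

        disc≈ : ⟦ c₁ ⟧ EB.^ 2 B.- ⟦ c₀ ⟧ *ˢ ⟦ c₂ ⟧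
          ≈[ M ] (z EB.^ f₁ *ˢ v EB.^ f₂) EB.^ 2 *ˢ v +ˢ const (+ 3) *ˢ k′
        disc≈ = B.trans (≈ˢ⇒≈[] (proj₂ discriminant-quotient))
          (B.trans (B.reflexive (cong₂ (λ a b → a *ˢ b +ˢ const (+ 3) *ˢ k′) (^ˢ≡^ z (2 ℕ.* f₁)) (^ˢ≡^ v (2 ℕ.* f₂ ℕ.+ 1))))
            (B.+-congʳ {const (+ 3) *ˢ k′} (even-odd-powers B z v f₁ f₂)))

        disc₃ : ⟦ c₁ ⟧ E₃.^ 2 B₃.- ⟦ c₀ ⟧ *ˢ ⟦ c₂ ⟧ ≈[ 3 ] (z E₃.^ f₁ *ˢ v E₃.^ f₂) E₃.^ 2 *ˢ v
        disc₃ = B₃.trans {⟦ c₁ ⟧ E₃.^ 2 B₃.- ⟦ c₀ ⟧ *ˢ ⟦ c₂ ⟧} {z ^ˢ (2 ℕ.* f₁) *ˢ v ^ˢ (2 ℕ.* f₂ ℕ.+ 1)} ⌈ discriminant ⌉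
          (B₃.trans (B₃.reflexive (cong₂ _*ˢ_ (S₃.^ˢ≡^ z (2 ℕ.* f₁)) (S₃.^ˢ≡^ v (2 ℕ.* f₂ ℕ.+ 1))))
            (even-odd-powers B₃ z v f₁ f₂))

        P≈0 : ∀ M → Differential.Equation.P (seriesDifferentialRing M) z ⟦ c₀ ⟧ ⟦ c₁ ⟧ ⟦ c₂ ⟧ s Q F ≈[ M ] const 0ℤ
        P≈0 M = subst (_≈[ M ] const 0ℤ) (equationLHS≡P M c₀ c₁ c₂ s Q F) (≈ˢ⇒≈[] solves)

        3≈0 : const (+ 3) ≈[ 3 ] const 0ℤ
        3≈0 = ⌈ (λ { zero → divides 1ℤ refl ; (suc n) → divides 0ℤ refl }) ⌉

        root : Series
        root = z ^ˢ f₁ *ˢ v ^ˢ f₂ *ˢ (v *ˢ Ψ w)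

        root≡ : root ≡ z E₃.^ f₁ *ˢ v E₃.^ f₂ *ˢ (v *ˢ Ψ w)
        root≡ = cong₂ (λ a b → a *ˢ b *ˢ (v *ˢ Ψ w)) (S₃.^ˢ≡^ z f₁) (S₃.^ˢ≡^ v f₂)

        -- `root` is z^f₁ times a series with constant coefficient 1. This is the index at which the
        -- two signs of the root are told apart.
        root-leading : root f₁ ≡ 1ℤ
        root-leading = trans (*ˢ-assoc (z ^ˢ f₁) (v ^ˢ f₂) (v *ˢ Ψ w) f₁)
          (trans (cong (z ^ˢ f₁ *ˢ (v ^ˢ f₂ *ˢ (v *ˢ Ψ w))) (sym (ℕ.+-identityʳ f₁)))
            (trans (z^*-+ f₁ (v ^ˢ f₂ *ˢ (v *ˢ Ψ w)) 0)
              (constant-* {v ^ˢ f₂} {v *ˢ Ψ w} (constant-^ {v} v₀ f₂) (constant-* {v} {Ψ w} v₀ Ψ₀))))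

        A²≈root² : A F *ˢ A F ≈[ 3 ] root *ˢ root
        A²≈root² = subst (λ r → A F *ˢ A F ≈[ 3 ] r *ˢ r) (sym root≡)
          (discriminant-square B₃ 3≈0 z ⟦ c₀ ⟧ ⟦ c₁ ⟧ ⟦ c₂ ⟧ s Q {F} {z E₃.^ f₁ *ˢ v E₃.^ f₂} {v} {Ψ w}
            (P≈0 3) disc₃ (Ψ-square-mod-3 ε γ))

        signed-root : ∃[ σ ] (σ ≡ 1ℤ ⊎ σ ≡ -1ℤ) × A F ≈[ 3 ] const σ *ˢ root
        signed-root = SquareRoots.square-root-unique f₁ {A F} {root} root-leading A²≈root²

        σ : ℤ
        σ = proj₁ signed-root

        σ² : K.ι σ K.* K.ι σ K.≈ K.ι 1ℤ
        σ² = K.trans (K.sym (K.ι-* σ σ)) (K.reflexive (cong K.ι (go σ (proj₁ (proj₂ signed-root)))))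
          where
          go : ∀ σ → σ ≡ 1ℤ ⊎ σ ≡ -1ℤ → σ ℤ.* σ ≡ 1ℤ
          go _ (inj₁ refl) = refl
          go _ (inj₂ refl) = refl

        -- An arbitrary series is enough here, since it enters only through the 3-adic filtration of
        -- the whole Laurent ring.
        A-quotient : ∃[ y ] A F ≈ˢ const σ *ˢ root +ˢ const (+ 3) *ˢ y
        A-quotient = ≡ˢ⇒quotient {3} {A F} {const σ *ˢ root} ⌊ proj₂ (proj₂ signed-root) ⌋

        A≈ : A F ≈[ M ] const σ *ˢ (z EB.^ f₁ *ˢ v EB.^ f₂ *ˢ (v *ˢ Ψ w)) +ˢ const (+ 3) *ˢ proj₁ A-quotient
        A≈ = B.trans (≈ˢ⇒≈[] (proj₂ A-quotient))
          (B.reflexive (cong₂ (λ a b → const σ *ˢ (a *ˢ b *ˢ (v *ˢ Ψ w)) +ˢ const (+ 3) *ˢ proj₁ A-quotient)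
            (^ˢ≡^ z f₁) (^ˢ≡^ v f₂)))

        module Solution = Setting.Solution (embed ⟦ c₀ ⟧) (embed ⟦ c₁ ⟧) (embed ⟦ c₂ ⟧) s Q
          (poly∈R (isPoly c₀)) (poly∈R (isPoly c₁)) (poly∈R (isPoly c₂)) e₁ e₂ f₁ f₂ (embed k) (embed k′)
          (poly∈R (isPoly (proj₁ leading-quotient))) (poly∈R (isPoly (proj₁ discriminant-quotient)))
          (H.e-leading z w {⟦ c₂ ⟧} {k} e₁ e₂ c₂≈) (H.e-discriminant z w {⟦ c₀ ⟧} {⟦ c₁ ⟧} {⟦ c₂ ⟧} {k′} f₁ f₂ disc≈)
          (embed F) (K.ι σ) (embed (proj₁ A-quotient)) (gen⁰ (base-ι σ)) σ²

        solution : ∃[ x ] Setting.I 0 x × embed F K.≈ x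
        solution = Solution.solution∈
          (K.trans (K.sym (H.e-P z ⟦ c₀ ⟧ ⟦ c₁ ⟧ ⟦ c₂ ⟧ s Q F)) (embed-cong (P≈0 M)))
          (K.trans (K.sym (H.e-A z ⟦ c₀ ⟧ ⟦ c₁ ⟧ ⟦ c₂ ⟧ s Q F)) (H.e-root z w {A F} {Ψ w} {proj₁ A-quotient} σ f₁ f₂ A≈))

      solution-representable : Representable F
      solution-representable = representable (proj₁ (proj₂ solution)) (proj₂ (proj₂ solution))

open import Defs
open import Data.Fin using (Fin; toℕ)
open import Data.Integer using (ℤ; 1ℤ; -1ℤ)
open import Data.Nat using (ℕ; zero; suc; _+_; _*_; _^_; NonZero)
open import Data.Product using (_,_; ∃-syntax; Σ-syntax)
open import Data.Sum using (_⊎_)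
open import Relation.Binary.PropositionalEquality using (_≡_)
open Conclusion using (module Representation)

theorem6p1 :
    (α γ : ℕ) .{{_ : NonZero α}} .{{_ : NonZero γ}}
    (ε : ℤ) → ε ≡ 1ℤ ⊎ ε ≡ -1ℤ →
    let w = monomial ε γ in
    (c₀ c₁ c₂ : Poly) (s : ℕ) (Q : MvPoly (2 + s)) (F : Series) →
    equationLHS c₀ c₁ c₂ s Q F ≈ˢ 0ˢ →
    (∃[ e₁ ] ∃[ e₂ ] ⟦ c₂ ⟧ ≡ˢ z ^ˢ e₁ *ˢ (1ˢ +ˢ w) ^ˢ e₂ [mod 3 ]) →
    (∃[ f₁ ] ∃[ f₂ ]
      ⟦ c₁ ⟧ ^ˢ 2 -ˢ ⟦ c₀ ⟧ *ˢ ⟦ c₂ ⟧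
        ≡ˢ z ^ˢ (2 * f₁) *ˢ (1ˢ +ˢ w) ^ˢ (2 * f₂ + 1) [mod 3 ]) →
    ((G H : Series) →
      equationLHS c₀ c₁ c₂ s Q G ≡ˢ 0ˢ [mod 3 ^ 3 ^ α ] →
      equationLHS c₀ c₁ c₂ s Q H ≡ˢ 0ˢ [mod 3 ^ 3 ^ α ] →
      G ≡ˢ H [mod 3 ^ 3 ^ α ]) →
    Σ[ a ∈ (Fin (2 * 3 ^ α) → LocPoly) ]
      fromSeries F
        ≡ᴸ sumᴸ (λ i → expand w (a i) *ᴸ fromSeries (Ψ w) ^ᴸ toℕ i)
        [mod 3 ^ 3 ^ α ]
-- For γ = 0 the monomial would be the constant ε, and Ψ would have no meaning as a limit.
theorem6p1 α zero    {{_}} {{()}}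
theorem6p1 α (suc γ) ε _ c₀ c₁ c₂ s Q F solves (e₁ , e₂ , leading) (f₁ , f₂ , discriminant) _ =
  -- The modulus 3^N with N = 3^α turns the degree bound 2N into 2 · 3^α.
  Representation.solution-representable (3 ^ α) γ ε c₀ c₁ c₂ s Q F solves e₁ e₂ f₁ f₂ leading discriminant
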